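{- Let $\alpha=(\alpha_1,\dots,\alpha_k)$ be a composition of $n$ and let $A,B$ be complementary subsets of $[k]$ ($A\cup B=[k]$, $A\cap B=\emptyset$). Let $N(\alpha,A,B)$ (resp. $N^*(\alpha,A,B)$) be the number of $(A,B)$-alternating (resp. reverse $(A,B)$-alternating) $\alpha$-permutations. (a) If $n$ is odd, then $N(\alpha,A,B)=N^*(\alpha,A,B)=\left(\prod_{i\in A}e_{\alpha_i}\prod_{j\in B}h_{\alpha_j}\right)[E,0,-E,0,E,0,-E,0,\dots]$. (b) If $n$ is even, then $N(\alpha,A,B)=\left(\prod_{i\in A}e_{\alpha_i}\prod_{j\in B}h_{\alpha_j}\right)[E,-1,-E,1,E,-1,-E,1,\dots]$ and $N^*(\alpha,A,B)=\left(\prod_{i\in A}e_{\alpha_i}\prod_{j\in B}h_{\alpha_j}\right)[E,1,-E,-1,E,1,-E,-1,\dots]$. All right-hand sides are evaluated umbrally.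
   Context: An $\alpha$-permutation is a sequence $a_1a_2\cdots a_n$ containing exactly $\alpha_i$ occurrences of $i$ for $1\le i\le k$. Comparisons between equal values are decided by $A,B$: declare $j>j$ if $j\in A$ and $j<j$ if $j\in B$ (distinct values compare as usual). The $\alpha$-permutation is $(A,B)$-alternating if $a_1>a_2<a_3>a_4<\cdots$ and reverse $(A,B)$-alternating if $a_1<a_2>a_3<a_4>\cdots$, under this convention. $e_i$ and $h_i$ are the elementary and complete homogeneous symmetric functions. Substitution: $f[a_1,a_2,\dots]$ means write $f$ as a polynomial in the power sums $p_i$ and set $p_i=a_i$; $[E,0,-E,0,\dots]$: $p_{2j+1}=(-1)^jE$, $p_{2j}=0$; $[E,-1,-E,1,\dots]$: $p_{2j+1}=(-1)^jE$, $p_{2j}=(-1)^j$; $[E,1,-E,-1,\dots]$: $p_{2j+1}=(-1)^jE$, $p_{2j}=(-1)^{j+1}$. Euler numbers $E_n$: $\sum E_nx^n/n!=\sec x+\tan x$. Umbral evaluation: expand the polynomial in the indeterminate $E$ in powers of $E$, then replace each $E^k$ by $E_k$ as the last step. -}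

module Defs where

open import Data.Nat as ℕ using (ℕ; zero; suc; _∸_; _^_; _≡ᵇ_; _<ᵇ_; _≤ᵇ_)
open import Data.Nat.DivMod using (_/_; _%_)
open import Data.Nat using (_!)
open import Data.Bool using (Bool; true; false; if_then_else_; _∧_; not)
open import Data.Integer as ℤ using (ℤ; +_)
open import Data.Rational as ℚ using (ℚ; 0ℚ; 1ℚ)
open import Data.List as L using (List; []; _∷_; _++_; map; concatMap; filterᵇ; length; foldr; upTo; allFin)
open import Data.Fin as F using (Fin; toℕ)
open import Data.Fin.Subset using (Subset)
open import Data.Vec as V using (Vec)
import Data.Bool.ListAction
open import Relation.Nullary.Decidable using (⌊_⌋)

ℕtoℚ : ℕ → ℚ
ℕtoℚ n = + n ℚ./ 1

-- 1/d for d ≥ 1 (junk value 0 at d = 0; only ever applied to d ≥ 1)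
invℕ : ℕ → ℚ
invℕ zero    = 0ℚ
invℕ (suc d) = + 1 ℚ./ suc d

sgn : ℕ → ℚ
sgn zero    = 1ℚ
sgn (suc j) = ℚ.- sgn j

sumℚ : List ℚ → ℚ
sumℚ = foldr ℚ._+_ 0ℚ

at : List ℚ → ℕ → ℚ
at []       _       = 0ℚ
at (x ∷ _)  zero    = x
at (_ ∷ xs) (suc i) = at xs i

-- Euler numbers:  Σ E_n x^n / n! = sec x + tan x = (1 + sin x) / cos x
-- (formal power series given by coefficient functions ℕ → ℚ)

cosC : ℕ → ℚ
cosC n = if n % 2 ≡ᵇ 0 then sgn (n / 2) ℚ.* invℕ (n !) else 0ℚ

sinC : ℕ → ℚ
sinC n = if n % 2 ≡ᵇ 1 then sgn (n / 2) ℚ.* invℕ (n !) else 0ℚ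

onePlusSinC : ℕ → ℚ
onePlusSinC zero    = 1ℚ
onePlusSinC (suc n) = sinC (suc n)

-- first n+1 coefficients b_0..b_n of the reciprocal 1/a of a power
-- series a with constant term a_0 = 1:
--   b_0 = 1,  b_m = - Σ_{i=1}^{m} a_i b_{m-i}
recip1UpTo : (ℕ → ℚ) → ℕ → List ℚ
recip1UpTo a zero    = 1ℚ ∷ []
recip1UpTo a (suc m) =
  let bs = recip1UpTo a m in
  bs ++ (ℚ.- sumℚ (map (λ i → a (suc i) ℚ.* at bs (m ∸ i)) (upTo (suc m))) ∷ [])

secC : ℕ → ℚ
secC n = at (recip1UpTo cosC n) n

secTanC : ℕ → ℚ
secTanC n = sumℚ (map (λ i → onePlusSinC i ℚ.* secC (n ∸ i)) (upTo (suc n)))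

euler : ℕ → ℚ
euler n = ℕtoℚ (n !) ℚ.* secTanC n

-- Polynomials in the indeterminate E over ℚ (coefficient lists,
-- constant term first)

Poly : Set
Poly = List ℚ

_⊕_ : Poly → Poly → Poly
[]      ⊕ q       = q
(a ∷ p) ⊕ []      = a ∷ p
(a ∷ p) ⊕ (b ∷ q) = (a ℚ.+ b) ∷ (p ⊕ q)

scale : ℚ → Poly → Poly
scale c = map (c ℚ.*_)

_⊗_ : Poly → Poly → Poly
[]      ⊗ q = []
(a ∷ p) ⊗ q = scale a q ⊕ (0ℚ ∷ (p ⊗ q))

constP : ℚ → Poly
constP c = c ∷ []

varE : Poly
varE = 0ℚ ∷ 1ℚ ∷ []

sumP : List Poly → Poly
sumP = foldr _⊕_ []

prodP : List Poly → Poly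
prodP = foldr _⊗_ (constP 1ℚ)

umbral : Poly → ℚ
umbral p = go 0 p
  where
  go : ℕ → Poly → ℚ
  go k []       = 0ℚ
  go k (c ∷ cs) = c ℚ.* euler k ℚ.+ go (suc k) cs

-- partitions (weakly decreasing lists of positive parts) of m with all
-- parts ≤ b, using fuel f (f ≥ m suffices since every part is ≥ 1)
partsF : ℕ → ℕ → ℕ → List (List ℕ)
partsF _       _ zero    = [] ∷ []
partsF zero    _ (suc _) = []
partsF (suc f) b (suc m) =
  concatMap (λ i → map (suc i ∷_) (partsF f (suc i) (m ∸ i)))
            (filterᵇ (λ i → (i <ᵇ b) ∧ (i ≤ᵇ m)) (upTo (suc m)))

partitions : ℕ → List (List ℕ)
partitions m = partsF m m m

sumℕ : List ℕ → ℕ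
sumℕ = foldr ℕ._+_ 0

prodℕ : List ℕ → ℕ
prodℕ = foldr ℕ._*_ 1

mult : ℕ → List ℕ → ℕ
mult i λs = length (filterᵇ (i ≡ᵇ_) λs)

zee : List ℕ → ℕ
zee λs = prodℕ (map (λ i → i ^ mult i λs ℕ.* (mult i λs) !) (upTo (suc (sumℕ λs))))

-- a specialization of the power sums: p_i ↦ σ i  (i ≥ 1)
Spec : Set
Spec = ℕ → Poly

pλ : Spec → List ℕ → Poly
pλ σ λs = prodP (map σ λs)

-- e_m = Σ_{λ ⊢ m} ε_λ z_λ⁻¹ p_λ,  ε_λ = (-1)^{m - ℓ(λ)}
eSpec : Spec → ℕ → Poly
eSpec σ m = sumP (map (λ λs → scale (sgn (m ∸ length λs) ℚ.* invℕ (zee λs)) (pλ σ λs))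
                      (partitions m))

-- h_m = Σ_{λ ⊢ m} z_λ⁻¹ p_λ
hSpec : Spec → ℕ → Poly
hSpec σ m = sumP (map (λ λs → scale (invℕ (zee λs)) (pλ σ λs)) (partitions m))

rhs : ∀ {k} → Vec ℕ k → Subset k → Subset k → Spec → ℚ
rhs {k} α A B σ = umbral (prodP (map factor (allFin k)))
  where
  factor : Fin k → Poly
  factor i = (if V.lookup A i then eSpec σ (V.lookup α i) else constP 1ℚ)
           ⊗ (if V.lookup B i then hSpec σ (V.lookup α i) else constP 1ℚ)

σodd : Spec
σodd i = if i % 2 ≡ᵇ 1 then scale (sgn (i / 2)) varE else constP 0ℚ

σminus : Spec
σminus i = if i % 2 ≡ᵇ 1 then scale (sgn (i / 2)) varE else constP (sgn (i / 2))

σplus : Spec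
σplus i = if i % 2 ≡ᵇ 1 then scale (sgn (i / 2)) varE else constP (sgn (suc (i / 2)))

words : (k n : ℕ) → List (List (Fin k))
words k zero    = [] ∷ []
words k (suc n) = concatMap (λ x → map (x ∷_) (words k n)) (allFin k)

occ : ∀ {k} → Fin k → List (Fin k) → ℕ
occ i w = length (filterᵇ (λ x → ⌊ x F.≟ i ⌋) w)

isαPerm : ∀ {k} → Vec ℕ k → List (Fin k) → Bool
isαPerm {k} α w = Data.Bool.ListAction.and (map (λ i → occ i w ≡ᵇ V.lookup α i) (allFin k))

-- x > y under the (A,B) convention (j > j iff j ∈ A)
gtAB : ∀ {k} → Subset k → Fin k → Fin k → Bool
gtAB A x y = if ⌊ x F.≟ y ⌋ then V.lookup A x else toℕ y <ᵇ toℕ x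

-- x < y under the (A,B) convention (j < j iff j ∈ B)
ltAB : ∀ {k} → Subset k → Fin k → Fin k → Bool
ltAB B x y = if ⌊ x F.≟ y ⌋ then V.lookup B x else toℕ x <ᵇ toℕ y

altFrom : ∀ {k} → Subset k → Subset k → Bool → List (Fin k) → Bool
altFrom A B d (x ∷ y ∷ w) =
  (if d then gtAB A x y else ltAB B x y) ∧ altFrom A B (not d) (y ∷ w)
altFrom A B d _ = true

Nalt : ∀ {k} → ℕ → Vec ℕ k → Subset k → Subset k → ℕ
Nalt {k} n α A B =
  length (filterᵇ (λ w → isαPerm α w ∧ altFrom A B true w) (words k n))

Nralt : ∀ {k} → ℕ → Vec ℕ k → Subset k → Subset k → ℕ
Nralt {k} n α A B =
  length (filterᵇ (λ w → isαPerm α w ∧ altFrom A B false w) (words k n))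

{-# OPTIONS --safe #-}
module Submission where

open import Defs
open import Data.Nat as ℕ using (ℕ; zero; suc; _!; _^_; _∸_; _<_; _≡ᵇ_; _<ᵇ_; _≤ᵇ_; z≤n; s≤s)
import Data.Nat.Properties as ℕₚ
open import Data.Nat.DivMod using (_/_; _%_; [m+n]%n≡m%n; m/n≡1+[m∸n]/n)
open import Data.Nat.Induction using (<-wellFounded)
open import Data.Nat.Tactic.RingSolver using () renaming (solve-∀ to solve-∀ᴺ)
import Data.Integer as ℤ
import Data.Integer.Properties as ℤₚ
open import Data.Rational using (ℚ; 0ℚ; 1ℚ; _+_; _*_; -_; _-_)
import Data.Rational.Properties as ℚₚ
open import Data.Rational.Unnormalised as ℚᵘ using (*≡*)
import Data.Rational.Unnormalised.Properties as ℚᵘₚ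
open import Data.Bool using (Bool; true; false; if_then_else_; _∧_; not)
import Data.Bool.Properties as Boolₚ
import Data.Bool.ListAction
open import Data.Fin as Fin using (Fin; zero; suc; toℕ)
import Data.Fin.Properties as Finₚ
open import Data.Fin.Subset using (Subset; _∩_; _∪_; ⊥; ⊤)
open import Data.Vec as Vec using (Vec; []; _∷_; lookup; sum)
import Data.Vec.Properties as Vecₚ
open import Data.List as List using (List; []; _∷_; _++_; _∷ʳ_; map; length; replicate; reverse; concatMap; filterᵇ; upTo; applyUpTo; allFin; tabulate)
import Data.List.Properties as Listₚ
open import Data.List.Relation.Unary.All as All using (All; []; _∷_)
open import Data.Maybe using (Maybe; just; nothing)
open import Data.Product using (_×_; _,_; proj₁; proj₂)
open import Data.Sum using (_⊎_; inj₁; inj₂)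
open import Data.Empty using (⊥-elim)
open import Function using (id; _∘_)
open import Induction.WellFounded using (Acc; acc)
open import Relation.Nullary using (yes; no)
open import Relation.Binary.PropositionalEquality using (_≡_; _≢_; _≗_; refl; sym; trans; cong; cong₂; subst; module ≡-Reasoning)
open import Tactic.RingSolver using (solve-∀)
open import Tactic.RingSolver.Core.AlmostCommutativeRing using (AlmostCommutativeRing; fromCommutativeRing)
open ≡-Reasoning

-- The umbra E ↦ E_k is evaluation at 0 of p(D) applied to the series sec + tan.  Newton's identity
-- shows that under the three specialisations every factor e_m or h_m becomes the coefficient g_m of
-- x^m in (1 + x²)^(s/2) exp (E arctan x), with s = 0 (odd n) or s = ± 1 (even n).  Since
-- exp (i arctan x) = (1 + i x) / √(1 + x²), the shift E ↦ E + i multiplies these generating functions by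
-- 1 + i x or 1 / (1 - i x), up to a change of s; applying p(D) to cos · (sec + tan) = 1 + sin therefore
-- yields a linear recurrence for the right-hand sides, whose coefficients count the strictly or weakly
-- monotone words (runs) with given multiplicities.  The numbers of alternating words satisfy the same
-- recurrence: in the sum of (-1)^j over all factorisations w = u v with u a run of length 2j and
-- v alternating, the terms cancel in pairs.

-- Umbral evaluation is not multiplicative, but p ↦ p(D) turns products into compositions; hence the
-- argument runs on linear operators and evaluates at 0 only at the end. The number i is replaced by
-- an operator J with J² = - 1 that commutes with D. In the generating function of the runs, a
-- letter that a run may repeat contributes 1 / (1 - x J), any other letter 1 + x J. Passing from D
-- to D + J, the first factor turns an exponent s into s - 1, the second turns s into s + 1. So if ŝ
-- is the exponent after the shift, s is ŝ + 1 at repeatable letters and ŝ - 1 at the others: ŝ = 0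
-- gives s = ± 1, and s = 0 throughout forces ŝ = ∓ 1. These are the even and the odd case. Exponent
-- 0 is what can be evaluated, because exp (D arctan x) fixes the constant series 1. For even n it
-- stands after the shift, and of 1 + sin only 1 survives by parity. For odd n it stands before the
-- shift and only sin survives; sin is the imaginary part of e^(ix), so a second reading of the same
-- identity, applied to the series 1, evaluates that term.

private variable
  A B I I′ I″ : Set

-- Rational arithmetic and linear operators

ℚ-ring : AlmostCommutativeRing _ _
ℚ-ring = fromCommutativeRing ℚₚ.+-*-commutativeRing isZero?
  where
  isZero? : ∀ x → Maybe (0ℚ ≡ x)
  isZero? x with 0ℚ ℚₚ.≟ x
  ... | yes p = just p
  ... | no _  = nothing

+-interchange : ∀ w x y z → w + x + (y + z) ≡ w + y + (x + z)
+-interchange = solve-∀ ℚ-ring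

*-left-comm : ∀ x y z → x * (y * z) ≡ y * (x * z)
*-left-comm = solve-∀ ℚ-ring

-- Normalisation divides by a gcd that does not reduce for a variable n, so the fractions are
-- compared in unnormalised form.
ℕtoℚ-suc : ∀ n → ℕtoℚ (suc n) ≡ 1ℚ + ℕtoℚ n
ℕtoℚ-suc n = ℚₚ.toℚᵘ-injective
  (≃-trans (ℚₚ.toℚᵘ-fromℚᵘ (ℤ.+ suc n ℚᵘ./ 1))
  (≃-trans (*≡* (cong (λ x → (ℤ.+ 1 ℤ.+ x) ℤ.* ℤ.+ 1) (sym (ℤₚ.*-identityʳ (ℤ.+ n)))))
  (≃-trans (ℚᵘₚ.+-congʳ (ℤ.+ 1 ℚᵘ./ 1) (≃-sym (ℚₚ.toℚᵘ-fromℚᵘ (ℤ.+ n ℚᵘ./ 1))))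
           (≃-sym (ℚₚ.toℚᵘ-homo-+ 1ℚ (ℕtoℚ n))))))
  where open ℚᵘₚ using (≃-trans; ≃-sym)

ℕtoℚ-+ : ∀ m n → ℕtoℚ (m ℕ.+ n) ≡ ℕtoℚ m + ℕtoℚ n
ℕtoℚ-+ zero    n = sym (ℚₚ.+-identityˡ (ℕtoℚ n))
ℕtoℚ-+ (suc m) n = begin
  ℕtoℚ (suc (m ℕ.+ n))       ≡⟨ ℕtoℚ-suc (m ℕ.+ n) ⟩
  1ℚ + ℕtoℚ (m ℕ.+ n)        ≡⟨ cong (1ℚ +_) (ℕtoℚ-+ m n) ⟩
  1ℚ + (ℕtoℚ m + ℕtoℚ n)     ≡⟨ ℚₚ.+-assoc 1ℚ (ℕtoℚ m) (ℕtoℚ n) ⟨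
  1ℚ + ℕtoℚ m + ℕtoℚ n       ≡⟨ cong (_+ ℕtoℚ n) (ℕtoℚ-suc m) ⟨
  ℕtoℚ (suc m) + ℕtoℚ n      ∎

ℕtoℚ-* : ∀ m n → ℕtoℚ (m ℕ.* n) ≡ ℕtoℚ m * ℕtoℚ n
ℕtoℚ-* zero    n = sym (ℚₚ.*-zeroˡ (ℕtoℚ n))
ℕtoℚ-* (suc m) n = begin
  ℕtoℚ (n ℕ.+ m ℕ.* n)          ≡⟨ ℕtoℚ-+ n (m ℕ.* n) ⟩
  ℕtoℚ n + ℕtoℚ (m ℕ.* n)       ≡⟨ cong (ℕtoℚ n +_) (ℕtoℚ-* m n) ⟩
  ℕtoℚ n + ℕtoℚ m * ℕtoℚ n      ≡⟨ lemma (ℕtoℚ m) (ℕtoℚ n) ⟩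
  (1ℚ + ℕtoℚ m) * ℕtoℚ n        ≡⟨ cong (_* ℕtoℚ n) (ℕtoℚ-suc m) ⟨
  ℕtoℚ (suc m) * ℕtoℚ n         ∎
  where
  lemma : ∀ a b → b + a * b ≡ (1ℚ + a) * b
  lemma = solve-∀ ℚ-ring

ℕtoℚ*invℕ : ∀ d → ℕtoℚ (suc d) * invℕ (suc d) ≡ 1ℚ
ℕtoℚ*invℕ d = ℚₚ.toℚᵘ-injective
  (≃-trans (ℚₚ.toℚᵘ-homo-* (ℕtoℚ (suc d)) (invℕ (suc d)))
  (≃-trans (ℚᵘₚ.*-cong (ℚₚ.toℚᵘ-fromℚᵘ (ℤ.+ suc d ℚᵘ./ 1)) (ℚₚ.toℚᵘ-fromℚᵘ (ℤ.+ 1 ℚᵘ./ suc d)))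
           (*≡* (cong ℤ.+_ d*1*1≡1*1*d))))
  where
  open ℚᵘₚ using (≃-trans)
  d*1*1≡1*1*d : suc d ℕ.* 1 ℕ.* 1 ≡ 1 ℕ.* (1 ℕ.* suc d)
  d*1*1≡1*1*d = trans (ℕₚ.*-identityʳ _) (trans (ℕₚ.*-comm (suc d) 1) (sym (ℕₚ.*-identityˡ _)))

-- The index types vary: ℕ for series, `Bool × ℕ` for complex series, `Vec ℕ k` for coefficients in
-- several variables. Respect for pointwise equality is a field because functions that agree
-- everywhere need not be provably equal.
record Linear (φ : (I → ℚ) → I′ → ℚ) : Set where
  field
    cong-≗ : ∀ {f g} → f ≗ g → φ f ≗ φ g
    +-homo : ∀ f g j → φ (λ i → f i + g i) j ≡ φ f j + φ g j
    *-homo : ∀ c f j → φ (λ i → c * f i) j ≡ c * φ f j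

open Linear

id-linear : Linear {I} id
id-linear = record { cong-≗ = id ; +-homo = λ _ _ _ → refl ; *-homo = λ _ _ _ → refl }

∘-linear : {φ : (I′ → ℚ) → I″ → ℚ} {ψ : (I → ℚ) → I′ → ℚ} → Linear φ → Linear ψ → Linear (φ ∘ ψ)
∘-linear {φ = φ} {ψ} φ-lin ψ-lin = record
  { cong-≗ = cong-≗ φ-lin ∘ cong-≗ ψ-lin
  ; +-homo = λ f g k → trans (cong-≗ φ-lin (+-homo ψ-lin f g) k) (+-homo φ-lin (ψ f) (ψ g) k)
  ; *-homo = λ c f k → trans (cong-≗ φ-lin (*-homo ψ-lin c f) k) (*-homo φ-lin c (ψ f) k)
  }

-- The combination c (φ + d ψ) is the shape of the recursion step of `gop`.
comb-linear : {φ ψ : (I → ℚ) → I′ → ℚ} → Linear φ → Linear ψ → ∀ c d →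
  Linear (λ a j → c * (φ a j + d * ψ a j))
comb-linear {φ = φ} {ψ} φ-lin ψ-lin c d = record
  { cong-≗ = λ f≗g j → cong₂ (λ x y → c * (x + d * y)) (cong-≗ φ-lin f≗g j) (cong-≗ ψ-lin f≗g j)
  ; +-homo = λ f g j → trans (cong₂ (λ x y → c * (x + d * y)) (+-homo φ-lin f g j) (+-homo ψ-lin f g j))
                             (distrib c d (φ f j) (φ g j) (ψ f j) (ψ g j))
  ; *-homo = λ e f j → trans (cong₂ (λ x y → c * (x + d * y)) (*-homo φ-lin e f j) (*-homo ψ-lin e f j))
                             (scal c d e (φ f j) (ψ f j))
  }
  where
  distrib : ∀ c d w x y z → c * (w + x + d * (y + z)) ≡ c * (w + d * y) + c * (x + d * z)
  distrib = solve-∀ ℚ-ring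
  scal : ∀ c d e x y → c * (e * x + d * (e * y)) ≡ e * (c * (x + d * y))
  scal = solve-∀ ℚ-ring

linear-comb : {φ : (I → ℚ) → I′ → ℚ} → Linear φ → ∀ c d f g j →
  φ (λ i → c * (f i + d * g i)) j ≡ c * (φ f j + d * φ g j)
linear-comb {φ = φ} φ-lin c d f g j = begin
  φ (λ i → c * (f i + d * g i)) j      ≡⟨ *-homo φ-lin c _ j ⟩
  c * φ (λ i → f i + d * g i) j        ≡⟨ cong (c *_) (+-homo φ-lin f _ j) ⟩
  c * (φ f j + φ (λ i → d * g i) j)    ≡⟨ cong (λ x → c * (φ f j + x)) (*-homo φ-lin d g j) ⟩
  c * (φ f j + d * φ g j)              ∎

linear-neg : {φ : (I → ℚ) → I′ → ℚ} → Linear φ → ∀ f j → φ (λ i → - f i) j ≡ - φ f j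
linear-neg {φ = φ} φ-lin f j = begin
  φ (λ i → - f i) j           ≡⟨ cong-≗ φ-lin (λ i → neg≡ (f i)) j ⟩
  φ (λ i → - 1ℚ * f i) j      ≡⟨ *-homo φ-lin (- 1ℚ) f j ⟩
  - 1ℚ * φ f j                ≡⟨ neg≡ (φ f j) ⟨
  - φ f j                     ∎
  where
  neg≡ : ∀ x → - x ≡ - 1ℚ * x
  neg≡ = solve-∀ ℚ-ring

linear-zero : {φ : (I → ℚ) → I′ → ℚ} → Linear φ → ∀ j → φ (λ _ → 0ℚ) j ≡ 0ℚ
linear-zero {φ = φ} φ-lin j = begin
  φ (λ _ → 0ℚ) j          ≡⟨ cong-≗ φ-lin (λ _ → sym (ℚₚ.*-zeroˡ 0ℚ)) j ⟩
  φ (λ _ → 0ℚ * 0ℚ) j     ≡⟨ *-homo φ-lin 0ℚ (λ _ → 0ℚ) j ⟩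
  0ℚ * φ (λ _ → 0ℚ) j     ≡⟨ ℚₚ.*-zeroˡ (φ (λ _ → 0ℚ) j) ⟩
  0ℚ                      ∎

-- gop T s m is the coefficient of x^m in (1 + x²)^(s/2) exp (T arctan x), read off from the
-- differential equation (1 + x²) G′ = (T + s x) G.
gop : ((I → ℚ) → I → ℚ) → ℚ → ℕ → (I → ℚ) → I → ℚ
gop T s zero          a = a
gop T s (suc zero)    a = T a
gop T s (suc (suc m)) a = λ i → invℕ (suc (suc m)) * (T (gop T s (suc m) a) i + (s - ℕtoℚ m) * gop T s m a i)

-- The coefficient of x^(m+1) in the differential equation: x² G′ contributes m g_m on the left and
-- s x G contributes s g_m on the right.
gop-rec : ∀ (T : (I → ℚ) → I → ℚ) s m a i →
  ℕtoℚ (suc (suc m)) * gop T s (suc (suc m)) a i ≡ T (gop T s (suc m) a) i + (s - ℕtoℚ m) * gop T s m a i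
gop-rec T s m a i = begin
  ℕtoℚ (suc (suc m)) * (invℕ (suc (suc m)) * x)  ≡⟨ ℚₚ.*-assoc (ℕtoℚ (suc (suc m))) (invℕ (suc (suc m))) x ⟨
  ℕtoℚ (suc (suc m)) * invℕ (suc (suc m)) * x    ≡⟨ cong (_* x) (ℕtoℚ*invℕ (suc m)) ⟩
  1ℚ * x                                         ≡⟨ ℚₚ.*-identityˡ x ⟩
  x                                              ∎
  where x = T (gop T s (suc m) a) i + (s - ℕtoℚ m) * gop T s m a i

gop-linear : {T : (I → ℚ) → I → ℚ} → Linear T → ∀ s m → Linear (gop T s m)
gop-linear T-lin s zero          = id-linear
gop-linear T-lin s (suc zero)    = T-lin
gop-linear T-lin s (suc (suc m)) =
  comb-linear (∘-linear T-lin (gop-linear T-lin s (suc m))) (gop-linear T-lin s m) (invℕ (suc (suc m))) (s - ℕtoℚ m)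

-- `gop T s m` is a polynomial in T with rational coefficients, so whatever carries T to T′ carries
-- it along. Instances of φ are `Jᶜ`, the embedding of real series, multiplication by e^(ix) and x ↦
-- - x.
gop-intertwine : {T : (I → ℚ) → I → ℚ} {T′ : (I′ → ℚ) → I′ → ℚ} {φ : (I → ℚ) → I′ → ℚ} →
  Linear T′ → Linear φ → (∀ a → φ (T a) ≗ T′ (φ a)) → ∀ s m a → φ (gop T s m a) ≗ gop T′ s m (φ a)
gop-intertwine T′-lin φ-lin φT s zero          a j = refl
gop-intertwine T′-lin φ-lin φT s (suc zero)    a j = φT a j
gop-intertwine {T = T} {T′} {φ} T′-lin φ-lin φT s (suc (suc m)) a j =
  trans (linear-comb φ-lin c d (T (gop T s (suc m) a)) (gop T s m a) j)
        (cong₂ (λ x y → c * (x + d * y))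
          (trans (φT (gop T s (suc m) a) j) (cong-≗ T′-lin (gop-intertwine T′-lin φ-lin φT s (suc m) a) j))
          (gop-intertwine T′-lin φ-lin φT s m a j))
  where
  c = invℕ (suc (suc m))
  d = s - ℕtoℚ m

gop-≗ : {T T′ : (I → ℚ) → I → ℚ} → Linear T′ → (∀ a → T a ≗ T′ a) → ∀ s m a → gop T s m a ≗ gop T′ s m a
gop-≗ T′-lin T≗T′ = gop-intertwine T′-lin id-linear T≗T′

-- Shifting T by a square root of minus one

module Shift (T J : (I → ℚ) → I → ℚ) (T-lin : Linear T) (J-lin : Linear J)
  (JT : ∀ a → J (T a) ≗ T (J a)) (JJ : ∀ a i → J (J a) i ≡ - a i) where

  T⁺ : (I → ℚ) → I → ℚ
  T⁺ a i = T a i + J a i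

  T⁺-linear : Linear T⁺
  T⁺-linear = record
    { cong-≗ = λ f≗g i → cong₂ _+_ (cong-≗ T-lin f≗g i) (cong-≗ J-lin f≗g i)
    ; +-homo = λ f g i → trans (cong₂ _+_ (+-homo T-lin f g i) (+-homo J-lin f g i)) (+-interchange (T f i) (T g i) (J f i) (J g i))
    ; *-homo = λ c f i → trans (cong₂ _+_ (*-homo T-lin c f i) (*-homo J-lin c f i)) (sym (ℚₚ.*-distribˡ-+ c (T f i) (J f i)))
    }

  private
    T⁺-step : ∀ u v i → T⁺ (λ i → u i + J v i) i ≡ T u i + J (T v) i + J u i - v i
    T⁺-step u v i = begin
      T (λ i → u i + J v i) i + J (λ i → u i + J v i) i  ≡⟨ cong₂ _+_ (+-homo T-lin u (J v) i) (+-homo J-lin u (J v) i) ⟩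
      T u i + T (J v) i + (J u i + J (J v) i)            ≡⟨ cong₂ (λ x y → T u i + x + (J u i + y)) (sym (JT v i)) (JJ v i) ⟩
      T u i + J (T v) i + (J u i + - v i)                ≡⟨ ℚₚ.+-assoc (T u i + J (T v) i) (J u i) (- v i) ⟨
      T u i + J (T v) i + J u i - v i                    ∎

  -- (1 + x²)^(s/2) exp ((T + J) arctan x) = (1 + x J) (1 + x²)^((s-1)/2) exp (T arctan x).
  gop-shift : ∀ s m a i → gop T⁺ s (suc m) a i ≡ gop T (s - 1ℚ) (suc m) a i + J (gop T (s - 1ℚ) m a) i
  gop-shift s zero          a i = refl
  -- The general step applies the recurrence to the coefficient one degree lower; here that
  -- coefficient has index 1, where there is no recurrence.
  gop-shift s (suc zero)    a i = begin
    iv * (T⁺ (T⁺ a) i + (s - 0ℚ) * a i)                                     ≡⟨ cong (λ x → iv * (x + (s - 0ℚ) * a i)) (T⁺-step (T a) a i) ⟩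
    iv * (T (T a) i + J (T a) i + J (T a) i - a i + (s - 0ℚ) * a i)         ≡⟨ regroup iv s (T (T a) i) (J (T a) i) (a i) ⟩
    iv * (T (T a) i + (s - 1ℚ - 0ℚ) * a i) + (1ℚ + 1ℚ) * iv * J (T a) i     ≡⟨ cong (λ x → iv * (T (T a) i + (s - 1ℚ - 0ℚ) * a i) + x * J (T a) i) (ℕtoℚ*invℕ 1) ⟩
    iv * (T (T a) i + (s - 1ℚ - 0ℚ) * a i) + 1ℚ * J (T a) i                 ≡⟨ cong (iv * (T (T a) i + (s - 1ℚ - 0ℚ) * a i) +_) (ℚₚ.*-identityˡ (J (T a) i)) ⟩
    iv * (T (T a) i + (s - 1ℚ - 0ℚ) * a i) + J (T a) i                      ∎
    where
    iv = invℕ 2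
    regroup : ∀ iv s x y z → iv * (x + y + y - z + (s - 0ℚ) * z) ≡ iv * (x + (s - 1ℚ - 0ℚ) * z) + (1ℚ + 1ℚ) * iv * y
    regroup = solve-∀ ℚ-ring
  gop-shift s (suc (suc m)) a i = begin
    iv * (T⁺ (gop T⁺ s (2 ℕ.+ m) a) i + (s - n) * gop T⁺ s (1 ℕ.+ m) a i)
      ≡⟨ cong₂ (λ x y → iv * (x + (s - n) * y))
           (trans (cong-≗ T⁺-linear (gop-shift s (suc m) a) i) (T⁺-step g₂ g₁ i)) (gop-shift s m a i) ⟩
    iv * (T g₂ i + J (T g₁) i + J g₂ i - g₁ i + (s - n) * (g₁ i + J g₀ i))
      ≡⟨ regroup iv (T g₂ i) (J (T g₁) i) (J g₂ i) (g₁ i) (J g₀ i) s n ⟩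
    iv * (T g₂ i + (s - 1ℚ - n) * g₁ i) + iv * (J g₂ i + (J (T g₁) i + (s - n) * J g₀ i))
      ≡⟨ cong (λ x → iv * (T g₂ i + (s - 1ℚ - n) * g₁ i) + iv * (J g₂ i + x)) J-rec ⟩
    iv * (T g₂ i + (s - 1ℚ - n) * g₁ i) + iv * (J g₂ i + ℕtoℚ (2 ℕ.+ m) * J g₂ i)
      ≡⟨ cong (iv * (T g₂ i + (s - 1ℚ - n) * g₁ i) +_) cancel ⟩
    iv * (T g₂ i + (s - 1ℚ - n) * g₁ i) + J g₂ i
      ∎
    where
    iv = invℕ (3 ℕ.+ m)
    n  = ℕtoℚ (suc m)
    g₀ = gop T (s - 1ℚ) m a
    g₁ = gop T (s - 1ℚ) (1 ℕ.+ m) a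
    g₂ = gop T (s - 1ℚ) (2 ℕ.+ m) a
    regroup : ∀ iv x y z u v s n → iv * (x + y + z - u + (s - n) * (u + v)) ≡ iv * (x + (s - 1ℚ - n) * u) + iv * (z + (y + (s - n) * v))
    regroup = solve-∀ ℚ-ring
    shift-s : ∀ s n x → (s - (1ℚ + n)) * x ≡ (s - 1ℚ - n) * x
    shift-s = solve-∀ ℚ-ring
    factor : ∀ iv n x → iv * (x + n * x) ≡ (1ℚ + n) * iv * x
    factor = solve-∀ ℚ-ring
    -- J applied to the recurrence for g₂: lowering s by 1 compensates that n is one more than m, as
    -- s - (m + 1) = (s - 1) - m.
    J-rec : J (T g₁) i + (s - n) * J g₀ i ≡ ℕtoℚ (2 ℕ.+ m) * J g₂ i
    J-rec = begin
      J (T g₁) i + (s - n) * J g₀ i                       ≡⟨ cong (λ x → J (T g₁) i + (s - x) * J g₀ i) (ℕtoℚ-suc m) ⟩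
      J (T g₁) i + (s - (1ℚ + ℕtoℚ m)) * J g₀ i           ≡⟨ cong (J (T g₁) i +_) (shift-s s (ℕtoℚ m) (J g₀ i)) ⟩
      J (T g₁) i + (s - 1ℚ - ℕtoℚ m) * J g₀ i             ≡⟨ cong (J (T g₁) i +_) (*-homo J-lin (s - 1ℚ - ℕtoℚ m) g₀ i) ⟨
      J (T g₁) i + J (λ i → (s - 1ℚ - ℕtoℚ m) * g₀ i) i   ≡⟨ +-homo J-lin (T g₁) _ i ⟨
      J (λ i → T g₁ i + (s - 1ℚ - ℕtoℚ m) * g₀ i) i       ≡⟨ cong-≗ J-lin (gop-rec T (s - 1ℚ) m a) i ⟨
      J (λ i → ℕtoℚ (2 ℕ.+ m) * g₂ i) i                   ≡⟨ *-homo J-lin (ℕtoℚ (2 ℕ.+ m)) g₂ i ⟩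
      ℕtoℚ (2 ℕ.+ m) * J g₂ i                             ∎
    -- The J-terms add up to 1 + (m + 2) copies of J g₂, which absorbs the denominator m + 3.
    cancel : iv * (J g₂ i + ℕtoℚ (2 ℕ.+ m) * J g₂ i) ≡ J g₂ i
    cancel = begin
      iv * (J g₂ i + ℕtoℚ (2 ℕ.+ m) * J g₂ i)   ≡⟨ factor iv (ℕtoℚ (2 ℕ.+ m)) (J g₂ i) ⟩
      (1ℚ + ℕtoℚ (2 ℕ.+ m)) * iv * J g₂ i       ≡⟨ cong (λ x → x * iv * J g₂ i) (ℕtoℚ-suc (2 ℕ.+ m)) ⟨
      ℕtoℚ (3 ℕ.+ m) * iv * J g₂ i              ≡⟨ cong (_* J g₂ i) (ℕtoℚ*invℕ (2 ℕ.+ m)) ⟩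
      1ℚ * J g₂ i                               ≡⟨ ℚₚ.*-identityˡ (J g₂ i) ⟩
      J g₂ i                                    ∎

neg-linear : {φ : (I → ℚ) → I′ → ℚ} → Linear φ → Linear (λ a j → - φ a j)
neg-linear {φ = φ} φ-lin = record
  { cong-≗ = λ f≗g j → cong -_ (cong-≗ φ-lin f≗g j)
  ; +-homo = λ f g j → trans (cong -_ (+-homo φ-lin f g j)) (ℚₚ.neg-distrib-+ (φ f j) (φ g j))
  ; *-homo = λ c f j → trans (cong -_ (*-homo φ-lin c f j)) (ℚₚ.neg-distribʳ-* c (φ f j))
  }

module Unshift (T J : (I → ℚ) → I → ℚ) (T-lin : Linear T) (J-lin : Linear J)
  (JT : ∀ a → J (T a) ≗ T (J a)) (JJ : ∀ a i → J (J a) i ≡ - a i) where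
  open Shift T J T-lin J-lin JT JJ

  private
    double : ∀ x → - (- x) ≡ x
    double = solve-∀ ℚ-ring

    -- The inverse shift: - J also squares to - 1, and T + J - J = T.
    module Back = Shift T⁺ (λ a i → - J a i) T⁺-linear (neg-linear J-lin)
      (λ a i → trans (cong -_ (trans (+-homo J-lin (T a) (J a) i) (cong (_+ J (J a) i) (JT a i))))
                     (sym (linear-neg T⁺-linear (J a) i)))
      (λ a i → trans (cong -_ (linear-neg J-lin (J a) i)) (trans (double (J (J a) i)) (JJ a i)))

  -- Shifting back multiplies by 1 - x J and raises s by 1. Solved for its top coefficient, this
  -- divides by 1 - x J without a geometric series; the unknown recurs on the right one degree
  -- lower.
  gop-unshift : ∀ s m a i → gop T⁺ s (suc m) a i ≡ gop T (s + 1ℚ) (suc m) a i + J (gop T⁺ s m a) i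
  gop-unshift s m a i = begin
    gop T⁺ s (suc m) a i
      ≡⟨ add-sub (gop T⁺ s (suc m) a i) (J (gop T⁺ s m a) i) ⟩
    gop T⁺ s (suc m) a i + - J (gop T⁺ s m a) i + J (gop T⁺ s m a) i
      ≡⟨ cong (λ t → gop T⁺ t (suc m) a i + - J (gop T⁺ t m a) i + J (gop T⁺ s m a) i) (sub-add s) ⟨
    gop T⁺ (s + 1ℚ - 1ℚ) (suc m) a i + - J (gop T⁺ (s + 1ℚ - 1ℚ) m a) i + J (gop T⁺ s m a) i
      ≡⟨ cong (_+ J (gop T⁺ s m a) i) (Back.gop-shift (s + 1ℚ) m a i) ⟨
    gop Back.T⁺ (s + 1ℚ) (suc m) a i + J (gop T⁺ s m a) i
      ≡⟨ cong (_+ J (gop T⁺ s m a) i) (gop-≗ T-lin (λ a i → sym (add-sub′ (T a i) (J a i))) (s + 1ℚ) (suc m) a i) ⟩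
    gop T (s + 1ℚ) (suc m) a i + J (gop T⁺ s m a) i
      ∎
    where
    add-sub : ∀ x y → x ≡ x + - y + y
    add-sub = solve-∀ ℚ-ring
    add-sub′ : ∀ x y → x ≡ x + y + - y
    add-sub′ = solve-∀ ℚ-ring
    sub-add : ∀ s → s + 1ℚ - 1ℚ ≡ s
    sub-add = solve-∀ ℚ-ring

invℕ-unique : ∀ d x → ℕtoℚ (suc d) * x ≡ 1ℚ → x ≡ invℕ (suc d)
invℕ-unique d x eq = begin
  x                                      ≡⟨ ℚₚ.*-identityˡ x ⟨
  1ℚ * x                                 ≡⟨ cong (_* x) (ℕtoℚ*invℕ d) ⟨
  ℕtoℚ (suc d) * invℕ (suc d) * x        ≡⟨ swap (ℕtoℚ (suc d)) (invℕ (suc d)) x ⟩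
  invℕ (suc d) * (ℕtoℚ (suc d) * x)      ≡⟨ cong (invℕ (suc d) *_) eq ⟩
  invℕ (suc d) * 1ℚ                      ≡⟨ ℚₚ.*-identityʳ (invℕ (suc d)) ⟩
  invℕ (suc d)                           ∎
  where
  swap : ∀ x y z → x * y * z ≡ y * (x * z)
  swap = solve-∀ ℚ-ring

invℕ-* : ∀ m n → invℕ (m ℕ.* n) ≡ invℕ m * invℕ n
invℕ-* zero    n       = sym (ℚₚ.*-zeroˡ (invℕ n))
invℕ-* (suc m) zero    = trans (cong invℕ (ℕₚ.*-zeroʳ m)) (sym (ℚₚ.*-zeroʳ (invℕ (suc m))))
invℕ-* (suc m) (suc n) = sym (invℕ-unique (n ℕ.+ m ℕ.* suc n) (invℕ (suc m) * invℕ (suc n)) (begin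
  ℕtoℚ (suc m ℕ.* suc n) * (invℕ (suc m) * invℕ (suc n))              ≡⟨ cong (_* (invℕ (suc m) * invℕ (suc n))) (ℕtoℚ-* (suc m) (suc n)) ⟩
  ℕtoℚ (suc m) * ℕtoℚ (suc n) * (invℕ (suc m) * invℕ (suc n))         ≡⟨ swap (ℕtoℚ (suc m)) (ℕtoℚ (suc n)) (invℕ (suc m)) (invℕ (suc n)) ⟩
  ℕtoℚ (suc m) * invℕ (suc m) * (ℕtoℚ (suc n) * invℕ (suc n))         ≡⟨ cong₂ _*_ (ℕtoℚ*invℕ m) (ℕtoℚ*invℕ n) ⟩
  1ℚ * 1ℚ                                                             ≡⟨ ℚₚ.*-identityˡ 1ℚ ⟩
  1ℚ                                                                  ∎))
  where
  swap : ∀ w x y z → w * x * (y * z) ≡ w * y * (x * z)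
  swap = solve-∀ ℚ-ring

ℕtoℚ*invℕ! : ∀ n → ℕtoℚ (suc n) * invℕ (suc n !) ≡ invℕ (n !)
ℕtoℚ*invℕ! n = begin
  ℕtoℚ (suc n) * invℕ (suc n !)                    ≡⟨ cong (ℕtoℚ (suc n) *_) (invℕ-* (suc n) (n !)) ⟩
  ℕtoℚ (suc n) * (invℕ (suc n) * invℕ (n !))       ≡⟨ ℚₚ.*-assoc (ℕtoℚ (suc n)) (invℕ (suc n)) (invℕ (n !)) ⟨
  ℕtoℚ (suc n) * invℕ (suc n) * invℕ (n !)         ≡⟨ cong (_* invℕ (n !)) (ℕtoℚ*invℕ n) ⟩
  1ℚ * invℕ (n !)                                  ≡⟨ ℚₚ.*-identityˡ (invℕ (n !)) ⟩
  invℕ (n !)                                       ∎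

-- Formal power series

Series : Set
Series = ℕ → ℚ

D : Series → Series
D a n = ℕtoℚ (suc n) * a (suc n)

D-linear : Linear D
D-linear = record
  { cong-≗ = λ f≗g n → cong (ℕtoℚ (suc n) *_) (f≗g (suc n))
  ; +-homo = λ f g n → ℚₚ.*-distribˡ-+ (ℕtoℚ (suc n)) (f (suc n)) (g (suc n))
  ; *-homo = λ c f n → *-left-comm (ℕtoℚ (suc n)) c (f (suc n))
  }

conv : Series → Series → Series
conv a b zero    = a 0 * b 0
conv a b (suc n) = a 0 * b (suc n) + conv (a ∘ suc) b n

-- The sums that define `recip1UpTo` and `secTanC` index with truncated subtraction. Peeling off the
-- leading coefficient avoids it, so the later arguments use `conv`.
conv-sum : ∀ a b n → sumℚ (map (λ i → a i * b (n ∸ i)) (upTo (suc n))) ≡ conv a b n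
conv-sum a b n = trans (cong sumℚ (Listₚ.map-upTo (λ i → a i * b (n ∸ i)) (suc n))) (go a n)
  where
  go : ∀ a n → sumℚ (applyUpTo (λ i → a i * b (n ∸ i)) (suc n)) ≡ conv a b n
  go a zero    = ℚₚ.+-identityʳ (a 0 * b 0)
  go a (suc n) = cong (a 0 * b (suc n) +_) (go (a ∘ suc) n)

conv-congˡ : ∀ {a a′} b → a ≗ a′ → conv a b ≗ conv a′ b
conv-congˡ b a≗a′ zero    = cong (_* b 0) (a≗a′ 0)
conv-congˡ b a≗a′ (suc n) = cong₂ (λ x y → x * b (suc n) + y) (a≗a′ 0) (conv-congˡ b (a≗a′ ∘ suc) n)

-- The bound is needed for reciprocals, where only a finite list of coefficients is at hand.
conv-congʳ-≤ : ∀ a {b b′} n → (∀ j → j ℕ.≤ n → b j ≡ b′ j) → conv a b n ≡ conv a b′ n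
conv-congʳ-≤ a zero    b≡b′ = cong (a 0 *_) (b≡b′ 0 z≤n)
conv-congʳ-≤ a (suc n) b≡b′ = cong₂ (λ x y → a 0 * x + y) (b≡b′ (suc n) ℕₚ.≤-refl)
  (conv-congʳ-≤ (a ∘ suc) n (λ j j≤n → b≡b′ j (ℕₚ.m≤n⇒m≤1+n j≤n)))

conv-congʳ : ∀ a {b b′} → b ≗ b′ → conv a b ≗ conv a b′
conv-congʳ a b≗b′ n = conv-congʳ-≤ a n (λ j _ → b≗b′ j)

conv-linearˡ : ∀ b → Linear (λ a → conv a b)
conv-linearˡ b = record { cong-≗ = conv-congˡ b ; +-homo = add ; *-homo = mul }
  where
  step : ∀ w x y z c → (w + x) * c + (y + z) ≡ w * c + y + (x * c + z)
  step = solve-∀ ℚ-ring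
  step′ : ∀ c x y z → c * x * y + c * z ≡ c * (x * y + z)
  step′ = solve-∀ ℚ-ring
  add : ∀ f g n → conv (λ i → f i + g i) b n ≡ conv f b n + conv g b n
  add f g zero    = ℚₚ.*-distribʳ-+ (b 0) (f 0) (g 0)
  add f g (suc n) = trans (cong ((f 0 + g 0) * b (suc n) +_) (add (f ∘ suc) (g ∘ suc) n))
    (step (f 0) (g 0) (conv (f ∘ suc) b n) (conv (g ∘ suc) b n) (b (suc n)))
  mul : ∀ c f n → conv (λ i → c * f i) b n ≡ c * conv f b n
  mul c f zero    = ℚₚ.*-assoc c (f 0) (b 0)
  mul c f (suc n) = trans (cong (c * f 0 * b (suc n) +_) (mul c (f ∘ suc) n)) (step′ c (f 0) (b (suc n)) (conv (f ∘ suc) b n))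

conv-last : ∀ a b n → conv a b (suc n) ≡ conv a (b ∘ suc) n + a (suc n) * b 0
conv-last a b zero    = refl
conv-last a b (suc n) = trans (cong (a 0 * b (2 ℕ.+ n) +_) (conv-last (a ∘ suc) b n))
  (sym (ℚₚ.+-assoc (a 0 * b (2 ℕ.+ n)) (conv (a ∘ suc) (b ∘ suc) n) (a (2 ℕ.+ n) * b 0)))

conv-comm : ∀ a b → conv a b ≗ conv b a
conv-comm a b zero    = ℚₚ.*-comm (a 0) (b 0)
conv-comm a b (suc n) = begin
  a 0 * b (suc n) + conv (a ∘ suc) b n   ≡⟨ cong₂ _+_ (ℚₚ.*-comm (a 0) (b (suc n))) (conv-comm (a ∘ suc) b n) ⟩
  b (suc n) * a 0 + conv b (a ∘ suc) n   ≡⟨ ℚₚ.+-comm (b (suc n) * a 0) (conv b (a ∘ suc) n) ⟩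
  conv b (a ∘ suc) n + b (suc n) * a 0   ≡⟨ conv-last b a n ⟨
  conv b a (suc n)                       ∎

conv-assoc : ∀ a b c → conv (conv a b) c ≗ conv a (conv b c)
conv-assoc a b c zero    = ℚₚ.*-assoc (a 0) (b 0) (c 0)
conv-assoc a b c (suc n) = begin
  a 0 * b 0 * c (suc n) + conv (λ i → a 0 * b (suc i) + conv (a ∘ suc) b i) c n
    ≡⟨ cong (a 0 * b 0 * c (suc n) +_) (+-homo (conv-linearˡ c) (λ i → a 0 * b (suc i)) (conv (a ∘ suc) b) n) ⟩
  a 0 * b 0 * c (suc n) + (conv (λ i → a 0 * b (suc i)) c n + conv (conv (a ∘ suc) b) c n)
    ≡⟨ cong₂ (λ x y → a 0 * b 0 * c (suc n) + (x + y)) (*-homo (conv-linearˡ c) (a 0) (b ∘ suc) n) (conv-assoc (a ∘ suc) b c n) ⟩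
  a 0 * b 0 * c (suc n) + (a 0 * conv (b ∘ suc) c n + conv (a ∘ suc) (conv b c) n)
    ≡⟨ regroup (a 0) (b 0) (c (suc n)) (conv (b ∘ suc) c n) (conv (a ∘ suc) (conv b c) n) ⟩
  a 0 * (b 0 * c (suc n) + conv (b ∘ suc) c n) + conv (a ∘ suc) (conv b c) n
    ∎
  where
  regroup : ∀ x y z u v → x * y * z + (x * u + v) ≡ x * (y * z + u) + v
  regroup = solve-∀ ℚ-ring

-- The Euler operator θ = x d/dx keeps degrees, so its product rule follows by induction; D is θ
-- with the index lowered by one, and the constant terms that θ kills drop out.
D-conv : ∀ a b n → D (conv a b) n ≡ conv (D a) b n + conv a (D b) n
D-conv a b n = begin
  ℕtoℚ (suc n) * conv a b (suc n)
    ≡⟨ θ-conv a b (suc n) ⟩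
  0ℚ * a 0 * b (suc n) + conv (D a) b n + conv a (θ b) (suc n)
    ≡⟨ cong (0ℚ * a 0 * b (suc n) + conv (D a) b n +_) (conv-last a (θ b) n) ⟩
  0ℚ * a 0 * b (suc n) + conv (D a) b n + (conv a (D b) n + a (suc n) * (0ℚ * b 0))
    ≡⟨ drop (a 0) (b (suc n)) (conv (D a) b n) (conv a (D b) n) (a (suc n)) (b 0) ⟩
  conv (D a) b n + conv a (D b) n
    ∎
  where
  θ : Series → Series
  θ a n = ℕtoℚ n * a n
  drop : ∀ x y z u v w → 0ℚ * x * y + z + (u + v * (0ℚ * w)) ≡ z + u
  drop = solve-∀ ℚ-ring
  regroup : ∀ n x y u v w → n * (x * y) + (u + w + v) ≡ 0ℚ * x * y + (u + w) + (x * (n * y) + v)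
  regroup = solve-∀ ℚ-ring
  expand : ∀ n x y z → (1ℚ + n) * (x * y + z) ≡ (1ℚ + n) * (x * y) + (n * z + z)
  expand = solve-∀ ℚ-ring
  split : ∀ n x → n * x + x ≡ (1ℚ + n) * x
  split = solve-∀ ℚ-ring
  rot : ∀ x y z → x + y + z ≡ x + z + y
  rot = solve-∀ ℚ-ring
  θ-conv : ∀ a b n → ℕtoℚ n * conv a b n ≡ conv (θ a) b n + conv a (θ b) n
  θ-conv a b zero    = base (a 0) (b 0)
    where
    base : ∀ x y → 0ℚ * (x * y) ≡ 0ℚ * x * y + x * (0ℚ * y)
    base = solve-∀ ℚ-ring
  θ-conv a b (suc n) = begin
    ℕtoℚ (suc n) * (a 0 * b (suc n) + conv a′ b n)
      ≡⟨ cong (_* (a 0 * b (suc n) + conv a′ b n)) (ℕtoℚ-suc n) ⟩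
    (1ℚ + ℕtoℚ n) * (a 0 * b (suc n) + conv a′ b n)
      ≡⟨ expand (ℕtoℚ n) (a 0) (b (suc n)) (conv a′ b n) ⟩
    (1ℚ + ℕtoℚ n) * (a 0 * b (suc n)) + (ℕtoℚ n * conv a′ b n + conv a′ b n)
      ≡⟨ cong₂ (λ k x → k * (a 0 * b (suc n)) + (x + conv a′ b n)) (sym (ℕtoℚ-suc n)) (θ-conv a′ b n) ⟩
    ℕtoℚ (suc n) * (a 0 * b (suc n)) + (conv (θ a′) b n + conv a′ (θ b) n + conv a′ b n)
      ≡⟨ cong (ℕtoℚ (suc n) * (a 0 * b (suc n)) +_) (rot (conv (θ a′) b n) (conv a′ (θ b) n) (conv a′ b n)) ⟩
    ℕtoℚ (suc n) * (a 0 * b (suc n)) + (conv (θ a′) b n + conv a′ b n + conv a′ (θ b) n)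
      ≡⟨ regroup (ℕtoℚ (suc n)) (a 0) (b (suc n)) (conv (θ a′) b n) (conv a′ (θ b) n) (conv a′ b n) ⟩
    0ℚ * a 0 * b (suc n) + (conv (θ a′) b n + conv a′ b n) + (a 0 * (ℕtoℚ (suc n) * b (suc n)) + conv a′ (θ b) n)
      ≡⟨ cong (λ x → 0ℚ * a 0 * b (suc n) + x + (a 0 * (ℕtoℚ (suc n) * b (suc n)) + conv a′ (θ b) n)) (+-homo (conv-linearˡ b) (θ a′) a′ n) ⟨
    0ℚ * a 0 * b (suc n) + conv (λ i → θ a′ i + a′ i) b n + (a 0 * (ℕtoℚ (suc n) * b (suc n)) + conv a′ (θ b) n)
      ≡⟨ cong (λ x → 0ℚ * a 0 * b (suc n) + x + (a 0 * (ℕtoℚ (suc n) * b (suc n)) + conv a′ (θ b) n))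
              (conv-congˡ b (λ i → trans (split (ℕtoℚ i) (a′ i)) (cong (_* a′ i) (sym (ℕtoℚ-suc i)))) n) ⟩
    0ℚ * a 0 * b (suc n) + conv (θ a ∘ suc) b n + (a 0 * (ℕtoℚ (suc n) * b (suc n)) + conv a′ (θ b) n)
      ∎
    where a′ = a ∘ suc

-- Powers of i, sine, cosine, and secant plus tangent

reI imI : ℕ → ℚ
reI zero    = 1ℚ
reI (suc n) = - imI n
imI zero    = 0ℚ
imI (suc n) = reI n

2+n%2 : ∀ n → (2 ℕ.+ n) % 2 ≡ n % 2
2+n%2 n = trans (cong (_% 2) (ℕₚ.+-comm 2 n)) ([m+n]%n≡m%n n 2)

2+n/2 : ∀ n → (2 ℕ.+ n) / 2 ≡ suc (n / 2)
2+n/2 n = m/n≡1+[m∸n]/n {2 ℕ.+ n} {2} (s≤s (s≤s z≤n))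

private
  if-neg : ∀ (b : Bool) x y → (if b then - x * y else 0ℚ) ≡ - (if b then x * y else 0ℚ)
  if-neg true  x y = sym (ℚₚ.neg-distribˡ-* x y)
  if-neg false x y = refl

-- `reI n` and `imI n` are the parts of i^n; two steps in n change the sign of both sides. This
-- trades the quotient and remainder in `cosC` for a recursion.
reI-parity : ∀ n x → (if n % 2 ≡ᵇ 0 then sgn (n / 2) * x else 0ℚ) ≡ reI n * x
reI-parity zero          x = refl
reI-parity (suc zero)    x = sym (ℚₚ.*-zeroˡ x)
reI-parity (suc (suc n)) x = begin
  (if (2 ℕ.+ n) % 2 ≡ᵇ 0 then sgn ((2 ℕ.+ n) / 2) * x else 0ℚ)  ≡⟨ cong₂ (λ r q → if r ≡ᵇ 0 then sgn q * x else 0ℚ) (2+n%2 n) (2+n/2 n) ⟩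
  (if n % 2 ≡ᵇ 0 then - sgn (n / 2) * x else 0ℚ)                ≡⟨ if-neg (n % 2 ≡ᵇ 0) (sgn (n / 2)) x ⟩
  - (if n % 2 ≡ᵇ 0 then sgn (n / 2) * x else 0ℚ)                ≡⟨ cong -_ (reI-parity n x) ⟩
  - (reI n * x)                                                 ≡⟨ ℚₚ.neg-distribˡ-* (reI n) x ⟩
  - reI n * x                                                   ∎

imI-parity : ∀ n x → (if n % 2 ≡ᵇ 1 then sgn (n / 2) * x else 0ℚ) ≡ imI n * x
imI-parity zero          x = sym (ℚₚ.*-zeroˡ x)
imI-parity (suc zero)    x = refl
imI-parity (suc (suc n)) x = begin
  (if (2 ℕ.+ n) % 2 ≡ᵇ 1 then sgn ((2 ℕ.+ n) / 2) * x else 0ℚ)  ≡⟨ cong₂ (λ r q → if r ≡ᵇ 1 then sgn q * x else 0ℚ) (2+n%2 n) (2+n/2 n) ⟩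
  (if n % 2 ≡ᵇ 1 then - sgn (n / 2) * x else 0ℚ)                ≡⟨ if-neg (n % 2 ≡ᵇ 1) (sgn (n / 2)) x ⟩
  - (if n % 2 ≡ᵇ 1 then sgn (n / 2) * x else 0ℚ)                ≡⟨ cong -_ (imI-parity n x) ⟩
  - (imI n * x)                                                 ≡⟨ ℚₚ.neg-distribˡ-* (imI n) x ⟩
  - imI n * x                                                   ∎

D-cos : ∀ n → D cosC n ≡ - sinC n
D-cos n = begin
  ℕtoℚ (suc n) * cosC (suc n)                       ≡⟨ cong (ℕtoℚ (suc n) *_) (reI-parity (suc n) (invℕ (suc n !))) ⟩
  ℕtoℚ (suc n) * (- imI n * invℕ (suc n !))         ≡⟨ *-left-comm (ℕtoℚ (suc n)) (- imI n) (invℕ (suc n !)) ⟩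
  - imI n * (ℕtoℚ (suc n) * invℕ (suc n !))         ≡⟨ cong (- imI n *_) (ℕtoℚ*invℕ! n) ⟩
  - imI n * invℕ (n !)                              ≡⟨ ℚₚ.neg-distribˡ-* (imI n) (invℕ (n !)) ⟨
  - (imI n * invℕ (n !))                            ≡⟨ cong -_ (imI-parity n (invℕ (n !))) ⟨
  - sinC n                                          ∎

D-sin : ∀ n → D sinC n ≡ cosC n
D-sin n = begin
  ℕtoℚ (suc n) * sinC (suc n)                       ≡⟨ cong (ℕtoℚ (suc n) *_) (imI-parity (suc n) (invℕ (suc n !))) ⟩
  ℕtoℚ (suc n) * (reI n * invℕ (suc n !))           ≡⟨ *-left-comm (ℕtoℚ (suc n)) (reI n) (invℕ (suc n !)) ⟩
  reI n * (ℕtoℚ (suc n) * invℕ (suc n !))           ≡⟨ cong (reI n *_) (ℕtoℚ*invℕ! n) ⟩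
  reI n * invℕ (n !)                                ≡⟨ reI-parity n (invℕ (n !)) ⟨
  cosC n                                            ∎

one : Series
one zero    = 1ℚ
one (suc n) = 0ℚ

conv-one : ∀ a → conv a one ≗ a
conv-one a zero    = ℚₚ.*-identityʳ (a 0)
conv-one a (suc n) = trans (cong₂ _+_ (ℚₚ.*-zeroʳ (a 0)) (conv-one (a ∘ suc) n)) (ℚₚ.+-identityˡ (a (suc n)))

onePlusSin≗ : ∀ n → onePlusSinC n ≡ one n + sinC n
onePlusSin≗ zero    = refl
onePlusSin≗ (suc n) = sym (ℚₚ.+-identityˡ (sinC (suc n)))

length-recip : ∀ a m → length (recip1UpTo a m) ≡ suc m
length-recip a zero    = refl
length-recip a (suc m) = trans (Listₚ.length-++ (recip1UpTo a m)) (trans (cong (ℕ._+ 1) (length-recip a m)) (ℕₚ.+-comm (suc m) 1))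

at-++ˡ : ∀ xs {ys j} → j ℕ.< length xs → at (xs ++ ys) j ≡ at xs j
at-++ˡ (x ∷ xs) {j = zero}  _         = refl
at-++ˡ (x ∷ xs) {j = suc j} (s≤s j<l) = at-++ˡ xs j<l

at-last : ∀ xs y → at (xs ++ y ∷ []) (length xs) ≡ y
at-last []       y = refl
at-last (x ∷ xs) y = at-last xs y

recip : Series → Series
recip a n = at (recip1UpTo a n) n

-- Longer lists extend shorter ones, so a coefficient does not depend on how far the list was
-- computed.
at-recip : ∀ a m j → j ℕ.≤ m → at (recip1UpTo a m) j ≡ recip a j
at-recip a m j j≤m with ℕₚ.m≤n⇒m<n∨m≡n j≤m
at-recip a m       j _ | inj₂ refl      = refl
at-recip a (suc m) j _ | inj₁ (s≤s j≤m) =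
  trans (at-++ˡ (recip1UpTo a m) (subst (j ℕ.<_) (sym (length-recip a m)) (s≤s j≤m))) (at-recip a m j j≤m)

-- The last entry of each list was chosen to cancel the remaining terms of the product.
conv-recip : ∀ a → a 0 ≡ 1ℚ → conv a (recip a) ≗ one
conv-recip a a₀≡1 zero    = cong (_* 1ℚ) a₀≡1
conv-recip a a₀≡1 (suc m) = begin
  a 0 * recip a (suc m) + conv (a ∘ suc) (recip a) m     ≡⟨ cong₂ (λ x y → x * y + c) a₀≡1 recip-suc ⟩
  1ℚ * - c + c                                           ≡⟨ cancel c ⟩
  0ℚ                                                     ∎
  where
  c = conv (a ∘ suc) (recip a) m
  bs = recip1UpTo a m
  cancel : ∀ c → 1ℚ * - c + c ≡ 0ℚ
  cancel = solve-∀ ℚ-ring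
  recip-suc : recip a (suc m) ≡ - c
  recip-suc = begin
    recip a (suc m)                     ≡⟨ cong (at (recip1UpTo a (suc m))) (length-recip a m) ⟨
    at (recip1UpTo a (suc m)) (length bs)  ≡⟨ at-last bs _ ⟩
    - sumℚ (map (λ i → a (suc i) * at bs (m ∸ i)) (upTo (suc m)))  ≡⟨ cong -_ (conv-sum (a ∘ suc) (at bs) m) ⟩
    - conv (a ∘ suc) (at bs) m          ≡⟨ cong -_ (conv-congʳ-≤ (a ∘ suc) m (at-recip a m)) ⟩
    - c                                 ∎

secTan-cos : conv secTanC cosC ≗ onePlusSinC
secTan-cos n = begin
  conv secTanC cosC n                        ≡⟨ conv-congˡ cosC (conv-sum onePlusSinC secC) n ⟩
  conv (conv onePlusSinC secC) cosC n        ≡⟨ conv-assoc onePlusSinC secC cosC n ⟩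
  conv onePlusSinC (conv secC cosC) n        ≡⟨ conv-congʳ onePlusSinC (λ j → trans (conv-comm secC cosC j) (conv-recip cosC refl j)) n ⟩
  conv onePlusSinC one n                     ≡⟨ conv-one onePlusSinC n ⟩
  onePlusSinC n                              ∎

-- Complex power series and multiplication by e^(ix)

-- The Boolean index selects the real (false) or the imaginary (true) part.
ℂSeries : Set
ℂSeries = Bool × ℕ → ℚ

re im : ℂSeries → Series
re z n = z (false , n)
im z n = z (true , n)

Dᶜ Jᶜ : ℂSeries → ℂSeries
Dᶜ z (b , n)     = ℕtoℚ (suc n) * z (b , suc n)
Jᶜ z (false , n) = - z (true , n)
Jᶜ z (true  , n) = z (false , n)

Dᶜ-linear : Linear Dᶜ
Dᶜ-linear = record
  { cong-≗ = λ { f≗g (b , n) → cong (ℕtoℚ (suc n) *_) (f≗g (b , suc n)) }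
  ; +-homo = λ { f g (b , n) → ℚₚ.*-distribˡ-+ (ℕtoℚ (suc n)) (f (b , suc n)) (g (b , suc n)) }
  ; *-homo = λ { c f (b , n) → *-left-comm (ℕtoℚ (suc n)) c (f (b , suc n)) }
  }

Jᶜ-linear : Linear Jᶜ
Jᶜ-linear = record
  { cong-≗ = λ { f≗g (false , n) → cong -_ (f≗g (true , n)) ; f≗g (true , n) → f≗g (false , n) }
  ; +-homo = λ { f g (false , n) → ℚₚ.neg-distrib-+ (f (true , n)) (g (true , n)) ; f g (true , n) → refl }
  ; *-homo = λ { c f (false , n) → ℚₚ.neg-distribʳ-* c (f (true , n)) ; c f (true , n) → refl }
  }

JᶜDᶜ : ∀ z → Jᶜ (Dᶜ z) ≗ Dᶜ (Jᶜ z)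
JᶜDᶜ z (false , n) = ℚₚ.neg-distribʳ-* (ℕtoℚ (suc n)) (z (true , suc n))
JᶜDᶜ z (true  , n) = refl

JᶜJᶜ : ∀ z i → Jᶜ (Jᶜ z) i ≡ - z i
JᶜJᶜ z (false , n) = refl
JᶜJᶜ z (true  , n) = refl

open Shift Dᶜ Jᶜ Dᶜ-linear Jᶜ-linear JᶜDᶜ JᶜJᶜ renaming (T⁺ to Dᶜ⁺; T⁺-linear to Dᶜ⁺-linear)
open Unshift Dᶜ Jᶜ Dᶜ-linear Jᶜ-linear JᶜDᶜ JᶜJᶜ

-- The real and imaginary parts of e^(ix) z(x); multiplication by e^(ix) turns D + i into D.
Re-exp Im-exp : ℂSeries → Series
Re-exp z n = conv (re z) cosC n - conv (im z) sinC n
Im-exp z n = conv (re z) sinC n + conv (im z) cosC n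

Re-exp-linear : Linear Re-exp
Re-exp-linear = record
  { cong-≗ = λ f≗g n → cong₂ _-_ (conv-congˡ cosC (λ i → f≗g (false , i)) n) (conv-congˡ sinC (λ i → f≗g (true , i)) n)
  ; +-homo = λ f g n → trans (cong₂ _-_ (+-homo (conv-linearˡ cosC) (re f) (re g) n) (+-homo (conv-linearˡ sinC) (im f) (im g) n))
      (add (conv (re f) cosC n) (conv (re g) cosC n) (conv (im f) sinC n) (conv (im g) sinC n))
  ; *-homo = λ c f n → trans (cong₂ _-_ (*-homo (conv-linearˡ cosC) c (re f) n) (*-homo (conv-linearˡ sinC) c (im f) n))
      (mul c (conv (re f) cosC n) (conv (im f) sinC n))
  }
  where
  add : ∀ w x y z → w + x - (y + z) ≡ w - y + (x - z)
  add = solve-∀ ℚ-ring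
  mul : ∀ c x y → c * x - c * y ≡ c * (x - y)
  mul = solve-∀ ℚ-ring

Im-exp-linear : Linear Im-exp
Im-exp-linear = record
  { cong-≗ = λ f≗g n → cong₂ _+_ (conv-congˡ sinC (λ i → f≗g (false , i)) n) (conv-congˡ cosC (λ i → f≗g (true , i)) n)
  ; +-homo = λ f g n → trans (cong₂ _+_ (+-homo (conv-linearˡ sinC) (re f) (re g) n) (+-homo (conv-linearˡ cosC) (im f) (im g) n))
      (+-interchange (conv (re f) sinC n) (conv (re g) sinC n) (conv (im f) cosC n) (conv (im g) cosC n))
  ; *-homo = λ c f n → trans (cong₂ _+_ (*-homo (conv-linearˡ sinC) c (re f) n) (*-homo (conv-linearˡ cosC) c (im f) n))
      (sym (ℚₚ.*-distribˡ-+ c (conv (re f) sinC n) (conv (im f) cosC n)))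
  }

private
  D-conv-cos : ∀ a n → D (conv a cosC) n ≡ conv (D a) cosC n - conv a sinC n
  D-conv-cos a n = begin
    D (conv a cosC) n                            ≡⟨ D-conv a cosC n ⟩
    conv (D a) cosC n + conv a (D cosC) n        ≡⟨ cong (conv (D a) cosC n +_) (conv-comm a (D cosC) n) ⟩
    conv (D a) cosC n + conv (D cosC) a n        ≡⟨ cong (conv (D a) cosC n +_) (conv-congˡ a D-cos n) ⟩
    conv (D a) cosC n + conv (λ i → - sinC i) a n  ≡⟨ cong (conv (D a) cosC n +_) (linear-neg (conv-linearˡ a) sinC n) ⟩
    conv (D a) cosC n - conv sinC a n            ≡⟨ cong (λ x → conv (D a) cosC n - x) (conv-comm sinC a n) ⟩
    conv (D a) cosC n - conv a sinC n            ∎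

  D-conv-sin : ∀ a n → D (conv a sinC) n ≡ conv (D a) sinC n + conv a cosC n
  D-conv-sin a n = trans (D-conv a sinC n) (cong (conv (D a) sinC n +_) (conv-congʳ a D-sin n))

  re-Dᶜ⁺ : ∀ z b → conv (re (Dᶜ⁺ z)) b ≗ λ n → conv (D (re z)) b n - conv (im z) b n
  re-Dᶜ⁺ z b n = trans (+-homo (conv-linearˡ b) (D (re z)) (λ i → - im z i) n)
                       (cong (conv (D (re z)) b n +_) (linear-neg (conv-linearˡ b) (im z) n))

  im-Dᶜ⁺ : ∀ z b → conv (im (Dᶜ⁺ z)) b ≗ λ n → conv (D (im z)) b n + conv (re z) b n
  im-Dᶜ⁺ z b n = +-homo (conv-linearˡ b) (D (im z)) (re z) n

Re-exp-D : ∀ z → Re-exp (Dᶜ⁺ z) ≗ D (Re-exp z)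
Re-exp-D z n = begin
  conv (re (Dᶜ⁺ z)) cosC n - conv (im (Dᶜ⁺ z)) sinC n
    ≡⟨ cong₂ _-_ (re-Dᶜ⁺ z cosC n) (im-Dᶜ⁺ z sinC n) ⟩
  conv (D (re z)) cosC n - conv (im z) cosC n - (conv (D (im z)) sinC n + conv (re z) sinC n)
    ≡⟨ regroup (conv (D (re z)) cosC n) (conv (im z) cosC n) (conv (D (im z)) sinC n) (conv (re z) sinC n) ⟩
  conv (D (re z)) cosC n - conv (re z) sinC n - (conv (D (im z)) sinC n + conv (im z) cosC n)
    ≡⟨ cong₂ _-_ (D-conv-cos (re z) n) (D-conv-sin (im z) n) ⟨
  D (conv (re z) cosC) n - D (conv (im z) sinC) n
    ≡⟨ factor (ℕtoℚ (suc n)) (conv (re z) cosC (suc n)) (conv (im z) sinC (suc n)) ⟩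
  D (Re-exp z) n
    ∎
  where
  regroup : ∀ w x y z → w - x - (y + z) ≡ w - z - (y + x)
  regroup = solve-∀ ℚ-ring
  factor : ∀ c x y → c * x - c * y ≡ c * (x - y)
  factor = solve-∀ ℚ-ring

Im-exp-D : ∀ z → Im-exp (Dᶜ⁺ z) ≗ D (Im-exp z)
Im-exp-D z n = begin
  conv (re (Dᶜ⁺ z)) sinC n + conv (im (Dᶜ⁺ z)) cosC n
    ≡⟨ cong₂ _+_ (re-Dᶜ⁺ z sinC n) (im-Dᶜ⁺ z cosC n) ⟩
  conv (D (re z)) sinC n - conv (im z) sinC n + (conv (D (im z)) cosC n + conv (re z) cosC n)
    ≡⟨ regroup (conv (D (re z)) sinC n) (conv (im z) sinC n) (conv (D (im z)) cosC n) (conv (re z) cosC n) ⟩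
  conv (D (re z)) sinC n + conv (re z) cosC n + (conv (D (im z)) cosC n - conv (im z) sinC n)
    ≡⟨ cong₂ _+_ (D-conv-sin (re z) n) (D-conv-cos (im z) n) ⟨
  D (conv (re z) sinC) n + D (conv (im z) cosC) n
    ≡⟨ ℚₚ.*-distribˡ-+ (ℕtoℚ (suc n)) (conv (re z) sinC (suc n)) (conv (im z) cosC (suc n)) ⟨
  D (Im-exp z) n
    ∎
  where
  regroup : ∀ w x y z → w - x + (y + z) ≡ w + z + (y - x)
  regroup = solve-∀ ℚ-ring

real : Series → ℂSeries
real a (false , n) = a n
real a (true  , n) = 0ℚ

real-linear : Linear real
real-linear = record
  { cong-≗ = λ { f≗g (false , n) → f≗g n ; f≗g (true , n) → refl }
  ; +-homo = λ { f g (false , n) → refl ; f g (true , n) → refl }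
  ; *-homo = λ { c f (false , n) → refl ; c f (true , n) → sym (ℚₚ.*-zeroʳ c) }
  }

real-D : ∀ a → real (D a) ≗ Dᶜ (real a)
real-D a (false , n) = refl
real-D a (true  , n) = sym (ℚₚ.*-zeroʳ (ℕtoℚ (suc n)))

conv-zero : ∀ b n → conv (λ _ → 0ℚ) b n ≡ 0ℚ
conv-zero b = linear-zero (conv-linearˡ b)

Re-exp-real : ∀ a → Re-exp (real a) ≗ conv a cosC
Re-exp-real a n = trans (cong (λ x → conv a cosC n - x) (conv-zero sinC n)) (sub-zero (conv a cosC n))
  where
  sub-zero : ∀ x → x - 0ℚ ≡ x
  sub-zero = solve-∀ ℚ-ring

Im-exp-real : ∀ a → Im-exp (real a) ≗ conv a sinC
Im-exp-real a n = trans (cong (conv a sinC n +_) (conv-zero cosC n)) (ℚₚ.+-identityʳ (conv a sinC n))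

-- e^(ix) has constant term 1, so values at 0 are not affected by the multiplication.
Re-exp-at-0 : ∀ z → Re-exp z 0 ≡ z (false , 0)
Re-exp-at-0 z = lemma (z (false , 0)) (z (true , 0))
  where
  lemma : ∀ x y → x * 1ℚ - y * 0ℚ ≡ x
  lemma = solve-∀ ℚ-ring

Im-exp-at-0 : ∀ z → Im-exp z 0 ≡ z (true , 0)
Im-exp-at-0 z = lemma (z (false , 0)) (z (true , 0))
  where
  lemma : ∀ x y → x * 0ℚ + y * 1ℚ ≡ y
  lemma = solve-∀ ℚ-ring

-- Polynomials in E acting as differential operators

act : Poly → Series → Series
act []      a n = 0ℚ
act (c ∷ p) a n = c * a n + act p (D a) n

act-linear : ∀ p → Linear (act p)
act-linear []      = record
  { cong-≗ = λ _ _ → refl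
  ; +-homo = λ _ _ _ → sym (ℚₚ.+-identityˡ 0ℚ)
  ; *-homo = λ c _ _ → sym (ℚₚ.*-zeroʳ c)
  }
act-linear (c ∷ p) = record
  { cong-≗ = λ f≗g n → cong₂ (λ x y → c * x + y) (f≗g n) (cong-≗ pD f≗g n)
  ; +-homo = λ f g n → trans (cong (c * (f n + g n) +_) (+-homo pD f g n)) (add c (f n) (g n) (act p (D f) n) (act p (D g) n))
  ; *-homo = λ d f n → trans (cong (c * (d * f n) +_) (*-homo pD d f n)) (mul c d (f n) (act p (D f) n))
  }
  where
  pD = ∘-linear (act-linear p) D-linear
  add : ∀ c w x y z → c * (w + x) + (y + z) ≡ c * w + y + (c * x + z)
  add = solve-∀ ℚ-ring
  mul : ∀ c d x y → c * (d * x) + d * y ≡ d * (c * x + y)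
  mul = solve-∀ ℚ-ring

D-act : ∀ p a → D (act p a) ≗ act p (D a)
D-act []      a n = ℚₚ.*-zeroʳ (ℕtoℚ (suc n))
D-act (c ∷ p) a n = trans (distrib (ℕtoℚ (suc n)) c (a (suc n)) (act p (D a) (suc n))) (cong (c * D a n +_) (D-act p (D a) n))
  where
  distrib : ∀ n c x y → n * (c * x + y) ≡ c * (n * x) + n * y
  distrib = solve-∀ ℚ-ring

act-⊕ : ∀ p q a n → act (p ⊕ q) a n ≡ act p a n + act q a n
act-⊕ []      q       a n = sym (ℚₚ.+-identityˡ (act q a n))
act-⊕ (c ∷ p) []      a n = sym (ℚₚ.+-identityʳ (act (c ∷ p) a n))
act-⊕ (c ∷ p) (d ∷ q) a n = trans (cong ((c + d) * a n +_) (act-⊕ p q (D a) n)) (lemma c d (a n) (act p (D a) n) (act q (D a) n))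
  where
  lemma : ∀ c d x y z → (c + d) * x + (y + z) ≡ c * x + y + (d * x + z)
  lemma = solve-∀ ℚ-ring

act-scale : ∀ c p a n → act (scale c p) a n ≡ c * act p a n
act-scale c []      a n = sym (ℚₚ.*-zeroʳ c)
act-scale c (d ∷ p) a n = trans (cong (c * d * a n +_) (act-scale c p (D a) n)) (lemma c d (a n) (act p (D a) n))
  where
  lemma : ∀ c d x y → c * d * x + c * y ≡ c * (d * x + y)
  lemma = solve-∀ ℚ-ring

-- Products of polynomials become compositions, which lets each factor e_m or h_m be handled as an
-- operator of its own.
act-⊗ : ∀ p q a n → act (p ⊗ q) a n ≡ act p (act q a) n
act-⊗ []      q a n = refl
act-⊗ (c ∷ p) q a n = begin
  act (scale c q ⊕ (0ℚ ∷ (p ⊗ q))) a n                 ≡⟨ act-⊕ (scale c q) (0ℚ ∷ (p ⊗ q)) a n ⟩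
  act (scale c q) a n + (0ℚ * a n + act (p ⊗ q) (D a) n)  ≡⟨ cong₂ (λ x y → x + (0ℚ * a n + y)) (act-scale c q a n) (act-⊗ p q (D a) n) ⟩
  c * act q a n + (0ℚ * a n + act p (act q (D a)) n)   ≡⟨ drop (c * act q a n) (a n) (act p (act q (D a)) n) ⟩
  c * act q a n + act p (act q (D a)) n                ≡⟨ cong (c * act q a n +_) (cong-≗ (act-linear p) (D-act q a) n) ⟨
  c * act q a n + act p (D (act q a)) n                ∎
  where
  drop : ∀ x y z → x + (0ℚ * y + z) ≡ x + z
  drop = solve-∀ ℚ-ring

act-const : ∀ c a n → act (constP c) a n ≡ c * a n
act-const c a n = ℚₚ.+-identityʳ (c * a n)

private
  moment : Poly → Series → ℕ → ℚ
  moment []      v n = 0ℚ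
  moment (c ∷ p) v n = c * v n + moment p v (suc n)

  record IsEuler (v : Series) : Set where
    field euler≡ : ∀ n → euler n ≡ v n
  open IsEuler

  -- The recursion hidden inside `umbral` cannot be named; abstracting its initial index and its
  -- ambient polynomial one after the other lets the left-hand side of `moments` be inferred.
  mutual
    umbral-moment : ∀ p v → IsEuler v → umbral p ≡ moment p v 0
    umbral-moment []      v e = refl
    umbral-moment (c ∷ p) v e = cong₂ (λ x y → c * x + y) (euler≡ e 0) (tail-moment c p v e)

    tail-moment : ∀ c p v → IsEuler v → _ ≡ moment p v 1
    tail-moment c p v e with 1
    ... | k with c List.∷ p
    ... | q = moments q p k v e

    moments : ∀ q p k v → IsEuler v → _ ≡ moment p v k
    moments q []      k v e = refl
    moments q (c ∷ p) k v e = cong₂ (λ x y → c * x + y) (euler≡ e k) (moments q p (suc k) v e)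

  moment-suc : ∀ p v k → moment p v (suc k) ≡ moment p (v ∘ suc) k
  moment-suc []      v k = refl
  moment-suc (c ∷ p) v k = cong (c * v (suc k) +_) (moment-suc p v (suc k))

  -- If v has the exponential generating function a, then v shifted by one has D a; so moments of v
  -- become coefficients of p(D) a.
  moment-act : ∀ p v a k → (∀ n → v n ≡ ℕtoℚ (n !) * a n) → moment p v k ≡ ℕtoℚ (k !) * act p a k
  moment-act []      v a k v≡ = sym (ℚₚ.*-zeroʳ (ℕtoℚ (k !)))
  moment-act (c ∷ p) v a k v≡ = begin
    c * v k + moment p v (suc k)                                   ≡⟨ cong₂ (λ x y → c * x + y) (v≡ k) (moment-suc p v k) ⟩
    c * (ℕtoℚ (k !) * a k) + moment p (v ∘ suc) k                  ≡⟨ cong (c * (ℕtoℚ (k !) * a k) +_) (moment-act p (v ∘ suc) (D a) k v∘suc≡) ⟩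
    c * (ℕtoℚ (k !) * a k) + ℕtoℚ (k !) * act p (D a) k            ≡⟨ factor (ℕtoℚ (k !)) c (a k) (act p (D a) k) ⟩
    ℕtoℚ (k !) * (c * a k + act p (D a) k)                         ∎
    where
    factor : ∀ n c x y → c * (n * x) + n * y ≡ n * (c * x + y)
    factor = solve-∀ ℚ-ring
    swap : ∀ x y z → x * y * z ≡ y * (x * z)
    swap = solve-∀ ℚ-ring
    v∘suc≡ : ∀ n → v (suc n) ≡ ℕtoℚ (n !) * D a n
    v∘suc≡ n = begin
      v (suc n)                                ≡⟨ v≡ (suc n) ⟩
      ℕtoℚ (suc n !) * a (suc n)               ≡⟨ cong (_* a (suc n)) (ℕtoℚ-* (suc n) (n !)) ⟩
      ℕtoℚ (suc n) * ℕtoℚ (n !) * a (suc n)    ≡⟨ swap (ℕtoℚ (suc n)) (ℕtoℚ (n !)) (a (suc n)) ⟩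
      ℕtoℚ (n !) * D a n                       ∎

umbral-act : ∀ p → umbral p ≡ act p secTanC 0
umbral-act p = trans (umbral-moment p euler (record { euler≡ = λ _ → refl }))
  (trans (moment-act p euler secTanC 0 (λ _ → refl)) (ℚₚ.*-identityˡ (act p secTanC 0)))

-- Newton's identity for sums over partitions

∑ : (A → ℚ) → List A → ℚ
∑ f xs = sumℚ (map f xs)

∑-cong : {f g : A → ℚ} → f ≗ g → ∑ f ≗ ∑ g
∑-cong f≗g xs = cong sumℚ (Listₚ.map-cong f≗g xs)

∑-* : ∀ c (f : A → ℚ) xs → ∑ (λ x → c * f x) xs ≡ c * ∑ f xs
∑-* c f []       = sym (ℚₚ.*-zeroʳ c)
∑-* c f (x ∷ xs) = trans (cong (c * f x +_) (∑-* c f xs)) (sym (ℚₚ.*-distribˡ-+ c (f x) (∑ f xs)))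

∑-++ : ∀ (f : A → ℚ) xs ys → ∑ f (xs ++ ys) ≡ ∑ f xs + ∑ f ys
∑-++ f []       ys = sym (ℚₚ.+-identityˡ (∑ f ys))
∑-++ f (x ∷ xs) ys = trans (cong (f x +_) (∑-++ f xs ys)) (sym (ℚₚ.+-assoc (f x) (∑ f xs) (∑ f ys)))

∑-map : ∀ (f : B → ℚ) (g : A → B) xs → ∑ f (map g xs) ≡ ∑ (f ∘ g) xs
∑-map f g xs = cong sumℚ (sym (Listₚ.map-∘ xs))

∑-concatMap : ∀ (f : B → ℚ) (g : A → List B) xs → ∑ f (concatMap g xs) ≡ ∑ (λ x → ∑ f (g x)) xs
∑-concatMap f g []       = refl
∑-concatMap f g (x ∷ xs) = trans (∑-++ f (g x) (concatMap g xs)) (cong (∑ f (g x) +_) (∑-concatMap f g xs))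

∑-filterᵇ : ∀ (f : A → ℚ) p xs → ∑ f (filterᵇ p xs) ≡ ∑ (λ x → if p x then f x else 0ℚ) xs
∑-filterᵇ f p []       = refl
∑-filterᵇ f p (x ∷ xs) with p x
... | true  = cong (f x +_) (∑-filterᵇ f p xs)
... | false = trans (∑-filterᵇ f p xs) (sym (ℚₚ.+-identityˡ (∑ (λ x → if p x then f x else 0ℚ) xs)))

∑-linear : {φ : (I → ℚ) → I′ → ℚ} → Linear φ → ∀ (f : A → I → ℚ) xs i →
  φ (λ i → ∑ (λ x → f x i) xs) i ≡ ∑ (λ x → φ (f x) i) xs
∑-linear φ-lin f []       i = linear-zero φ-lin i
∑-linear {φ = φ} φ-lin f (x ∷ xs) i =
  trans (+-homo φ-lin (f x) (λ i → ∑ (λ x → f x i) xs) i) (cong (φ (f x) i +_) (∑-linear φ-lin f xs i))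

sumTo : ℕ → (ℕ → ℚ) → ℚ
sumTo zero    f = 0ℚ
sumTo (suc n) f = f 0 + sumTo n (f ∘ suc)

∑-upTo : ∀ f n → ∑ f (upTo n) ≡ sumTo n f
∑-upTo f n = trans (cong sumℚ (Listₚ.map-upTo f n)) (go f n)
  where
  go : ∀ f n → sumℚ (applyUpTo f n) ≡ sumTo n f
  go f zero    = refl
  go f (suc n) = cong (f 0 +_) (go (f ∘ suc) n)

sumTo-cong : ∀ {f g} n → (∀ i → i ℕ.< n → f i ≡ g i) → sumTo n f ≡ sumTo n g
sumTo-cong zero    f≡g = refl
sumTo-cong (suc n) f≡g = cong₂ _+_ (f≡g 0 (s≤s z≤n)) (sumTo-cong n (λ i i<n → f≡g (suc i) (s≤s i<n)))

sumTo-+ : ∀ n f g → sumTo n (λ i → f i + g i) ≡ sumTo n f + sumTo n g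
sumTo-+ zero    f g = refl
sumTo-+ (suc n) f g = trans (cong (f 0 + g 0 +_) (sumTo-+ n (f ∘ suc) (g ∘ suc)))
  (+-interchange (f 0) (g 0) (sumTo n (f ∘ suc)) (sumTo n (g ∘ suc)))

sumTo-* : ∀ n c f → sumTo n (λ i → c * f i) ≡ c * sumTo n f
sumTo-* zero    c f = sym (ℚₚ.*-zeroʳ c)
sumTo-* (suc n) c f = trans (cong (c * f 0 +_) (sumTo-* n c (f ∘ suc))) (sym (ℚₚ.*-distribˡ-+ c (f 0) (sumTo n (f ∘ suc))))

sumTo-zero : ∀ n → sumTo n (λ _ → 0ℚ) ≡ 0ℚ
sumTo-zero zero    = refl
sumTo-zero (suc n) = trans (ℚₚ.+-identityˡ (sumTo n (λ _ → 0ℚ))) (sumTo-zero n)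

sumTo-last : ∀ n f → sumTo (suc n) f ≡ sumTo n f + f n
sumTo-last zero    f = ℚₚ.+-comm (f 0) 0ℚ
sumTo-last (suc n) f = trans (cong (f 0 +_) (sumTo-last n (f ∘ suc))) (sym (ℚₚ.+-assoc (f 0) (sumTo n (f ∘ suc)) (f (suc n))))

sumTo-single : ∀ n b (f : ℕ → ℚ) → sumTo n (λ i → if i ≡ᵇ b then f i else 0ℚ) ≡ (if b <ᵇ n then f b else 0ℚ)
sumTo-single zero    b       f = refl
sumTo-single (suc n) zero    f = trans (cong (f 0 +_) (sumTo-zero n)) (ℚₚ.+-identityʳ (f 0))
sumTo-single (suc n) (suc b) f = trans (ℚₚ.+-identityˡ _) (sumTo-single n b (f ∘ suc))

-- Multiplication of a generating function by x^c. Below degree c it gives 0, where m ∸ c would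
-- wrongly give index 0.
shift : ℕ → Series → Series
shift zero    u m       = u m
shift (suc c) u zero    = 0ℚ
shift (suc c) u (suc m) = shift c u m

shift-≤ᵇ : ∀ c u m → shift c u m ≡ (if c ≤ᵇ m then u (m ∸ c) else 0ℚ)
shift-≤ᵇ zero          u m       = refl
shift-≤ᵇ (suc c)       u zero    = refl
shift-≤ᵇ (suc zero)    u (suc m) = refl
shift-≤ᵇ (suc (suc c)) u (suc m) = shift-≤ᵇ (suc c) u m

-- Keeping c + m′ ≡ m makes the descent to m′ < m available to well-founded induction when c is
-- positive.
shift-cong : ∀ c {u v} m → (∀ m′ → c ℕ.+ m′ ≡ m → u m′ ≡ v m′) → shift c u m ≡ shift c v m
shift-cong zero    m       u≡v = u≡v m refl
shift-cong (suc c) zero    u≡v = refl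
shift-cong (suc c) (suc m) u≡v = shift-cong c m (λ m′ eq → u≡v m′ (cong suc eq))

shift-linear : ∀ c → Linear (shift c)
shift-linear c = record { cong-≗ = λ u≗v m → shift-cong c m (λ m′ _ → u≗v m′) ; +-homo = add c ; *-homo = mul c }
  where
  add : ∀ c u v m → shift c (λ i → u i + v i) m ≡ shift c u m + shift c v m
  add zero    u v m       = refl
  add (suc c) u v zero    = refl
  add (suc c) u v (suc m) = add c u v m
  mul : ∀ c x u m → shift c (λ i → x * u i) m ≡ x * shift c u m
  mul zero    x u m       = refl
  mul (suc c) x u zero    = sym (ℚₚ.*-zeroʳ x)
  mul (suc c) x u (suc m) = mul c x u m

shift-sumTo : ∀ c n (f : ℕ → Series) m → shift c (λ i → sumTo n (λ j → f j i)) m ≡ sumTo n (λ j → shift c (f j) m)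
shift-sumTo c zero    f m = linear-zero (shift-linear c) m
shift-sumTo c (suc n) f m = trans (+-homo (shift-linear c) (f 0) _ m) (cong (shift c (f 0) m +_) (shift-sumTo c n (f ∘ suc) m))

shift-+ : ∀ c d u m → shift c (shift d u) m ≡ shift (c ℕ.+ d) u m
shift-+ zero    d u m       = refl
shift-+ (suc c) d u zero    = refl
shift-+ (suc c) d u (suc m) = shift-+ c d u m

shift-comm : ∀ c d u m → shift c (shift d u) m ≡ shift d (shift c u) m
shift-comm c d u m = trans (shift-+ c d u m) (trans (cong (λ k → shift k u m) (ℕₚ.+-comm c d)) (sym (shift-+ d c u m)))

-- In terms of θ = x d/dx this is (θ + k) x^c = x^c (θ + c + k).
shift-θ : ∀ c k u m → (ℕtoℚ m + ℕtoℚ k) * shift c u m ≡ shift c (λ i → (ℕtoℚ i + ℕtoℚ (c ℕ.+ k)) * u i) m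
shift-θ zero    k u m       = refl
shift-θ (suc c) k u zero    = ℚₚ.*-zeroʳ (ℕtoℚ 0 + ℕtoℚ k)
shift-θ (suc c) k u (suc m) = begin
  (ℕtoℚ (suc m) + ℕtoℚ k) * shift c u m                       ≡⟨ cong (_* shift c u m) move ⟩
  (ℕtoℚ m + ℕtoℚ (suc k)) * shift c u m                       ≡⟨ shift-θ c (suc k) u m ⟩
  shift c (λ i → (ℕtoℚ i + ℕtoℚ (c ℕ.+ suc k)) * u i) m       ≡⟨ cong (λ x → shift c (λ i → (ℕtoℚ i + ℕtoℚ x) * u i) m) (ℕₚ.+-suc c k) ⟩
  shift c (λ i → (ℕtoℚ i + ℕtoℚ (suc c ℕ.+ k)) * u i) m       ∎
  where
  assoc : ∀ x y → 1ℚ + x + y ≡ x + (1ℚ + y)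
  assoc = solve-∀ ℚ-ring
  move : ℕtoℚ (suc m) + ℕtoℚ k ≡ ℕtoℚ m + ℕtoℚ (suc k)
  move = trans (cong (_+ ℕtoℚ k) (ℕtoℚ-suc m)) (trans (assoc (ℕtoℚ m) (ℕtoℚ k)) (cong (ℕtoℚ m +_) (sym (ℕtoℚ-suc k))))

partsF-fuel : ∀ f f′ b m → m ℕ.≤ f → m ℕ.≤ f′ → partsF f b m ≡ partsF f′ b m
partsF-fuel f       f′       b zero    _ _ = refl
partsF-fuel (suc f) (suc f′) b (suc m) (s≤s m≤f) (s≤s m≤f′) =
  Listₚ.concatMap-cong
    (λ i → cong (map (suc i ∷_)) (partsF-fuel f f′ (suc i) (m ∸ i) (ℕₚ.≤-trans (ℕₚ.m∸n≤m m i) m≤f) (ℕₚ.≤-trans (ℕₚ.m∸n≤m m i) m≤f′)))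
    (filterᵇ (λ i → (i <ᵇ b) ∧ (i ≤ᵇ m)) (upTo (suc m)))

partSum : ℕ → (List ℕ → ℚ) → Series
partSum b G m = ∑ G (partsF m b m)

partSum-suc : ∀ b G m → partSum b G (suc m) ≡ sumTo (suc m) (λ i → if (i <ᵇ b) ∧ (i ≤ᵇ m) then partSum (suc i) (G ∘ (suc i ∷_)) (m ∸ i) else 0ℚ)
partSum-suc b G m = begin
  ∑ G (concatMap (λ i → map (suc i ∷_) (partsF m (suc i) (m ∸ i))) (filterᵇ p (upTo (suc m))))
    ≡⟨ ∑-concatMap G _ (filterᵇ p (upTo (suc m))) ⟩
  ∑ (λ i → ∑ G (map (suc i ∷_) (partsF m (suc i) (m ∸ i)))) (filterᵇ p (upTo (suc m)))
    ≡⟨ ∑-cong (λ i → trans (∑-map G (suc i ∷_) (partsF m (suc i) (m ∸ i))) (cong (∑ (G ∘ (suc i ∷_))) (partsF-fuel m (m ∸ i) (suc i) (m ∸ i) (ℕₚ.m∸n≤m m i) ℕₚ.≤-refl)))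
              (filterᵇ p (upTo (suc m))) ⟩
  ∑ (λ i → partSum (suc i) (G ∘ (suc i ∷_)) (m ∸ i)) (filterᵇ p (upTo (suc m)))
    ≡⟨ ∑-filterᵇ _ p (upTo (suc m)) ⟩
  ∑ (λ i → if p i then partSum (suc i) (G ∘ (suc i ∷_)) (m ∸ i) else 0ℚ) (upTo (suc m))
    ≡⟨ ∑-upTo (λ i → if p i then partSum (suc i) (G ∘ (suc i ∷_)) (m ∸ i) else 0ℚ) (suc m) ⟩
  sumTo (suc m) (λ i → if p i then partSum (suc i) (G ∘ (suc i ∷_)) (m ∸ i) else 0ℚ)
    ∎
  where p = λ i → (i <ᵇ b) ∧ (i ≤ᵇ m)

-- The lists are weakly decreasing: either b + 1 does not occur, or it stands first and can be
-- removed. Later inductions use this recurrence instead of the enumeration.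
partSum-bound : ∀ b G m → partSum (suc b) G m ≡ partSum b G m + shift (suc b) (partSum (suc b) (G ∘ (suc b ∷_))) m
partSum-bound b G zero    = sym (ℚₚ.+-identityʳ (partSum b G 0))
partSum-bound b G (suc m) = begin
  partSum (suc b) G (suc m)
    ≡⟨ partSum-suc (suc b) G m ⟩
  sumTo (suc m) (λ i → if (i <ᵇ suc b) ∧ (i ≤ᵇ m) then g i else 0ℚ)
    ≡⟨ sumTo-cong (suc m) (λ i _ → split i b (i ≤ᵇ m) (g i)) ⟩
  sumTo (suc m) (λ i → (if (i <ᵇ b) ∧ (i ≤ᵇ m) then g i else 0ℚ) + (if i ≡ᵇ b then (if i ≤ᵇ m then g i else 0ℚ) else 0ℚ))
    ≡⟨ sumTo-+ (suc m) (λ i → if (i <ᵇ b) ∧ (i ≤ᵇ m) then g i else 0ℚ) (λ i → if i ≡ᵇ b then (if i ≤ᵇ m then g i else 0ℚ) else 0ℚ) ⟩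
  sumTo (suc m) (λ i → if (i <ᵇ b) ∧ (i ≤ᵇ m) then g i else 0ℚ) + sumTo (suc m) (λ i → if i ≡ᵇ b then (if i ≤ᵇ m then g i else 0ℚ) else 0ℚ)
    ≡⟨ cong₂ _+_ (sym (partSum-suc b G m)) (sumTo-single (suc m) b (λ i → if i ≤ᵇ m then g i else 0ℚ)) ⟩
  partSum b G (suc m) + (if b <ᵇ suc m then (if b ≤ᵇ m then g b else 0ℚ) else 0ℚ)
    ≡⟨ cong (partSum b G (suc m) +_) (trans (merge b m (g b)) (sym (shift-≤ᵇ b (partSum (suc b) (G ∘ (suc b ∷_))) m))) ⟩
  partSum b G (suc m) + shift b (partSum (suc b) (G ∘ (suc b ∷_))) m
    ∎
  where
  g = λ i → partSum (suc i) (G ∘ (suc i ∷_)) (m ∸ i)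
  split : ∀ i b c x → (if (i <ᵇ suc b) ∧ c then x else 0ℚ) ≡ (if (i <ᵇ b) ∧ c then x else 0ℚ) + (if i ≡ᵇ b then (if c then x else 0ℚ) else 0ℚ)
  split zero    zero    c x = sym (ℚₚ.+-identityˡ _)
  split zero    (suc b) c x = sym (ℚₚ.+-identityʳ _)
  split (suc i) zero    c x = refl
  split (suc i) (suc b) c x = split i b c x
  merge : ∀ b m x → (if b <ᵇ suc m then (if b ≤ᵇ m then x else 0ℚ) else 0ℚ) ≡ (if b ≤ᵇ m then x else 0ℚ)
  merge zero    m x = refl
  merge (suc b) m x with b <ᵇ m
  ... | true  = refl
  ... | false = refl

partSum-zero : ∀ G m → partSum 0 G (suc m) ≡ 0ℚ
partSum-zero G m = trans (partSum-suc 0 G m) (sumTo-zero (suc m))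

IsPart : ℕ → ℕ → Set
IsPart b p = 1 ℕ.≤ p × p ℕ.≤ b

-- G and H need agree only on genuine partitions of m: the signs of e_m refer to the sum m, and the
-- normalised weights to the bound on the parts.
partSum-cong : ∀ b {G H} m → (∀ ls → sumℕ ls ≡ m → All (IsPart b) ls → G ls ≡ H ls) → partSum b G m ≡ partSum b H m
partSum-cong b m = go b m (<-wellFounded m)
  where
  go : ∀ b {G H} m → Acc ℕ._<_ m → (∀ ls → sumℕ ls ≡ m → All (IsPart b) ls → G ls ≡ H ls) → partSum b G m ≡ partSum b H m
  go zero    {G} {H} zero    _        G≡H = cong (_+ 0ℚ) (G≡H [] refl [])
  go zero    {G} {H} (suc m) _        G≡H = trans (partSum-zero G m) (sym (partSum-zero H m))
  go (suc b) {G} {H} m       (acc rs) G≡H = begin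
    partSum (suc b) G m                                          ≡⟨ partSum-bound b G m ⟩
    partSum b G m + shift (suc b) (partSum (suc b) (G ∘ (suc b ∷_))) m    ≡⟨ cong₂ _+_
      (go b m (acc rs) (λ ls sum≡ ps → G≡H ls sum≡ (All.map (λ { (1≤p , p≤b) → 1≤p , ℕₚ.m≤n⇒m≤1+n p≤b }) ps)))
      (shift-cong (suc b) m (λ m′ eq → go (suc b) m′ (rs (subst (m′ ℕ.<_) eq (s≤s (ℕₚ.m≤n+m m′ b))))
        (λ ls sum≡ ps → G≡H (suc b ∷ ls) (trans (cong (suc b ℕ.+_) sum≡) eq) ((s≤s z≤n , ℕₚ.≤-refl) ∷ ps)))) ⟩
    partSum b H m + shift (suc b) (partSum (suc b) (H ∘ (suc b ∷_))) m    ≡⟨ partSum-bound b H m ⟨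
    partSum (suc b) H m                                          ∎

partSum-≗ : ∀ b {G H} → G ≗ H → partSum b G ≗ partSum b H
partSum-≗ b G≗H m = ∑-cong G≗H (partsF m b m)

partSum-large : ∀ d G m → partSum (d ℕ.+ m) G m ≡ partSum m G m
partSum-large zero    G m = refl
partSum-large (suc d) G m = begin
  partSum (suc (d ℕ.+ m)) G m                                             ≡⟨ partSum-bound (d ℕ.+ m) G m ⟩
  partSum (d ℕ.+ m) G m + shift (suc (d ℕ.+ m)) (partSum (suc (d ℕ.+ m)) _) m      ≡⟨ cong₂ _+_ (partSum-large d G m) (vanish d m _) ⟩
  partSum m G m + 0ℚ                                                      ≡⟨ ℚₚ.+-identityʳ (partSum m G m) ⟩
  partSum m G m                                                           ∎
  where
  vanish : ∀ d m u → shift (suc (d ℕ.+ m)) u m ≡ 0ℚ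
  vanish d zero    u = refl
  vanish d (suc m) u = trans (cong (λ k → shift k u m) (ℕₚ.+-suc d m)) (vanish d m u)

≡ᵇ-refl : ∀ n → (n ≡ᵇ n) ≡ true
≡ᵇ-refl zero    = refl
≡ᵇ-refl (suc n) = ≡ᵇ-refl n

≢⇒≡ᵇ-false : ∀ {m n} → m ≢ n → (m ≡ᵇ n) ≡ false
≢⇒≡ᵇ-false {zero}  {zero}  m≢n = ⊥-elim (m≢n refl)
≢⇒≡ᵇ-false {zero}  {suc n} m≢n = refl
≢⇒≡ᵇ-false {suc m} {zero}  m≢n = refl
≢⇒≡ᵇ-false {suc m} {suc n} m≢n = ≢⇒≡ᵇ-false (m≢n ∘ cong suc)

mult-here : ∀ i ls → mult i (i ∷ ls) ≡ suc (mult i ls)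
mult-here i ls rewrite ≡ᵇ-refl i = refl

mult-there : ∀ i j ls → i ≢ j → mult i (j ∷ ls) ≡ mult i ls
mult-there i j ls i≢j rewrite ≢⇒≡ᵇ-false i≢j = refl

mult-bounded : ∀ i ls → All (ℕ._< i) ls → mult i ls ≡ 0
mult-bounded i []       []         = refl
mult-bounded i (l ∷ ls) (l<i ∷ ps) = trans (mult-there i l ls (λ { refl → ℕₚ.<-irrefl refl l<i })) (mult-bounded i ls ps)

parts≤sum : ∀ ls → All (ℕ._≤ sumℕ ls) ls
parts≤sum []       = []
parts≤sum (l ∷ ls) = ℕₚ.m≤m+n l (sumℕ ls) ∷ All.map (λ p≤ → ℕₚ.≤-trans p≤ (ℕₚ.m≤n+m (sumℕ ls) l)) (parts≤sum ls)

prodTo : ℕ → (ℕ → ℕ) → ℕ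
prodTo zero    f = 1
prodTo (suc n) f = f 0 ℕ.* prodTo n (f ∘ suc)

prodTo-applyUpTo : ∀ n f → prodℕ (applyUpTo f n) ≡ prodTo n f
prodTo-applyUpTo zero    f = refl
prodTo-applyUpTo (suc n) f = cong (f 0 ℕ.*_) (prodTo-applyUpTo n (f ∘ suc))

prodTo-ones : ∀ n f → (∀ i → f i ≡ 1) → prodTo n f ≡ 1
prodTo-ones zero    f f≡1 = refl
prodTo-ones (suc n) f f≡1 = cong₂ ℕ._*_ (f≡1 0) (prodTo-ones n (f ∘ suc) (f≡1 ∘ suc))

prodTo-extend : ∀ n d f → (∀ i → n ℕ.≤ i → f i ≡ 1) → prodTo (n ℕ.+ d) f ≡ prodTo n f
prodTo-extend zero    d f f≡1 = prodTo-ones d f (λ i → f≡1 i z≤n)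
prodTo-extend (suc n) d f f≡1 = cong (f 0 ℕ.*_) (prodTo-extend n d (f ∘ suc) (λ i n≤i → f≡1 (suc i) (s≤s n≤i)))

prodTo-cong : ∀ n {f g} → f ≗ g → prodTo n f ≡ prodTo n g
prodTo-cong zero    f≗g = refl
prodTo-cong (suc n) f≗g = cong₂ ℕ._*_ (f≗g 0) (prodTo-cong n (f≗g ∘ suc))

prodTo-change : ∀ n c k {f g} → c ℕ.< n → (∀ i → i ≢ c → f i ≡ g i) → f c ≡ k ℕ.* g c → prodTo n f ≡ k ℕ.* prodTo n g
prodTo-change (suc n) zero    k {f} {g} _ f≡g fc≡ = begin
  f 0 ℕ.* prodTo n (f ∘ suc)            ≡⟨ cong₂ ℕ._*_ fc≡ (prodTo-cong n (λ i → f≡g (suc i) (λ ()))) ⟩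
  k ℕ.* g 0 ℕ.* prodTo n (g ∘ suc)      ≡⟨ ℕₚ.*-assoc k (g 0) (prodTo n (g ∘ suc)) ⟩
  k ℕ.* (g 0 ℕ.* prodTo n (g ∘ suc))    ∎
prodTo-change (suc n) (suc c) k {f} {g} (s≤s c<n) f≡g fc≡ = begin
  f 0 ℕ.* prodTo n (f ∘ suc)            ≡⟨ cong₂ ℕ._*_ (f≡g 0 (λ ())) (prodTo-change n c k c<n (λ i i≢c → f≡g (suc i) (i≢c ∘ ℕₚ.suc-injective)) fc≡) ⟩
  g 0 ℕ.* (k ℕ.* prodTo n (g ∘ suc))    ≡⟨ swap (g 0) k (prodTo n (g ∘ suc)) ⟩
  k ℕ.* (g 0 ℕ.* prodTo n (g ∘ suc))    ∎
  where
  swap : ∀ x y z → x ℕ.* (y ℕ.* z) ≡ y ℕ.* (x ℕ.* z)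
  swap = solve-∀ᴺ

zfactor : ℕ → ℕ → ℕ
zfactor i r = i ^ r ℕ.* r !

-- The product defining `zee` stops at the sum of ls; beyond it all multiplicities are 0 and the
-- factors are 1. The slack d allows partitions with different sums to be compared over a common
-- range.
zee-prodTo : ∀ d ls → zee ls ≡ prodTo (suc (sumℕ ls) ℕ.+ d) (λ i → zfactor i (mult i ls))
zee-prodTo d ls = begin
  zee ls                      ≡⟨ cong prodℕ (Listₚ.map-upTo f (suc (sumℕ ls))) ⟩
  prodℕ (applyUpTo f (suc (sumℕ ls)))  ≡⟨ prodTo-applyUpTo (suc (sumℕ ls)) f ⟩
  prodTo (suc (sumℕ ls)) f    ≡⟨ prodTo-extend (suc (sumℕ ls)) d f (λ i s<i → cong (zfactor i) (mult-bounded i ls (All.map (λ p≤s → ℕₚ.≤-<-trans p≤s s<i) (parts≤sum ls)))) ⟨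
  prodTo (suc (sumℕ ls) ℕ.+ d) f  ∎
  where f = λ i → zfactor i (mult i ls)

sumℕ-replicate : ∀ r c ls → sumℕ (replicate r c ++ ls) ≡ sumℕ ls ℕ.+ r ℕ.* c
sumℕ-replicate zero    c ls = sym (ℕₚ.+-identityʳ (sumℕ ls))
sumℕ-replicate (suc r) c ls = trans (cong (c ℕ.+_) (sumℕ-replicate r c ls)) (lemma c (sumℕ ls) (r ℕ.* c))
  where
  lemma : ∀ x y z → x ℕ.+ (y ℕ.+ z) ≡ y ℕ.+ (x ℕ.+ z)
  lemma = solve-∀ᴺ

mult-replicate : ∀ r c ls → mult c (replicate r c ++ ls) ≡ r ℕ.+ mult c ls
mult-replicate zero    c ls = refl
mult-replicate (suc r) c ls = trans (mult-here c (replicate r c ++ ls)) (cong suc (mult-replicate r c ls))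

mult-replicate-≢ : ∀ i r c ls → i ≢ c → mult i (replicate r c ++ ls) ≡ mult i ls
mult-replicate-≢ i zero    c ls i≢c = refl
mult-replicate-≢ i (suc r) c ls i≢c = trans (mult-there i c (replicate r c ++ ls) i≢c) (mult-replicate-≢ i r c ls i≢c)

zee-replicate : ∀ r c ls → All (ℕ._< c) ls → zee (replicate r c ++ ls) ≡ zfactor c r ℕ.* zee ls
zee-replicate r c ls ls<c = begin
  zee μ                                                       ≡⟨ zee-prodTo c μ ⟩
  prodTo (suc (sumℕ μ) ℕ.+ c) (λ i → zfactor i (mult i μ))    ≡⟨ cong (λ n → prodTo n (λ i → zfactor i (mult i μ))) bound ⟩
  prodTo (suc (sumℕ ls) ℕ.+ (r ℕ.* c ℕ.+ c)) (λ i → zfactor i (mult i μ))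
    ≡⟨ prodTo-change (suc (sumℕ ls) ℕ.+ (r ℕ.* c ℕ.+ c)) c (zfactor c r)
         (s≤s (ℕₚ.≤-trans (ℕₚ.m≤n+m c (r ℕ.* c)) (ℕₚ.m≤n+m (r ℕ.* c ℕ.+ c) (sumℕ ls))))
         (λ i i≢c → cong (zfactor i) (mult-replicate-≢ i r c ls i≢c)) at-c ⟩
  zfactor c r ℕ.* prodTo (suc (sumℕ ls) ℕ.+ (r ℕ.* c ℕ.+ c)) (λ i → zfactor i (mult i ls))
    ≡⟨ cong (zfactor c r ℕ.*_) (zee-prodTo (r ℕ.* c ℕ.+ c) ls) ⟨
  zfactor c r ℕ.* zee ls                                      ∎
  where
  μ = replicate r c ++ ls
  bound : suc (sumℕ μ) ℕ.+ c ≡ suc (sumℕ ls) ℕ.+ (r ℕ.* c ℕ.+ c)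
  bound = cong suc (trans (cong (ℕ._+ c) (sumℕ-replicate r c ls)) (ℕₚ.+-assoc (sumℕ ls) (r ℕ.* c) c))
  mult-c : mult c ls ≡ 0
  mult-c = mult-bounded c ls ls<c
  at-c : zfactor c (mult c μ) ≡ zfactor c r ℕ.* zfactor c (mult c ls)
  at-c = begin
    zfactor c (mult c μ)                     ≡⟨ cong (zfactor c) (trans (mult-replicate r c ls) (trans (cong (r ℕ.+_) mult-c) (ℕₚ.+-identityʳ r))) ⟩
    zfactor c r                              ≡⟨ ℕₚ.*-identityʳ (zfactor c r) ⟨
    zfactor c r ℕ.* 1                        ≡⟨ cong (λ k → zfactor c r ℕ.* zfactor c k) mult-c ⟨
    zfactor c r ℕ.* zfactor c (mult c ls)    ∎

weight : List ℕ → ℚ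
weight ls = invℕ (zee ls)

infixr 7 _∙_
_∙_ : (List ℕ → ℚ) → (List ℕ → ℚ) → List ℕ → ℚ
(w ∙ F) ls = w ls * F ls

ℕtoℚ*invℕ-nonZero : ∀ n → ℕ.NonZero n → ℕtoℚ n * invℕ n ≡ 1ℚ
ℕtoℚ*invℕ-nonZero (suc n) _ = ℕtoℚ*invℕ n

zfactor-nonZero : ∀ b r → ℕ.NonZero (zfactor (suc b) r)
zfactor-nonZero b r = ℕₚ.m*n≢0 (suc b ^ r) (r !) {{ℕₚ.m^n≢0 (suc b) r}} {{r ℕₚ.!≢0}}

zfactor-suc : ∀ c r → zfactor c (suc r) ≡ c ℕ.* suc r ℕ.* zfactor c r
zfactor-suc c r = lemma c (suc r) (c ^ r) (r !)
  where
  lemma : ∀ x y z u → x ℕ.* z ℕ.* (y ℕ.* u) ≡ x ℕ.* y ℕ.* (z ℕ.* u)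
  lemma = solve-∀ᴺ

-- The weight of ls in a partition that already has r further parts c, normalised to be
-- `weight ls` when c does not occur in ls.
weightAfter : ℕ → ℕ → List ℕ → ℚ
weightAfter c r ls = ℕtoℚ (zfactor c r) * weight (replicate r c ++ ls)

weightAfter-< : ∀ b r ls → All (ℕ._< suc b) ls → weightAfter (suc b) r ls ≡ weight ls
weightAfter-< b r ls ls<c = begin
  ℕtoℚ z * invℕ (zee (replicate r (suc b) ++ ls))   ≡⟨ cong (λ k → ℕtoℚ z * invℕ k) (zee-replicate r (suc b) ls ls<c) ⟩
  ℕtoℚ z * invℕ (z ℕ.* zee ls)                      ≡⟨ cong (ℕtoℚ z *_) (invℕ-* z (zee ls)) ⟩
  ℕtoℚ z * (invℕ z * weight ls)                     ≡⟨ ℚₚ.*-assoc (ℕtoℚ z) (invℕ z) (weight ls) ⟨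
  ℕtoℚ z * invℕ z * weight ls                       ≡⟨ cong (_* weight ls) (ℕtoℚ*invℕ-nonZero z (zfactor-nonZero b r)) ⟩
  1ℚ * weight ls                                    ≡⟨ ℚₚ.*-identityˡ (weight ls) ⟩
  weight ls                                         ∎
  where z = zfactor (suc b) r

-- One more part c enlarges c^r r! to c^(r+1) (r + 1)!, that is, by the factor c (r + 1).
weightAfter-∷ : ∀ b r ls → weightAfter (suc b) r (suc b ∷ ls) ≡ invℕ (suc b ℕ.* suc r) * weightAfter (suc b) (suc r) ls
weightAfter-∷ b r ls = begin
  ℕtoℚ z * weight (replicate r c ++ c ∷ ls)              ≡⟨ cong (λ μ → ℕtoℚ z * weight μ) (replicate-∷ r) ⟩
  ℕtoℚ z * weight (replicate (suc r) c ++ ls)            ≡⟨ cong (_* weight (replicate (suc r) c ++ ls)) coefficient ⟩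
  invℕ k * ℕtoℚ (zfactor c (suc r)) * weight (replicate (suc r) c ++ ls)
                                                         ≡⟨ ℚₚ.*-assoc (invℕ k) (ℕtoℚ (zfactor c (suc r))) (weight (replicate (suc r) c ++ ls)) ⟩
  invℕ k * weightAfter c (suc r) ls                      ∎
  where
  c = suc b
  k = suc b ℕ.* suc r
  z = zfactor c r
  replicate-∷ : ∀ r → replicate r c ++ c ∷ ls ≡ replicate (suc r) c ++ ls
  replicate-∷ zero    = refl
  replicate-∷ (suc r) = cong (c ∷_) (replicate-∷ r)
  swap : ∀ x y z → x * (y * z) ≡ y * x * z
  swap = solve-∀ ℚ-ring
  coefficient : ℕtoℚ z ≡ invℕ k * ℕtoℚ (zfactor c (suc r))
  coefficient = sym (begin
    invℕ k * ℕtoℚ (zfactor c (suc r))    ≡⟨ cong (λ n → invℕ k * ℕtoℚ n) (zfactor-suc c r) ⟩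
    invℕ k * ℕtoℚ (k ℕ.* z)              ≡⟨ cong (invℕ k *_) (ℕtoℚ-* k z) ⟩
    invℕ k * (ℕtoℚ k * ℕtoℚ z)           ≡⟨ swap (invℕ k) (ℕtoℚ k) (ℕtoℚ z) ⟩
    ℕtoℚ k * invℕ k * ℕtoℚ z             ≡⟨ cong (_* ℕtoℚ z) (ℕtoℚ*invℕ (r ℕ.+ b ℕ.* suc r)) ⟩
    1ℚ * ℕtoℚ z                          ≡⟨ ℚₚ.*-identityˡ (ℕtoℚ z) ⟩
    ℕtoℚ z                               ∎)

-- Adjacent transpositions at any depth suffice, and this form is inherited when a part is
-- prepended.
Symmetric : (List ℕ → ℚ) → Set
Symmetric F = ∀ xs i j ys → F (xs ++ i ∷ j ∷ ys) ≡ F (xs ++ j ∷ i ∷ ys)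

-- 1 / z_λ is not a product over the parts. Remembering the number r of parts c already removed
-- restores a recurrence; Newton's identity is the case r = 0, but its induction on m passes from r
-- to r + 1.
partSumAfter : ℕ → ℕ → (List ℕ → ℚ) → Series
partSumAfter c r F = partSum c (weightAfter c r ∙ F)

partSumAfter-unfold : ∀ b r F m → partSumAfter (suc b) r F m ≡
  partSum b (weight ∙ F) m + invℕ (suc b ℕ.* suc r) * shift (suc b) (partSumAfter (suc b) (suc r) (F ∘ (suc b ∷_))) m
partSumAfter-unfold b r F m = trans (partSum-bound b (weightAfter c r ∙ F) m) (cong₂ _+_
  (partSum-cong b m (λ ls _ ps → cong (_* F ls) (weightAfter-< b r ls (All.map (λ { (_ , p≤b) → s≤s p≤b }) ps))))
  (trans (cong-≗ (shift-linear c) partSumAfter-∷ m) (*-homo (shift-linear c) κ (partSumAfter c (suc r) (F ∘ (c ∷_))) m)))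
  where
  c = suc b
  κ = invℕ (suc b ℕ.* suc r)
  partSumAfter-∷ : partSum c ((weightAfter c r ∙ F) ∘ (c ∷_)) ≗ λ m → κ * partSumAfter c (suc r) (F ∘ (c ∷_)) m
  partSumAfter-∷ m = trans (partSum-≗ c (λ ls → trans (cong (_* F (c ∷ ls)) (weightAfter-∷ b r ls)) (ℚₚ.*-assoc κ (weightAfter c (suc r) ls) (F (c ∷ ls)))) m)
                (∑-* κ (weightAfter c (suc r) ∙ (F ∘ (c ∷_))) (partsF m c m))

partSumAfter-zero : ∀ c F → partSumAfter c 0 F ≗ partSum c (weight ∙ F)
partSumAfter-zero c F = partSum-≗ c (λ ls → cong (_* F ls) (ℚₚ.*-identityˡ (weight ls)))

-- For F a product of power sums this is m h_m = ∑ p_j h_(m-j), restricted to parts at most b. F is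
-- any symmetric function of the list because it will be a composition of commuting operators,
-- evaluated at a series.
Newton : ℕ → Set
Newton b = ∀ F → Symmetric F → ∀ m → ℕtoℚ m * partSum b (weight ∙ F) m ≡ sumTo b (λ j → shift (suc j) (partSum b (weight ∙ (F ∘ (suc j ∷_)))) m)

-- Newton's identity for partitions whose c-parts are weighted as if r of them were already present.
newton-partSumAfter : ∀ b → Newton b → ∀ r F → Symmetric F → ∀ m → Acc ℕ._<_ m →
  (ℕtoℚ m + ℕtoℚ (suc b ℕ.* r)) * partSumAfter (suc b) r F m ≡
  ℕtoℚ (suc b ℕ.* r) * partSum b (weight ∙ F) m + shift (suc b) (partSumAfter (suc b) r (F ∘ (suc b ∷_))) m
    + sumTo b (λ j → shift (suc j) (partSumAfter (suc b) r (F ∘ (suc j ∷_))) m)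
newton-partSumAfter b newton-b r F symF m (acc rs) = begin
  (ℕtoℚ m + cr) * partSumAfter c r F m
    ≡⟨ cong ((ℕtoℚ m + cr) *_) (partSumAfter-unfold b r F m) ⟩
  (ℕtoℚ m + cr) * (s + κ * shift c v₁ m)
    ≡⟨ expand (ℕtoℚ m) cr s κ (shift c v₁ m) ⟩
  cr * s + ℕtoℚ m * s + κ * ((ℕtoℚ m + cr) * shift c v₁ m)
    -- Partitions without c fall under the bound b; those with c under the induction hypothesis for
    -- r + 1 at the smaller m - c.
    ≡⟨ cong₂ (λ x y → cr * s + x + κ * y) (newton-b F symF m) shifted ⟩
  cr * s + sumTo b s′ + κ * (ck * s₁ + shift c (shift c v₂) m + sumTo b v′)
    ≡⟨ regroup cr s (sumTo b s′) κ ck s₁ (shift c (shift c v₂) m) (sumTo b v′) ⟩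
  cr * s + (ck * κ * s₁ + κ * shift c (shift c v₂) m) + (sumTo b s′ + κ * sumTo b v′)
    ≡⟨ cong (λ x → cr * s + (x * s₁ + κ * shift c (shift c v₂) m) + (sumTo b s′ + κ * sumTo b v′)) (ℕtoℚ*invℕ (r ℕ.+ b ℕ.* suc r)) ⟩
  cr * s + (1ℚ * s₁ + κ * shift c (shift c v₂) m) + (sumTo b s′ + κ * sumTo b v′)
    ≡⟨ cong₂ (λ x y → cr * s + (x + κ * shift c (shift c v₂) m) + y) (ℚₚ.*-identityˡ s₁)
             (trans (cong (sumTo b s′ +_) (sym (sumTo-* b κ v′))) (sym (sumTo-+ b s′ (λ j → κ * v′ j)))) ⟩
  cr * s + (s₁ + κ * shift c (shift c v₂) m) + sumTo b (λ j → s′ j + κ * v′ j)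
    ≡⟨ cong₂ (λ x y → cr * s + x + y) (fold c v₂ (F ∘ (c ∷_)) (λ _ → refl)) (sumTo-cong b (λ j _ → fold-j j)) ⟩
  cr * s + shift c (partSumAfter c r (F ∘ (c ∷_))) m + sumTo b (λ j → shift (suc j) (partSumAfter c r (F ∘ (suc j ∷_))) m)
    ∎
  where
  c  = suc b
  κ  = invℕ (suc b ℕ.* suc r)
  cr = ℕtoℚ (c ℕ.* r)
  ck = ℕtoℚ (c ℕ.* suc r)
  s  = partSum b (weight ∙ F) m
  s₁ = shift c (partSum b (weight ∙ (F ∘ (c ∷_)))) m
  v₁ = partSumAfter c (suc r) (F ∘ (c ∷_))
  v₂ = partSumAfter c (suc r) (F ∘ (c ∷_) ∘ (c ∷_))
  s′ = λ j → shift (suc j) (partSum b (weight ∙ (F ∘ (suc j ∷_)))) m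
  v′ = λ j → shift c (shift (suc j) (partSumAfter c (suc r) (F ∘ (c ∷_) ∘ (suc j ∷_)))) m
  expand : ∀ m x s k y → (m + x) * (s + k * y) ≡ x * s + m * s + k * ((m + x) * y)
  expand = solve-∀ ℚ-ring
  regroup : ∀ x s t k z u v w → x * s + t + k * (z * u + v + w) ≡ x * s + (z * k * u + k * v) + (t + k * w)
  regroup = solve-∀ ℚ-ring
  -- The induction hypothesis, shifted by c.
  shifted : (ℕtoℚ m + cr) * shift c v₁ m ≡ ck * s₁ + shift c (shift c v₂) m + sumTo b v′
  shifted = begin
    (ℕtoℚ m + cr) * shift c v₁ m
      ≡⟨ shift-θ c (c ℕ.* r) v₁ m ⟩
    shift c (λ i → (ℕtoℚ i + ℕtoℚ (c ℕ.+ c ℕ.* r)) * v₁ i) m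
      ≡⟨ cong (λ k → shift c (λ i → (ℕtoℚ i + ℕtoℚ k) * v₁ i) m) (sym (ℕₚ.*-suc c r)) ⟩
    shift c (λ i → (ℕtoℚ i + ck) * v₁ i) m
      ≡⟨ shift-cong c m (λ m′ eq → newton-partSumAfter b newton-b (suc r) (F ∘ (c ∷_)) (symF ∘ (c ∷_)) m′ (rs (subst (m′ ℕ.<_) eq (s≤s (ℕₚ.m≤n+m m′ b))))) ⟩
    shift c (λ i → ck * partSum b (weight ∙ (F ∘ (c ∷_))) i + shift c v₂ i + sumTo b (λ j → shift (suc j) (partSumAfter c (suc r) (F ∘ (c ∷_) ∘ (suc j ∷_))) i)) m
      ≡⟨ trans (+-homo (shift-linear c) _ _ m) (cong₂ _+_ (trans (+-homo (shift-linear c) _ (shift c v₂) m)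
           (cong (_+ shift c (shift c v₂) m) (*-homo (shift-linear c) ck _ m))) (shift-sumTo c b (λ j → shift (suc j) (partSumAfter c (suc r) (F ∘ (c ∷_) ∘ (suc j ∷_)))) m)) ⟩
    ck * s₁ + shift c (shift c v₂) m + sumTo b v′
      ∎
  fold : ∀ d v G → partSumAfter c (suc r) (G ∘ (c ∷_)) ≗ v → shift d (partSum b (weight ∙ G)) m + κ * shift d (shift c v) m ≡ shift d (partSumAfter c r G) m
  fold d v G V≗v = sym (begin
    shift d (partSumAfter c r G) m
      ≡⟨ cong-≗ (shift-linear d) (partSumAfter-unfold b r G) m ⟩
    shift d (λ i → partSum b (weight ∙ G) i + κ * shift c (partSumAfter c (suc r) (G ∘ (c ∷_))) i) m
      ≡⟨ +-homo (shift-linear d) _ _ m ⟩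
    shift d (partSum b (weight ∙ G)) m + shift d (λ i → κ * shift c (partSumAfter c (suc r) (G ∘ (c ∷_))) i) m
      ≡⟨ cong (shift d (partSum b (weight ∙ G)) m +_) (*-homo (shift-linear d) κ _ m) ⟩
    shift d (partSum b (weight ∙ G)) m + κ * shift d (shift c (partSumAfter c (suc r) (G ∘ (c ∷_)))) m
      ≡⟨ cong (λ x → shift d (partSum b (weight ∙ G)) m + κ * x) (cong-≗ (shift-linear d) (cong-≗ (shift-linear c) V≗v) m) ⟩
    shift d (partSum b (weight ∙ G)) m + κ * shift d (shift c v) m
      ∎)
  -- The parts c and j + 1 are prepended in opposite orders on the two sides; this is where the
  -- symmetry of F enters.
  fold-j : ∀ j → s′ j + κ * v′ j ≡ shift (suc j) (partSumAfter c r (F ∘ (suc j ∷_))) m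
  fold-j j = trans (cong (λ x → s′ j + κ * x) (shift-comm c (suc j) (partSumAfter c (suc r) (F ∘ (c ∷_) ∘ (suc j ∷_))) m))
    (fold (suc j) (partSumAfter c (suc r) (F ∘ (c ∷_) ∘ (suc j ∷_))) (F ∘ (suc j ∷_))
      (partSum-≗ c (λ ls → cong (weightAfter c (suc r) ls *_) (symF [] (suc j) c ls))))

-- The case r = 0 of `newton-partSumAfter`: its first term vanishes and the term of the part b + 1
-- completes the sum.
newton : ∀ b → Newton b
newton zero    F symF zero    = ℚₚ.*-zeroˡ (partSum 0 (weight ∙ F) 0)
newton zero    F symF (suc m) = trans (cong (ℕtoℚ (suc m) *_) (partSum-zero (weight ∙ F) m)) (ℚₚ.*-zeroʳ (ℕtoℚ (suc m)))
newton (suc b) F symF m = begin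
  ℕtoℚ m * partSum c (weight ∙ F) m
    ≡⟨ cong (ℕtoℚ m *_) (partSumAfter-zero c F m) ⟨
  ℕtoℚ m * partSumAfter c 0 F m
    ≡⟨ cong (_* partSumAfter c 0 F m) (ℚₚ.+-identityʳ (ℕtoℚ m)) ⟨
  (ℕtoℚ m + 0ℚ) * partSumAfter c 0 F m
    ≡⟨ cong (λ k → (ℕtoℚ m + ℕtoℚ k) * partSumAfter c 0 F m) (ℕₚ.*-zeroʳ c) ⟨
  (ℕtoℚ m + ℕtoℚ (c ℕ.* 0)) * partSumAfter c 0 F m
    ≡⟨ newton-partSumAfter b (newton b) 0 F symF m (<-wellFounded m) ⟩
  ℕtoℚ (c ℕ.* 0) * s + shift c (partSumAfter c 0 (F ∘ (c ∷_))) m + sumTo b (λ j → shift (suc j) (partSumAfter c 0 (F ∘ (suc j ∷_))) m)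
    ≡⟨ cong (λ k → ℕtoℚ k * s + shift c (partSumAfter c 0 (F ∘ (c ∷_))) m + sumTo b (λ j → shift (suc j) (partSumAfter c 0 (F ∘ (suc j ∷_))) m)) (ℕₚ.*-zeroʳ c) ⟩
  0ℚ * s + shift c (partSumAfter c 0 (F ∘ (c ∷_))) m + sumTo b (λ j → shift (suc j) (partSumAfter c 0 (F ∘ (suc j ∷_))) m)
    ≡⟨ drop s (shift c (partSumAfter c 0 (F ∘ (c ∷_))) m) (sumTo b (λ j → shift (suc j) (partSumAfter c 0 (F ∘ (suc j ∷_))) m)) ⟩
  sumTo b (λ j → shift (suc j) (partSumAfter c 0 (F ∘ (suc j ∷_))) m) + shift c (partSumAfter c 0 (F ∘ (c ∷_))) m
    ≡⟨ sumTo-last b (λ j → shift (suc j) (partSumAfter c 0 (F ∘ (suc j ∷_))) m) ⟨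
  sumTo c (λ j → shift (suc j) (partSumAfter c 0 (F ∘ (suc j ∷_))) m)
    ≡⟨ sumTo-cong c (λ j _ → cong-≗ (shift-linear (suc j)) (partSumAfter-zero c (F ∘ (suc j ∷_))) m) ⟩
  sumTo c (λ j → shift (suc j) (partSum c (weight ∙ (F ∘ (suc j ∷_)))) m)
    ∎
  where
  c = suc b
  s = partSum b (weight ∙ F) m
  drop : ∀ x y z → 0ℚ * x + y + z ≡ z + y
  drop = solve-∀ ℚ-ring

-- Complete and elementary symmetric functions under the specialisations

complete : (List ℕ → ℚ) → Series
complete F m = ∑ (weight ∙ F) (partitions m)

newton-complete : ∀ F → Symmetric F → ∀ m → ℕtoℚ m * complete F m ≡ sumTo m (λ j → complete (F ∘ (suc j ∷_)) (m ∸ suc j))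
newton-complete F symF m = trans (newton m F symF m) (sumTo-cong m (λ j j<m →
  trans (shift-< (suc j) m j<m) (at-most (m ∸ suc j) (weight ∙ (F ∘ (suc j ∷_))) (ℕₚ.m∸n≤m m (suc j)))))
  where
  shift-< : ∀ c {u} m → c ℕ.≤ m → shift c u m ≡ u (m ∸ c)
  shift-< zero    m       _         = refl
  shift-< (suc c) (suc m) (s≤s c≤m) = shift-< c m c≤m
  at-most : ∀ m′ G → m′ ℕ.≤ m → partSum m G m′ ≡ partSum m′ G m′
  at-most m′ G m′≤m = trans (cong (λ b → partSum b G m′) (sym (ℕₚ.m∸n+n≡m m′≤m))) (partSum-large (m ∸ m′) G m′)

-- The hypotheses on P say ∑ P_j x^(j-1) = (D + s x) / (1 + x²), the logarithmic derivative of (1 +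
-- x²)^(s/2) exp (D arctan x).
module PowerSums (P : ℕ → Series → Series) (P-linear : ∀ j → Linear (P j)) (P-comm : ∀ i j a → P i (P j a) ≗ P j (P i a))
  (s : ℚ) (P₁ : ∀ a → P 1 a ≗ D a) (P₂ : ∀ a n → P 2 a n ≡ s * a n) (P₊₂ : ∀ j a n → P (3 ℕ.+ j) a n ≡ - P (1 ℕ.+ j) a n) where

  P* : List ℕ → Series → Series
  P* []       a = a
  P* (j ∷ ls) a = P j (P* ls a)

  P*-symmetric : ∀ a n → Symmetric (λ ls → P* ls a n)
  P*-symmetric a n []       i j ys = P-comm i j (P* ys a) n
  P*-symmetric a n (x ∷ xs) i j ys = cong-≗ (P-linear x) (λ n → P*-symmetric a n xs i j ys) n

  H : ℕ → Series → Series
  H m a n = complete (λ ls → P* ls a n) m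

  H-newton : ∀ m a n → ℕtoℚ m * H m a n ≡ sumTo m (λ j → P (suc j) (H (m ∸ suc j) a) n)
  H-newton m a n = trans (newton-complete (λ ls → P* ls a n) (P*-symmetric a n) m)
    (sumTo-cong m (λ j _ → sym (begin
      P (suc j) (H (m ∸ suc j) a) n
        ≡⟨ ∑-linear (P-linear (suc j)) (λ ls n → weight ls * P* ls a n) (partitions (m ∸ suc j)) n ⟩
      ∑ (λ ls → P (suc j) (λ n → weight ls * P* ls a n) n) (partitions (m ∸ suc j))
        ≡⟨ ∑-cong (λ ls → *-homo (P-linear (suc j)) (weight ls) (P* ls a) n) (partitions (m ∸ suc j)) ⟩
      complete (λ ls → P* (suc j ∷ ls) a n) (m ∸ suc j)
        ∎)))

  -- In Newton's identity for m + 2 the terms with j ≥ 3 are, by `P₊₂`, the negatives of all terms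
  -- of the identity for m, so they sum to - m times `H m`.
  H-rec : ∀ m a n → ℕtoℚ (2 ℕ.+ m) * H (2 ℕ.+ m) a n ≡ D (H (suc m) a) n + (s - ℕtoℚ m) * H m a n
  H-rec m a n = begin
    ℕtoℚ (2 ℕ.+ m) * H (2 ℕ.+ m) a n
      ≡⟨ H-newton (2 ℕ.+ m) a n ⟩
    P 1 (H (suc m) a) n + (P 2 (H m a) n + sumTo m (λ j → P (3 ℕ.+ j) (H (m ∸ suc j) a) n))
      ≡⟨ cong₂ (λ x y → x + (y + sumTo m (λ j → P (3 ℕ.+ j) (H (m ∸ suc j) a) n))) (P₁ (H (suc m) a) n) (P₂ (H m a) n) ⟩
    D (H (suc m) a) n + (s * H m a n + sumTo m (λ j → P (3 ℕ.+ j) (H (m ∸ suc j) a) n))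
      ≡⟨ cong (λ x → D (H (suc m) a) n + (s * H m a n + x)) tail ⟩
    D (H (suc m) a) n + (s * H m a n + - 1ℚ * (ℕtoℚ m * H m a n))
      ≡⟨ regroup (D (H (suc m) a) n) s (H m a n) (ℕtoℚ m) ⟩
    D (H (suc m) a) n + (s - ℕtoℚ m) * H m a n
      ∎
    where
    neg : ∀ x → - x ≡ - 1ℚ * x
    neg = solve-∀ ℚ-ring
    regroup : ∀ x s h m → x + (s * h + - 1ℚ * (m * h)) ≡ x + (s - m) * h
    regroup = solve-∀ ℚ-ring
    tail : sumTo m (λ j → P (3 ℕ.+ j) (H (m ∸ suc j) a) n) ≡ - 1ℚ * (ℕtoℚ m * H m a n)
    tail = begin
      sumTo m (λ j → P (3 ℕ.+ j) (H (m ∸ suc j) a) n)           ≡⟨ sumTo-cong m (λ j _ → trans (P₊₂ j (H (m ∸ suc j) a) n) (neg (P (suc j) (H (m ∸ suc j) a) n))) ⟩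
      sumTo m (λ j → - 1ℚ * P (suc j) (H (m ∸ suc j) a) n)      ≡⟨ sumTo-* m (- 1ℚ) (λ j → P (suc j) (H (m ∸ suc j) a) n) ⟩
      - 1ℚ * sumTo m (λ j → P (suc j) (H (m ∸ suc j) a) n)      ≡⟨ cong (- 1ℚ *_) (H-newton m a n) ⟨
      - 1ℚ * (ℕtoℚ m * H m a n)                                 ∎

  H≗gop : ∀ m a → H m a ≗ gop D s m a
  H≗gop zero          a n = lemma (a n)
    where
    lemma : ∀ x → 1ℚ * x + 0ℚ ≡ x
    lemma = solve-∀ ℚ-ring
  H≗gop (suc zero)    a n = begin
    H 1 a n                        ≡⟨ ℚₚ.*-identityˡ (H 1 a n) ⟨
    1ℚ * H 1 a n                   ≡⟨ H-newton 1 a n ⟩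
    P 1 (H 0 a) n + 0ℚ             ≡⟨ ℚₚ.+-identityʳ (P 1 (H 0 a) n) ⟩
    P 1 (H 0 a) n                  ≡⟨ P₁ (H 0 a) n ⟩
    D (H 0 a) n                    ≡⟨ cong-≗ D-linear (H≗gop zero a) n ⟩
    D a n                          ∎
  H≗gop (suc (suc m)) a n = begin
    H (2 ℕ.+ m) a n                                        ≡⟨ ℚₚ.*-identityˡ (H (2 ℕ.+ m) a n) ⟨
    1ℚ * H (2 ℕ.+ m) a n                                   ≡⟨ cong (_* H (2 ℕ.+ m) a n) (ℕtoℚ*invℕ (suc m)) ⟨
    ℕtoℚ (2 ℕ.+ m) * invℕ (2 ℕ.+ m) * H (2 ℕ.+ m) a n      ≡⟨ swap (ℕtoℚ (2 ℕ.+ m)) (invℕ (2 ℕ.+ m)) (H (2 ℕ.+ m) a n) ⟩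
    invℕ (2 ℕ.+ m) * (ℕtoℚ (2 ℕ.+ m) * H (2 ℕ.+ m) a n)    ≡⟨ cong (invℕ (2 ℕ.+ m) *_) (H-rec m a n) ⟩
    invℕ (2 ℕ.+ m) * (D (H (suc m) a) n + (s - ℕtoℚ m) * H m a n)
      ≡⟨ cong₂ (λ x y → invℕ (2 ℕ.+ m) * (x + (s - ℕtoℚ m) * y)) (cong-≗ D-linear (H≗gop (suc m) a) n) (H≗gop m a n) ⟩
    gop D s (2 ℕ.+ m) a n                                  ∎
    where
    swap : ∀ x y z → x * y * z ≡ y * (x * z)
    swap = solve-∀ ℚ-ring

act-comm : ∀ p q a → act p (act q a) ≗ act q (act p a)
act-comm []      q a n = sym (linear-zero (act-linear q) n)
act-comm (c ∷ p) q a n = begin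
  c * act q a n + act p (D (act q a)) n           ≡⟨ cong (c * act q a n +_) (cong-≗ (act-linear p) (D-act q a) n) ⟩
  c * act q a n + act p (act q (D a)) n           ≡⟨ cong (c * act q a n +_) (act-comm p q (D a) n) ⟩
  c * act q a n + act q (act p (D a)) n           ≡⟨ cong (_+ act q (act p (D a)) n) (*-homo (act-linear q) c a n) ⟨
  act q (λ n → c * a n) n + act q (act p (D a)) n  ≡⟨ +-homo (act-linear q) (λ n → c * a n) (act p (D a)) n ⟨
  act q (act (c ∷ p) a) n                         ∎

act-sumP : ∀ (f : A → Poly) xs a n → act (sumP (map f xs)) a n ≡ ∑ (λ x → act (f x) a n) xs
act-sumP f []       a n = refl
act-sumP f (x ∷ xs) a n = trans (act-⊕ (f x) (sumP (map f xs)) a n) (cong (act (f x) a n +_) (act-sumP f xs a n))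

record IsSpec (σ : Spec) (t : ℚ) : Set where
  field
    σ₁  : ∀ a n → act (σ 1) a n ≡ D a n
    σ₂  : ∀ a n → act (σ 2) a n ≡ t * a n
    σ₊₂ : ∀ j a n → act (σ (3 ℕ.+ j)) a n ≡ - act (σ (1 ℕ.+ j)) a n

sgn-+ : ∀ m n → sgn (m ℕ.+ n) ≡ sgn m * sgn n
sgn-+ zero    n = sym (ℚₚ.*-identityˡ (sgn n))
sgn-+ (suc m) n = trans (cong -_ (sgn-+ m n)) (ℚₚ.neg-distribˡ-* (sgn m) (sgn n))

length≤sum : ∀ {b} ls → All (IsPart b) ls → length ls ℕ.≤ sumℕ ls
length≤sum []       []             = z≤n
length≤sum (l ∷ ls) ((1≤l , _) ∷ ps) = ℕₚ.+-mono-≤ 1≤l (length≤sum ls ps)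

module _ {σ : Spec} {t : ℚ} (isSpec : IsSpec σ t) where
  open IsSpec isSpec

  private
    module h = PowerSums (λ j → act (σ j)) (λ j → act-linear (σ j)) (λ i j → act-comm (σ i) (σ j)) t σ₁ σ₂ σ₊₂

    act-pλ : ∀ ls a → act (pλ σ ls) a ≗ h.P* ls a
    act-pλ []       a n = trans (act-const 1ℚ a n) (ℚₚ.*-identityˡ (a n))
    act-pλ (j ∷ ls) a n = trans (act-⊗ (σ j) (pλ σ ls) a n) (cong-≗ (act-linear (σ j)) (act-pλ ls a) n)

    -- The substitution p_j ↦ (-1)^(j-1) p_j, which exchanges h_m and e_m. Odd indices keep their
    -- value and even ones change sign, so `PowerSums` applies again with t replaced by - t.
    signed : ℕ → Series → Series
    signed j a n = sgn (j ∸ 1) * act (σ j) a n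

    signed-linear : ∀ j → Linear (signed j)
    signed-linear j = record
      { cong-≗ = λ f≗g n → cong (sgn (j ∸ 1) *_) (cong-≗ (act-linear (σ j)) f≗g n)
      ; +-homo = λ f g n → trans (cong (sgn (j ∸ 1) *_) (+-homo (act-linear (σ j)) f g n)) (ℚₚ.*-distribˡ-+ (sgn (j ∸ 1)) (act (σ j) f n) (act (σ j) g n))
      ; *-homo = λ c f n → trans (cong (sgn (j ∸ 1) *_) (*-homo (act-linear (σ j)) c f n)) (*-left-comm (sgn (j ∸ 1)) c (act (σ j) f n))
      }

    signed-comm : ∀ i j a → signed i (signed j a) ≗ signed j (signed i a)
    signed-comm i j a n = begin
      sᵢ * act (σ i) (signed j a) n               ≡⟨ cong (sᵢ *_) (*-homo (act-linear (σ i)) sⱼ (act (σ j) a) n) ⟩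
      sᵢ * (sⱼ * act (σ i) (act (σ j) a) n)       ≡⟨ cong (λ x → sᵢ * (sⱼ * x)) (act-comm (σ i) (σ j) a n) ⟩
      sᵢ * (sⱼ * act (σ j) (act (σ i) a) n)       ≡⟨ *-left-comm sᵢ sⱼ (act (σ j) (act (σ i) a) n) ⟩
      sⱼ * (sᵢ * act (σ j) (act (σ i) a) n)       ≡⟨ cong (sⱼ *_) (*-homo (act-linear (σ j)) sᵢ (act (σ i) a) n) ⟨
      sⱼ * act (σ j) (signed i a) n               ∎
      where
      sᵢ = sgn (i ∸ 1)
      sⱼ = sgn (j ∸ 1)

    signed₂ : ∀ a n → signed 2 a n ≡ - t * a n
    signed₂ a n = trans (cong (- 1ℚ *_) (σ₂ a n)) (lemma t (a n))
      where
      lemma : ∀ t x → - 1ℚ * (t * x) ≡ - t * x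
      lemma = solve-∀ ℚ-ring

    signed₊₂ : ∀ j a n → signed (3 ℕ.+ j) a n ≡ - signed (1 ℕ.+ j) a n
    signed₊₂ j a n = trans (cong (- - sgn j *_) (σ₊₂ j a n)) (lemma (sgn j) (act (σ (1 ℕ.+ j)) a n))
      where
      lemma : ∀ s x → - - s * - x ≡ - (s * x)
      lemma = solve-∀ ℚ-ring

    module e = PowerSums signed signed-linear signed-comm (- t)
      (λ a n → trans (ℚₚ.*-identityˡ (act (σ 1) a n)) (σ₁ a n)) signed₂ signed₊₂

    -- Each part l contributes (-1)^(l-1). Positive parts make the length at most the sum, so the
    -- truncated difference is exact.
    sign-P* : ∀ {b} ls a n → All (IsPart b) ls → e.P* ls a n ≡ sgn (sumℕ ls ∸ length ls) * h.P* ls a n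
    sign-P* []       a n []                 = sym (ℚₚ.*-identityˡ (a n))
    sign-P* (suc l ∷ ls) a n (_ ∷ ps) = begin
      sgn l * act (σ (suc l)) (e.P* ls a) n
        ≡⟨ cong (sgn l *_) (cong-≗ (act-linear (σ (suc l))) (λ n → sign-P* ls a n ps) n) ⟩
      sgn l * act (σ (suc l)) (λ n → s * h.P* ls a n) n
        ≡⟨ cong (sgn l *_) (*-homo (act-linear (σ (suc l))) s (h.P* ls a) n) ⟩
      sgn l * (s * h.P* (suc l ∷ ls) a n)
        ≡⟨ ℚₚ.*-assoc (sgn l) s (h.P* (suc l ∷ ls) a n) ⟨
      sgn l * s * h.P* (suc l ∷ ls) a n
        ≡⟨ cong (_* h.P* (suc l ∷ ls) a n) (sgn-+ l (sumℕ ls ∸ length ls)) ⟨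
      sgn (l ℕ.+ (sumℕ ls ∸ length ls)) * h.P* (suc l ∷ ls) a n
        ≡⟨ cong (λ k → sgn k * h.P* (suc l ∷ ls) a n) (ℕₚ.+-∸-assoc l (length≤sum ls ps)) ⟨
      sgn (l ℕ.+ sumℕ ls ∸ length ls) * h.P* (suc l ∷ ls) a n
        ∎
      where s = sgn (sumℕ ls ∸ length ls)

  act-hSpec : ∀ m a → act (hSpec σ m) a ≗ gop D t m a
  act-hSpec m a n = begin
    act (hSpec σ m) a n
      ≡⟨ act-sumP (λ ls → scale (weight ls) (pλ σ ls)) (partitions m) a n ⟩
    ∑ (λ ls → act (scale (weight ls) (pλ σ ls)) a n) (partitions m)
      ≡⟨ ∑-cong (λ ls → trans (act-scale (weight ls) (pλ σ ls) a n) (cong (weight ls *_) (act-pλ ls a n))) (partitions m) ⟩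
    h.H m a n
      ≡⟨ h.H≗gop m a n ⟩
    gop D t m a n
      ∎

  act-eSpec : ∀ m a → act (eSpec σ m) a ≗ gop D (- t) m a
  act-eSpec m a n = begin
    act (eSpec σ m) a n
      ≡⟨ act-sumP (λ ls → scale (sgn (m ∸ length ls) * weight ls) (pλ σ ls)) (partitions m) a n ⟩
    partSum m (λ ls → act (scale (sgn (m ∸ length ls) * weight ls) (pλ σ ls)) a n) m
      ≡⟨ partSum-cong m m absorb-sign ⟩
    e.H m a n
      ≡⟨ e.H≗gop m a n ⟩
    gop D (- t) m a n
      ∎
    where
    rotate : ∀ x y z → x * y * z ≡ y * (x * z)
    rotate = solve-∀ ℚ-ring
    absorb-sign : ∀ ls → sumℕ ls ≡ m → All (IsPart m) ls →
      act (scale (sgn (m ∸ length ls) * weight ls) (pλ σ ls)) a n ≡ weight ls * e.P* ls a n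
    absorb-sign ls sum≡m ps = begin
      act (scale (sgn (m ∸ length ls) * weight ls) (pλ σ ls)) a n      ≡⟨ act-scale (sgn (m ∸ length ls) * weight ls) (pλ σ ls) a n ⟩
      sgn (m ∸ length ls) * weight ls * act (pλ σ ls) a n              ≡⟨ cong (sgn (m ∸ length ls) * weight ls *_) (act-pλ ls a n) ⟩
      sgn (m ∸ length ls) * weight ls * h.P* ls a n                    ≡⟨ rotate (sgn (m ∸ length ls)) (weight ls) (h.P* ls a n) ⟩
      weight ls * (sgn (m ∸ length ls) * h.P* ls a n)                  ≡⟨ cong (λ k → weight ls * (sgn (k ∸ length ls) * h.P* ls a n)) sum≡m ⟨
      weight ls * (sgn (sumℕ ls ∸ length ls) * h.P* ls a n)            ≡⟨ cong (weight ls *_) (sign-P* ls a n ps) ⟨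
      weight ls * e.P* ls a n                                          ∎

private
  -- Raising the index by 2 keeps its parity and raises the quotient by 1, which flips the sign. The
  -- function g gives the values at even indices in terms of the quotient.
  spec₊₂ : ∀ (g : ℕ → ℚ) → (∀ q → g (suc q) ≡ - g q) → ∀ i a n →
    act (if (2 ℕ.+ i) % 2 ≡ᵇ 1 then scale (sgn ((2 ℕ.+ i) / 2)) varE else constP (g ((2 ℕ.+ i) / 2))) a n ≡
    - act (if i % 2 ≡ᵇ 1 then scale (sgn (i / 2)) varE else constP (g (i / 2))) a n
  spec₊₂ g g-suc i a n = trans
    (cong₂ (λ r q → act (if r ≡ᵇ 1 then scale (sgn q) varE else constP (g q)) a n) (2+n%2 i) (2+n/2 i))
    (by-parity (i % 2 ≡ᵇ 1))
    where
    q = i / 2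
    odd : ∀ s x y → - s * 0ℚ * x + (- s * 1ℚ * y + 0ℚ) ≡ - (s * 0ℚ * x + (s * 1ℚ * y + 0ℚ))
    odd = solve-∀ ℚ-ring
    even : ∀ g x → - g * x + 0ℚ ≡ - (g * x + 0ℚ)
    even = solve-∀ ℚ-ring
    by-parity : ∀ b → act (if b then scale (sgn (suc q)) varE else constP (g (suc q))) a n ≡ - act (if b then scale (sgn q) varE else constP (g q)) a n
    by-parity true  = odd (sgn q) (a n) (D a n)
    by-parity false = trans (cong (λ x → x * a n + 0ℚ) (g-suc q)) (even (g q) (a n))

  spec₁ : ∀ a n → act (scale 1ℚ varE) a n ≡ D a n
  spec₁ a n = lemma (a n) (D a n)
    where
    lemma : ∀ x y → 1ℚ * 0ℚ * x + (1ℚ * 1ℚ * y + 0ℚ) ≡ y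
    lemma = solve-∀ ℚ-ring

σodd-isSpec : IsSpec σodd 0ℚ
σodd-isSpec = record { σ₁ = spec₁ ; σ₂ = act-const 0ℚ ; σ₊₂ = λ j → spec₊₂ (λ _ → 0ℚ) (λ _ → refl) (suc j) }

σminus-isSpec : IsSpec σminus (- 1ℚ)
σminus-isSpec = record { σ₁ = spec₁ ; σ₂ = act-const (- 1ℚ) ; σ₊₂ = λ j → spec₊₂ sgn (λ _ → refl) (suc j) }

σplus-isSpec : IsSpec σplus 1ℚ
σplus-isSpec = record { σ₁ = spec₁ ; σ₂ = act-const 1ℚ ; σ₊₂ = λ j → spec₊₂ (sgn ∘ suc) (λ _ → refl) (suc j) }

-- The coefficient of x₁^α₁ ⋯ x_k^α_k in ∏ (1 + x_i²)^(s_i/2) exp (T arctan x_i), where s_i depends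
-- on whether i ∈ X.
gops : ((I → ℚ) → I → ℚ) → (Bool → ℚ) → ∀ {k} → Subset k → Vec ℕ k → (I → ℚ) → I → ℚ
gops T s []      []      a = a
gops T s (x ∷ X) (m ∷ α) a = gop T (s x) m (gops T s X α a)

factorAt : ∀ {k} → Vec ℕ k → Subset k → Subset k → Spec → Fin k → Poly
factorAt α A B σ i = (if lookup A i then eSpec σ (lookup α i) else constP 1ℚ)
                   ⊗ (if lookup B i then hSpec σ (lookup α i) else constP 1ℚ)

-- X is a parameter because the runs decide which set counts: X = A for N and X = B for N*. As A and
-- B are complementary, one of the two factors at each letter is 1.
rhs-gops : ∀ {σ t} → IsSpec σ t → ∀ (s : Bool → ℚ) {k} (α : Vec ℕ k) A B X →
  (∀ i → lookup B i ≡ not (lookup A i)) → (∀ i → s (lookup X i) ≡ (if lookup A i then - t else t)) →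
  rhs α A B σ ≡ gops D s X α secTanC 0
rhs-gops {σ} {t} isSpec s α A B X B≡ s≡ =
  trans (cong (umbral ∘ prodP) (Listₚ.map-tabulate id (factorAt α A B σ))) (trans (umbral-act (prodP (tabulate (factorAt α A B σ)))) (go α A B X B≡ s≡ secTanC 0))
  where
  one-factor : ∀ b m a → act ((if b then eSpec σ m else constP 1ℚ) ⊗ (if not b then hSpec σ m else constP 1ℚ)) a ≗ gop D (if b then - t else t) m a
  one-factor true  m a n = trans (act-⊗ (eSpec σ m) (constP 1ℚ) a n) (trans
    (cong-≗ (act-linear (eSpec σ m)) (λ n → trans (act-const 1ℚ a n) (ℚₚ.*-identityˡ (a n))) n) (act-eSpec isSpec m a n))
  one-factor false m a n = trans (act-⊗ (constP 1ℚ) (hSpec σ m) a n) (trans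
    (act-const 1ℚ (act (hSpec σ m) a) n) (trans (ℚₚ.*-identityˡ (act (hSpec σ m) a n)) (act-hSpec isSpec m a n)))
  go : ∀ {k} (α : Vec ℕ k) A B X → (∀ i → lookup B i ≡ not (lookup A i)) → (∀ i → s (lookup X i) ≡ (if lookup A i then - t else t)) →
    ∀ a n → act (prodP (tabulate (factorAt α A B σ))) a n ≡ gops D s X α a n
  go []      []      []      []      B≡ s≡ a n = trans (act-const 1ℚ a n) (ℚₚ.*-identityˡ (a n))
  go (m ∷ α) (b ∷ A) (b′ ∷ B) (x ∷ X) B≡ s≡ a n = begin
    act (f ⊗ rest) a n                                ≡⟨ act-⊗ f rest a n ⟩
    act f (act rest a) n                              ≡⟨ cong-≗ (act-linear f) (go α A B X (B≡ ∘ suc) (s≡ ∘ suc) a) n ⟩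
    act f g n                                         ≡⟨ cong (λ c → act ((if b then eSpec σ m else constP 1ℚ) ⊗ (if c then hSpec σ m else constP 1ℚ)) g n) (B≡ zero) ⟩
    act ((if b then eSpec σ m else constP 1ℚ) ⊗ (if not b then hSpec σ m else constP 1ℚ)) g n  ≡⟨ one-factor b m g n ⟩
    gop D (if b then - t else t) m g n                ≡⟨ cong (λ c → gop D c m g n) (s≡ zero) ⟨
    gop D (s x) m g n                                 ∎
    where
    f    = factorAt (m ∷ α) (b ∷ A) (b′ ∷ B) σ zero
    rest = prodP (tabulate (factorAt α A B σ))
    g    = gops D s X α a

-- Words

⟦_⟧ : Bool → ℚ
⟦ true  ⟧ = 1ℚ
⟦ false ⟧ = 0ℚ

⟦∧⟧ : ∀ b c → ⟦ b ∧ c ⟧ ≡ ⟦ b ⟧ * ⟦ c ⟧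
⟦∧⟧ true  c = sym (ℚₚ.*-identityˡ ⟦ c ⟧)
⟦∧⟧ false c = sym (ℚₚ.*-zeroˡ ⟦ c ⟧)

⟦not⟧ : ∀ b → ⟦ not b ⟧ ≡ 1ℚ - ⟦ b ⟧
⟦not⟧ true  = refl
⟦not⟧ false = refl

length-filterᵇ : ∀ (p : A → Bool) xs → ℕtoℚ (length (filterᵇ p xs)) ≡ ∑ (λ x → ⟦ p x ⟧) xs
length-filterᵇ p []       = refl
length-filterᵇ p (x ∷ xs) with p x
... | true  = trans (ℕtoℚ-suc (length (filterᵇ p xs))) (cong (1ℚ +_) (length-filterᵇ p xs))
... | false = trans (length-filterᵇ p xs) (sym (ℚₚ.+-identityˡ (∑ (λ x → ⟦ p x ⟧) xs)))

sumF : ∀ k → (Fin k → ℚ) → ℚ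
sumF zero    f = 0ℚ
sumF (suc k) f = f zero + sumF k (f ∘ suc)

∑-allFin : ∀ k f → ∑ f (allFin k) ≡ sumF k f
∑-allFin k f = trans (cong sumℚ (Listₚ.map-tabulate id f)) (go k f)
  where
  go : ∀ k (f : Fin k → ℚ) → sumℚ (tabulate f) ≡ sumF k f
  go zero    f = refl
  go (suc k) f = cong (f zero +_) (go k (f ∘ suc))

sumF-cong : ∀ k {f g} → f ≗ g → sumF k f ≡ sumF k g
sumF-cong zero    f≗g = refl
sumF-cong (suc k) f≗g = cong₂ _+_ (f≗g zero) (sumF-cong k (f≗g ∘ suc))

sumF-+ : ∀ k f g → sumF k (λ x → f x + g x) ≡ sumF k f + sumF k g
sumF-+ zero    f g = refl
sumF-+ (suc k) f g = trans (cong (f zero + g zero +_) (sumF-+ k (f ∘ suc) (g ∘ suc)))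
  (+-interchange (f zero) (g zero) (sumF k (f ∘ suc)) (sumF k (g ∘ suc)))

sumF-* : ∀ k c f → sumF k (λ x → c * f x) ≡ c * sumF k f
sumF-* zero    c f = sym (ℚₚ.*-zeroʳ c)
sumF-* (suc k) c f = trans (cong (c * f zero +_) (sumF-* k c (f ∘ suc))) (sym (ℚₚ.*-distribˡ-+ c (f zero) (sumF k (f ∘ suc))))

sumF-linear : {φ : (I → ℚ) → I′ → ℚ} → Linear φ → ∀ k (f : Fin k → I → ℚ) i →
  φ (λ i → sumF k (λ x → f x i)) i ≡ sumF k (λ x → φ (f x) i)
sumF-linear φ-lin zero    f i = linear-zero φ-lin i
sumF-linear {φ = φ} φ-lin (suc k) f i =
  trans (+-homo φ-lin (f zero) (λ i → sumF k (λ x → f (suc x) i)) i) (cong (φ (f zero) i +_) (sumF-linear φ-lin k (f ∘ suc) i))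

sumW : ∀ {k} → ℕ → (List (Fin k) → ℚ) → ℚ
sumW     zero    f = f []
sumW {k} (suc n) f = sumF k (λ x → sumW n (f ∘ (x ∷_)))

∑-words : ∀ k n f → ∑ f (words k n) ≡ sumW n f
∑-words k zero    f = ℚₚ.+-identityʳ (f [])
∑-words k (suc n) f = begin
  ∑ f (List.concatMap (λ x → map (x ∷_) (words k n)) (allFin k))   ≡⟨ ∑-concatMap f (λ x → map (x ∷_) (words k n)) (allFin k) ⟩
  ∑ (λ x → ∑ f (map (x ∷_) (words k n))) (allFin k)                ≡⟨ ∑-cong (λ x → trans (∑-map f (x ∷_) (words k n)) (∑-words k n (f ∘ (x ∷_)))) (allFin k) ⟩
  ∑ (λ x → sumW n (f ∘ (x ∷_))) (allFin k)                         ≡⟨ ∑-allFin k (λ x → sumW n (f ∘ (x ∷_))) ⟩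
  sumW (suc n) f                                                   ∎

sumW-cong : ∀ {k} n {f g : List (Fin k) → ℚ} → (∀ w → length w ≡ n → f w ≡ g w) → sumW n f ≡ sumW n g
sumW-cong zero    f≡g = f≡g [] refl
sumW-cong {k} (suc n) f≡g = sumF-cong k (λ x → sumW-cong n (λ w eq → f≡g (x ∷ w) (cong suc eq)))

sumW-+ : ∀ {k} n (f g : List (Fin k) → ℚ) → sumW n (λ w → f w + g w) ≡ sumW n f + sumW n g
sumW-+ zero    f g = refl
sumW-+ {k} (suc n) f g = trans (sumF-cong k (λ x → sumW-+ n (f ∘ (x ∷_)) (g ∘ (x ∷_))))
  (sumF-+ k (λ x → sumW n (f ∘ (x ∷_))) (λ x → sumW n (g ∘ (x ∷_))))

sumW-* : ∀ {k} n c (f : List (Fin k) → ℚ) → sumW n (λ w → c * f w) ≡ c * sumW n f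
sumW-* zero    c f = refl
sumW-* {k} (suc n) c f = trans (sumF-cong k (λ x → sumW-* n c (f ∘ (x ∷_)))) (sumF-* k c (λ x → sumW n (f ∘ (x ∷_))))

sumW-zero : ∀ {k} n (f : List (Fin k) → ℚ) → (∀ w → f w ≡ 0ℚ) → sumW n f ≡ 0ℚ
sumW-zero n f f≡0 = begin
  sumW n f                   ≡⟨ sumW-cong n (λ w _ → trans (f≡0 w) (sym (ℚₚ.*-zeroˡ 0ℚ))) ⟩
  sumW n (λ _ → 0ℚ * 0ℚ)     ≡⟨ sumW-* n 0ℚ (λ _ → 0ℚ) ⟩
  0ℚ * sumW n (λ _ → 0ℚ)     ≡⟨ ℚₚ.*-zeroˡ (sumW n (λ _ → 0ℚ)) ⟩
  0ℚ                         ∎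

sumW-linear : ∀ {k} {φ : (I → ℚ) → I′ → ℚ} → Linear φ → ∀ n (f : List (Fin k) → I → ℚ) i →
  φ (λ i → sumW n (λ w → f w i)) i ≡ sumW n (λ w → φ (f w) i)
sumW-linear φ-lin zero    f i = refl
sumW-linear {k = k} φ-lin (suc n) f i = trans (sumF-linear φ-lin k (λ x i → sumW n (λ w → f (x ∷ w) i)) i)
  (sumF-cong k (λ x → sumW-linear φ-lin n (f ∘ (x ∷_)) i))

sumW-∷ʳ : ∀ {k} n (f : List (Fin k) → ℚ) → sumF k (λ x → sumW n (λ w → f (w ∷ʳ x))) ≡ sumW (suc n) f
sumW-∷ʳ zero        f = refl
sumW-∷ʳ {k} (suc n) f = begin
  sumF k (λ x → sumF k (λ y → sumW n (λ w → f (y ∷ w ∷ʳ x))))      ≡⟨ sumF-swap k k (λ x y → sumW n (λ w → f (y ∷ w ∷ʳ x))) ⟩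
  sumF k (λ y → sumF k (λ x → sumW n (λ w → f (y ∷ w ∷ʳ x))))      ≡⟨ sumF-cong k (λ y → sumW-∷ʳ n (f ∘ (y ∷_))) ⟩
  sumW (2 ℕ.+ n) f                                                  ∎
  where
  sumF-zero : ∀ k → sumF k (λ _ → 0ℚ) ≡ 0ℚ
  sumF-zero zero    = refl
  sumF-zero (suc k) = trans (ℚₚ.+-identityˡ (sumF k (λ _ → 0ℚ))) (sumF-zero k)
  sumF-swap : ∀ k l (g : Fin k → Fin l → ℚ) → sumF k (λ x → sumF l (g x)) ≡ sumF l (λ y → sumF k (λ x → g x y))
  sumF-swap zero    l g = sym (sumF-zero l)
  sumF-swap (suc k) l g = trans (cong (sumF l (g zero) +_) (sumF-swap k l (g ∘ suc)))
    (sym (sumF-+ l (g zero) (λ y → sumF k (λ x → g (suc x) y))))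

sumW-reverse : ∀ {k} n (f : List (Fin k) → ℚ) → sumW n (f ∘ reverse) ≡ sumW n f
sumW-reverse zero    f = refl
sumW-reverse {k} (suc n) f = begin
  sumF k (λ x → sumW n (λ w → f (reverse (x ∷ w))))   ≡⟨ sumF-cong k (λ x → sumW-cong n (λ w _ → cong f (Listₚ.unfold-reverse x w))) ⟩
  sumF k (λ x → sumW n (λ w → f (reverse w ∷ʳ x)))    ≡⟨ sumF-cong k (λ x → sumW-reverse n (λ w → f (w ∷ʳ x))) ⟩
  sumF k (λ x → sumW n (λ w → f (w ∷ʳ x)))            ≡⟨ sumW-∷ʳ n f ⟩
  sumW (suc n) f                                      ∎

-- Multiplication by x_i (δ i) and by the monomial of a word (δ* w), on power series given by their
-- coefficients.
δ : ∀ {k} → Fin k → (Vec ℕ k → ℚ) → Vec ℕ k → ℚ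
δ zero    φ (zero ∷ α)  = 0ℚ
δ zero    φ (suc m ∷ α) = φ (m ∷ α)
δ (suc x) φ (m ∷ α)     = δ x (φ ∘ (m ∷_)) α

δ* : ∀ {k} → List (Fin k) → (Vec ℕ k → ℚ) → Vec ℕ k → ℚ
δ* []      φ = φ
δ* (x ∷ w) φ = δ x (δ* w φ)

δ-linear : ∀ {k} (x : Fin k) → Linear (δ x)
δ-linear x = record { cong-≗ = congr x ; +-homo = add x ; *-homo = mul x }
  where
  congr : ∀ {k} (x : Fin k) {φ ψ} → φ ≗ ψ → δ x φ ≗ δ x ψ
  congr zero    φ≗ψ (zero ∷ α)  = refl
  congr zero    φ≗ψ (suc m ∷ α) = φ≗ψ (m ∷ α)
  congr (suc x) φ≗ψ (m ∷ α)     = congr x (φ≗ψ ∘ (m ∷_)) α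
  add : ∀ {k} (x : Fin k) φ ψ α → δ x (λ α → φ α + ψ α) α ≡ δ x φ α + δ x ψ α
  add zero    φ ψ (zero ∷ α)  = refl
  add zero    φ ψ (suc m ∷ α) = refl
  add (suc x) φ ψ (m ∷ α)     = add x (φ ∘ (m ∷_)) (ψ ∘ (m ∷_)) α
  mul : ∀ {k} (x : Fin k) c φ α → δ x (λ α → c * φ α) α ≡ c * δ x φ α
  mul zero    c φ (zero ∷ α)  = sym (ℚₚ.*-zeroʳ c)
  mul zero    c φ (suc m ∷ α) = refl
  mul (suc x) c φ (m ∷ α)     = mul x c (φ ∘ (m ∷_)) α

δ*-linear : ∀ {k} (w : List (Fin k)) → Linear (δ* w)
δ*-linear []      = id-linear
δ*-linear (x ∷ w) = ∘-linear (δ-linear x) (δ*-linear w)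

δ-cong : ∀ {k} (x : Fin k) {φ ψ} α → (∀ β → suc (Vec.sum β) ≡ Vec.sum α → φ β ≡ ψ β) → δ x φ α ≡ δ x ψ α
δ-cong zero    (zero ∷ α)  φ≡ψ = refl
δ-cong zero    (suc m ∷ α) φ≡ψ = φ≡ψ (m ∷ α) refl
δ-cong (suc x) (m ∷ α)     φ≡ψ = δ-cong x α (λ β eq → φ≡ψ (m ∷ β) (trans (sym (ℕₚ.+-suc m (Vec.sum β))) (cong (m ℕ.+_) eq)))

δ*-cong : ∀ {k} (w : List (Fin k)) {φ ψ} α → (∀ β → length w ℕ.+ Vec.sum β ≡ Vec.sum α → φ β ≡ ψ β) → δ* w φ α ≡ δ* w ψ α
δ*-cong []      α φ≡ψ = φ≡ψ α refl
δ*-cong (x ∷ w) α φ≡ψ = δ-cong x α (λ β eq → δ*-cong w β (λ γ eq′ → φ≡ψ γ (trans (cong suc eq′) eq)))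

δ-comm : ∀ {k} (x y : Fin k) φ → δ x (δ y φ) ≗ δ y (δ x φ)
δ-comm zero    zero    φ α           = refl
δ-comm zero    (suc y) φ (zero ∷ α)  = sym (linear-zero (δ-linear y) α)
δ-comm zero    (suc y) φ (suc m ∷ α) = refl
δ-comm (suc x) zero    φ (zero ∷ α)  = linear-zero (δ-linear x) α
δ-comm (suc x) zero    φ (suc m ∷ α) = refl
δ-comm (suc x) (suc y) φ (m ∷ α)     = δ-comm x y (φ ∘ (m ∷_)) α

δ*-∷ʳ : ∀ {k} (w : List (Fin k)) x φ → δ* (w ∷ʳ x) φ ≗ δ x (δ* w φ)
δ*-∷ʳ []      x φ α = refl
δ*-∷ʳ (y ∷ w) x φ α = trans (cong-≗ (δ-linear y) (δ*-∷ʳ w x φ) α) (δ-comm y x (δ* w φ) α)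

δ*-reverse : ∀ {k} (w : List (Fin k)) φ → δ* (reverse w) φ ≗ δ* w φ
δ*-reverse []      φ α = refl
δ*-reverse (x ∷ w) φ α = begin
  δ* (reverse (x ∷ w)) φ α    ≡⟨ cong (λ v → δ* v φ α) (Listₚ.unfold-reverse x w) ⟩
  δ* (reverse w ∷ʳ x) φ α     ≡⟨ δ*-∷ʳ (reverse w) x φ α ⟩
  δ x (δ* (reverse w) φ) α    ≡⟨ cong-≗ (δ-linear x) (δ*-reverse w φ) α ⟩
  δ x (δ* w φ) α              ∎

δ*-++ : ∀ {k} (u v : List (Fin k)) φ → δ* (u ++ v) φ ≗ δ* u (δ* v φ)
δ*-++ []      v φ α = refl
δ*-++ (x ∷ u) v φ α = cong-≗ (δ-linear x) (δ*-++ u v φ) α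

δ*-map-suc : ∀ {k} (w : List (Fin k)) φ m α → δ* (map suc w) φ (m ∷ α) ≡ δ* w (φ ∘ (m ∷_)) α
δ*-map-suc []      φ m α = refl
δ*-map-suc (x ∷ w) φ m α = cong-≗ (δ-linear x) (δ*-map-suc w φ m) α

-- L acts on a different index than the multiplicities, so the two operations commute.
δ*-natural : ∀ {k} {L : (I → ℚ) → I′ → ℚ} → Linear L → ∀ (w : List (Fin k)) (φ : Vec ℕ k → I → ℚ) α i →
  L (λ i → δ* w (λ β → φ β i) α) i ≡ δ* w (λ β → L (φ β) i) α
δ*-natural         L-lin []      φ α i = refl
δ*-natural {L = L} L-lin (x ∷ w) φ α i =
  trans (single x (λ β i → δ* w (λ β → φ β i) β) α) (cong-≗ (δ-linear x) (λ β → δ*-natural L-lin w φ β i) α)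
  where
  single : ∀ {k} (x : Fin k) (φ : Vec ℕ k → _ → ℚ) α → L (λ i → δ x (λ β → φ β i) α) i ≡ δ x (λ β → L (φ β) i) α
  single zero    φ (zero ∷ α)  = linear-zero L-lin i
  single zero    φ (suc m ∷ α) = refl
  single (suc x) φ (m ∷ α)     = single x (φ ∘ (m ∷_)) α

-- The power series 1 in k variables, so that `δ* w 1₀` is the monomial of w.
1₀ : ∀ {k} → Vec ℕ k → ℚ
1₀ []          = 1ℚ
1₀ (zero ∷ α)  = 1₀ α
1₀ (suc m ∷ α) = 0ℚ

1₀-positive : ∀ {k} (α : Vec ℕ k) → 0 ℕ.< Vec.sum α → 1₀ α ≡ 0ℚ
1₀-positive (zero ∷ α)  0<α = 1₀-positive α 0<α
1₀-positive (suc m ∷ α) _   = refl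

-- `isαPerm` with the letter counts abstracted, so that a single count can be raised at a time.
agrees : ∀ {k} → (Fin k → ℕ) → Vec ℕ k → Bool
agrees c []      = true
agrees c (m ∷ α) = (c zero ≡ᵇ m) ∧ agrees (c ∘ suc) α

isαPerm-agrees : ∀ {k} (α : Vec ℕ k) w → isαPerm α w ≡ agrees (λ i → occ i w) α
isαPerm-agrees α w = trans (cong Data.Bool.ListAction.and (Listₚ.map-tabulate id (λ i → occ i w ≡ᵇ lookup α i))) (go (λ i → occ i w) α)
  where
  go : ∀ {k} (c : Fin k → ℕ) α → Data.Bool.ListAction.and (tabulate (λ i → c i ≡ᵇ lookup α i)) ≡ agrees c α
  go c []      = refl
  go c (m ∷ α) = cong ((c zero ≡ᵇ m) ∧_) (go (c ∘ suc) α)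

agrees-cong : ∀ {k} {c d : Fin k → ℕ} → c ≗ d → ∀ α → agrees c α ≡ agrees d α
agrees-cong c≗d []      = refl
agrees-cong c≗d (m ∷ α) = cong₂ (λ x b → (x ≡ᵇ m) ∧ b) (c≗d zero) (agrees-cong (c≗d ∘ suc) α)

agrees-bump : ∀ {k} (x : Fin k) {c d : Fin k → ℕ} → d x ≡ suc (c x) → (∀ y → y ≢ x → d y ≡ c y) →
  ∀ α → ⟦ agrees d α ⟧ ≡ δ x (λ β → ⟦ agrees c β ⟧) α
agrees-bump zero {c} {d} dx dy (zero ∷ α)  rewrite dx = refl
agrees-bump zero {c} {d} dx dy (suc m ∷ α) rewrite dx =
  cong (λ b → ⟦ (c zero ≡ᵇ m) ∧ b ⟧) (agrees-cong (λ i → dy (suc i) (λ ())) α)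
agrees-bump (suc x) {c} {d} dx dy (m ∷ α) = begin
  ⟦ (d zero ≡ᵇ m) ∧ agrees (d ∘ suc) α ⟧                     ≡⟨ ⟦∧⟧ (d zero ≡ᵇ m) (agrees (d ∘ suc) α) ⟩
  ⟦ d zero ≡ᵇ m ⟧ * ⟦ agrees (d ∘ suc) α ⟧                   ≡⟨ cong₂ (λ n y → ⟦ n ≡ᵇ m ⟧ * y) (dy zero (λ ()))
                                                                   (agrees-bump x dx (λ y y≢x → dy (suc y) (y≢x ∘ Finₚ.suc-injective)) α) ⟩
  ⟦ c zero ≡ᵇ m ⟧ * δ x (λ β → ⟦ agrees (c ∘ suc) β ⟧) α     ≡⟨ *-homo (δ-linear x) ⟦ c zero ≡ᵇ m ⟧ (λ β → ⟦ agrees (c ∘ suc) β ⟧) α ⟨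
  δ x (λ β → ⟦ c zero ≡ᵇ m ⟧ * ⟦ agrees (c ∘ suc) β ⟧) α     ≡⟨ cong-≗ (δ-linear x) (λ β → ⟦∧⟧ (c zero ≡ᵇ m) (agrees (c ∘ suc) β)) α ⟨
  δ x (λ β → ⟦ (c zero ≡ᵇ m) ∧ agrees (c ∘ suc) β ⟧) α       ∎

isαPerm-δ* : ∀ {k} (w : List (Fin k)) α → ⟦ isαPerm α w ⟧ ≡ δ* w 1₀ α
isαPerm-δ* w α = trans (cong ⟦_⟧ (isαPerm-agrees α w)) (go w α)
  where
  empty : ∀ {k} (α : Vec ℕ k) → ⟦ agrees (λ _ → 0) α ⟧ ≡ 1₀ α
  empty []          = refl
  empty (zero ∷ α)  = empty α
  empty (suc m ∷ α) = refl
  occ-here : ∀ {k} (x : Fin k) w → occ x (x ∷ w) ≡ suc (occ x w)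
  occ-here x w with x Fin.≟ x
  ... | yes _  = refl
  ... | no x≢x = ⊥-elim (x≢x refl)
  occ-there : ∀ {k} (x y : Fin k) w → y ≢ x → occ y (x ∷ w) ≡ occ y w
  occ-there x y w y≢x with x Fin.≟ y
  ... | yes x≡y = ⊥-elim (y≢x (sym x≡y))
  ... | no _    = refl
  go : ∀ {k} (w : List (Fin k)) α → ⟦ agrees (λ i → occ i w) α ⟧ ≡ δ* w 1₀ α
  go []      α = empty α
  go (x ∷ w) α = trans (agrees-bump x (occ-here x w) (λ y → occ-there x y w) α) (cong-≗ (δ-linear x) (go w) α)

-- Telescoping over factorisations into a run and an alternating word

run : (A → A → Bool) → List A → Bool
run r (x ∷ y ∷ w) = r x y ∧ run r (y ∷ w)
run r _           = true

-- For complementary A and B the relations `gtAB A` and `ltAB B` are negations of each other, so one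
-- relation r describes both kinds of steps.
alt : (A → A → Bool) → Bool → List A → Bool
alt r d (x ∷ y ∷ w) = (if d then r x y else not (r x y)) ∧ alt r (not d) (y ∷ w)
alt r d _           = true

splits : (List A → List A → ℚ) → List A → ℚ
splits h []      = h [] []
splits h (x ∷ w) = h [] (x ∷ w) + splits (h ∘ (x ∷_)) w

splits-cong : {h h′ : List A → List A → ℚ} → (∀ u v → h u v ≡ h′ u v) → splits h ≗ splits h′
splits-cong h≡h′ []      = h≡h′ [] []
splits-cong h≡h′ (x ∷ w) = cong₂ _+_ (h≡h′ [] (x ∷ w)) (splits-cong (λ u → h≡h′ (x ∷ u)) w)

splits-* : ∀ c (h : List A → List A → ℚ) w → splits (λ u v → c * h u v) w ≡ c * splits h w
splits-* c h []      = refl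
splits-* c h (x ∷ w) = trans (cong (c * h [] (x ∷ w) +_) (splits-* c (h ∘ (x ∷_)) w))
  (sym (ℚₚ.*-distribˡ-+ c (h [] (x ∷ w)) (splits (h ∘ (x ∷_)) w)))

splits-++ : ∀ (h : List A → List A → ℚ) g w → splits (λ u v → h u v * g (u ++ v)) w ≡ splits h w * g w
splits-++ h g []      = refl
splits-++ h g (x ∷ w) = trans (cong (h [] (x ∷ w) * g (x ∷ w) +_) (splits-++ (h ∘ (x ∷_)) (g ∘ (x ∷_)) w))
  (sym (ℚₚ.*-distribʳ-+ (g (x ∷ w)) (h [] (x ∷ w)) (splits (h ∘ (x ∷_)) w)))

module Telescope (r : A → A → Bool) where

  -- `reI` vanishes at odd lengths and is (-1)^j at length 2j, so only runs of even length count.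
  signedSplit : List A → List A → ℚ
  signedSplit u v = reI (length u) * (⟦ run r u ⟧ * ⟦ alt r true v ⟧)

  private
    signedSplitAfter : A → List A → List A → ℚ
    signedSplitAfter y u v = reI (length u) * (⟦ run r (y ∷ u) ⟧ * ⟦ alt r true v ⟧)

    -- The letter y stands before the run, and a, b are the next two. The empty u asks nothing of y
    -- and a; the u of length at least 2 subtract the case `r y a`. What remains is `not (r y a)`,
    -- which prolongs the alternation leftwards to y. The term with `imI` is the boundary effect of
    -- a run that reaches the end of a word w of odd length.
    telescope-after : ∀ y w → splits (signedSplitAfter y) w ≡ ⟦ alt r false (y ∷ w) ⟧ + imI (length w) * ⟦ run r (y ∷ w) ⟧
    telescope-after y []      = refl
    telescope-after y (a ∷ []) with r y a
    ... | true  = refl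
    ... | false = refl
    telescope-after y (a ∷ b ∷ w) = begin
      1ℚ * (1ℚ * ⟦ r a b ∧ alt r false (b ∷ w) ⟧) + (0ℚ * (⟦ r y a ∧ true ⟧ * ⟦ alt r true (b ∷ w) ⟧) + splits (λ u → signedSplitAfter y (a ∷ b ∷ u)) w)
        ≡⟨ cong₂ (λ p q → 1ℚ * (1ℚ * p) + (0ℚ * (⟦ r y a ∧ true ⟧ * ⟦ alt r true (b ∷ w) ⟧) + q)) (⟦∧⟧ (r a b) (alt r false (b ∷ w))) inner ⟩
      1ℚ * (1ℚ * (ab * al)) + (0ℚ * (⟦ r y a ∧ true ⟧ * ⟦ alt r true (b ∷ w) ⟧) + - (ya * ab) * (al + c * ru))
        ≡⟨ regroup ya ab al c ru (⟦ r y a ∧ true ⟧ * ⟦ alt r true (b ∷ w) ⟧) ⟩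
      (1ℚ - ya) * (ab * al) + - c * (ya * (ab * ru))
        ≡⟨ cong₂ (λ p q → p + - c * q) (sym alternating) (sym running) ⟩
      ⟦ alt r false (y ∷ a ∷ b ∷ w) ⟧ + - c * ⟦ run r (y ∷ a ∷ b ∷ w) ⟧
        ∎
      where
      ya = ⟦ r y a ⟧
      ab = ⟦ r a b ⟧
      al = ⟦ alt r false (b ∷ w) ⟧
      ru = ⟦ run r (b ∷ w) ⟧
      c = imI (length w)
      regroup : ∀ ya ab al c ru z → 1ℚ * (1ℚ * (ab * al)) + (0ℚ * z + - (ya * ab) * (al + c * ru)) ≡ (1ℚ - ya) * (ab * al) + - c * (ya * (ab * ru))
      regroup = solve-∀ ℚ-ring
      pull : ∀ i ya ab p q → - i * (ya * (ab * p) * q) ≡ - (ya * ab) * (i * (p * q))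
      pull = solve-∀ ℚ-ring
      running′ : ∀ u → ⟦ run r (y ∷ a ∷ b ∷ u) ⟧ ≡ ya * (ab * ⟦ run r (b ∷ u) ⟧)
      running′ u = trans (⟦∧⟧ (r y a) (r a b ∧ run r (b ∷ u))) (cong (ya *_) (⟦∧⟧ (r a b) (run r (b ∷ u))))
      running = running′ w
      alternating : ⟦ alt r false (y ∷ a ∷ b ∷ w) ⟧ ≡ (1ℚ - ya) * (ab * al)
      alternating = trans (⟦∧⟧ (not (r y a)) (r a b ∧ alt r false (b ∷ w))) (cong₂ _*_ (⟦not⟧ (r y a)) (⟦∧⟧ (r a b) (alt r false (b ∷ w))))
      inner : splits (λ u → signedSplitAfter y (a ∷ b ∷ u)) w ≡ - (ya * ab) * (al + c * ru)
      inner = begin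
        splits (λ u → signedSplitAfter y (a ∷ b ∷ u)) w
          ≡⟨ splits-cong (λ u v → trans (cong (λ p → - reI (length u) * (p * ⟦ alt r true v ⟧)) (running′ u))
                                        (pull (reI (length u)) ya ab ⟦ run r (b ∷ u) ⟧ ⟦ alt r true v ⟧)) w ⟩
        splits (λ u v → - (ya * ab) * signedSplitAfter b u v) w
          ≡⟨ splits-* (- (ya * ab)) (signedSplitAfter b) w ⟩
        - (ya * ab) * splits (signedSplitAfter b) w
          ≡⟨ cong (- (ya * ab) *_) (telescope-after b w) ⟩
        - (ya * ab) * (al + c * ru)
          ∎

  ε : List A → ℚ
  ε []      = 1ℚ
  ε (_ ∷ _) = 0ℚ

  -- Moving the boundary of a factorisation by two letters changes the sign, so the terms cancel in
  -- pairs.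
  telescope : ∀ w → splits signedSplit w ≡ ε w + imI (length w) * ⟦ run r w ⟧
  telescope []          = refl
  telescope (x ∷ [])    = refl
  telescope (x ∷ y ∷ w) = begin
    1ℚ * (1ℚ * ⟦ r x y ∧ alt r false (y ∷ w) ⟧) + (0ℚ * (1ℚ * ⟦ alt r true (y ∷ w) ⟧) + splits (λ u → signedSplit (x ∷ y ∷ u)) w)
      ≡⟨ cong₂ (λ p q → 1ℚ * (1ℚ * p) + (0ℚ * (1ℚ * ⟦ alt r true (y ∷ w) ⟧) + q)) (⟦∧⟧ (r x y) (alt r false (y ∷ w))) inner ⟩
    1ℚ * (1ℚ * (xy * al)) + (0ℚ * (1ℚ * ⟦ alt r true (y ∷ w) ⟧) + - xy * (al + c * ru))
      ≡⟨ regroup xy al c ru ⟦ alt r true (y ∷ w) ⟧ ⟩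
    0ℚ + - c * (xy * ru)
      ≡⟨ cong (λ q → 0ℚ + - c * q) (⟦∧⟧ (r x y) (run r (y ∷ w))) ⟨
    0ℚ + - c * ⟦ run r (x ∷ y ∷ w) ⟧
      ∎
    where
    xy = ⟦ r x y ⟧
    al = ⟦ alt r false (y ∷ w) ⟧
    ru = ⟦ run r (y ∷ w) ⟧
    c = imI (length w)
    regroup : ∀ xy al c ru z → 1ℚ * (1ℚ * (xy * al)) + (0ℚ * (1ℚ * z) + - xy * (al + c * ru)) ≡ 0ℚ + - c * (xy * ru)
    regroup = solve-∀ ℚ-ring
    pull : ∀ i xy p q → - i * (xy * p * q) ≡ - xy * (i * (p * q))
    pull = solve-∀ ℚ-ring
    inner : splits (λ u → signedSplit (x ∷ y ∷ u)) w ≡ - xy * (al + c * ru)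
    inner = begin
      splits (λ u → signedSplit (x ∷ y ∷ u)) w
        ≡⟨ splits-cong (λ u v → trans (cong (λ p → - reI (length u) * (p * ⟦ alt r true v ⟧)) (⟦∧⟧ (r x y) (run r (y ∷ u))))
                                      (pull (reI (length u)) xy ⟦ run r (y ∷ u) ⟧ ⟦ alt r true v ⟧)) w ⟩
      splits (λ u v → - xy * signedSplitAfter y u v) w
        ≡⟨ splits-* (- xy) (signedSplitAfter y) w ⟩
      - xy * splits (signedSplitAfter y) w
        ≡⟨ cong (- xy *_) (telescope-after y w) ⟩
      - xy * (al + c * ru)
        ∎

antidiag : (ℕ → ℕ → ℚ) → ℕ → ℚ
antidiag g zero    = g 0 0
antidiag g (suc n) = g 0 (suc n) + antidiag (g ∘ suc) n

antidiag-cong : ∀ {g g′} n → (∀ a l → a ℕ.+ l ≡ n → g a l ≡ g′ a l) → antidiag g n ≡ antidiag g′ n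
antidiag-cong zero    g≡g′ = g≡g′ 0 0 refl
antidiag-cong (suc n) g≡g′ = cong₂ _+_ (g≡g′ 0 (suc n) refl) (antidiag-cong n (λ a l eq → g≡g′ (suc a) l (cong suc eq)))

antidiag-neg : ∀ g n → antidiag (λ a l → - g a l) n ≡ - antidiag g n
antidiag-neg g zero    = refl
antidiag-neg g (suc n) = trans (cong (- g 0 (suc n) +_) (antidiag-neg (g ∘ suc) n)) (sym (ℚₚ.neg-distrib-+ (g 0 (suc n)) (antidiag (g ∘ suc) n)))

antidiag-last : ∀ g n → (∀ a l → a ℕ.< n → g a l ≡ 0ℚ) → antidiag g n ≡ g n 0
antidiag-last g zero    g≡0 = refl
antidiag-last g (suc n) g≡0 = trans (cong₂ _+_ (g≡0 0 (suc n) (s≤s z≤n)) (antidiag-last (g ∘ suc) n (λ a l a<n → g≡0 (suc a) l (s≤s a<n))))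
  (ℚₚ.+-identityˡ (g (suc n) 0))

sumF-antidiag : ∀ k (g : Fin k → ℕ → ℕ → ℚ) n → sumF k (λ x → antidiag (g x) n) ≡ antidiag (λ a l → sumF k (λ x → g x a l)) n
sumF-antidiag k g zero    = refl
sumF-antidiag k g (suc n) = trans (sumF-+ k (λ x → g x 0 (suc n)) (λ x → antidiag (g x ∘ suc) n))
  (cong (sumF k (λ x → g x 0 (suc n)) +_) (sumF-antidiag k (λ x → g x ∘ suc) n))

-- A word of length n with a factorisation is a pair of words whose lengths add up to n.
sumW-splits : ∀ {k} n (h : List (Fin k) → List (Fin k) → ℚ) →
  sumW n (splits h) ≡ antidiag (λ a l → sumW a (λ u → sumW l (h u))) n
sumW-splits zero    h = refl
sumW-splits {k} (suc n) h = begin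
  sumF k (λ x → sumW n (λ w → h [] (x ∷ w) + splits (h ∘ (x ∷_)) w))
    ≡⟨ sumF-cong k (λ x → sumW-+ n (λ w → h [] (x ∷ w)) (splits (h ∘ (x ∷_)))) ⟩
  sumF k (λ x → sumW n (λ w → h [] (x ∷ w)) + sumW n (splits (h ∘ (x ∷_))))
    ≡⟨ sumF-+ k (λ x → sumW n (λ w → h [] (x ∷ w))) (λ x → sumW n (splits (h ∘ (x ∷_)))) ⟩
  sumW (suc n) (h []) + sumF k (λ x → sumW n (splits (h ∘ (x ∷_))))
    ≡⟨ cong (sumW (suc n) (h []) +_) (trans (sumF-cong k (λ x → sumW-splits n (h ∘ (x ∷_))))
         (sumF-antidiag k (λ x a l → sumW a (λ u → sumW l (h (x ∷ u)))) n)) ⟩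
  sumW (suc n) (h []) + antidiag (λ a l → sumW (suc a) (λ u → sumW l (h u))) n
    ∎

-- The coefficient at α of φ times the sum of the monomials of all runs of length n.
runW : ∀ {k} → (Fin k → Fin k → Bool) → ℕ → (Vec ℕ k → ℚ) → Vec ℕ k → ℚ
runW r n φ α = sumW n (λ w → ⟦ run r w ⟧ * δ* w φ α)

altW : ∀ {k} → (Fin k → Fin k → Bool) → ℕ → Vec ℕ k → ℚ
altW r n α = sumW n (λ w → ⟦ alt r true w ⟧ * δ* w 1₀ α)

runW-cong : ∀ {k} (r : Fin k → Fin k → Bool) n {φ ψ} α → (∀ β → n ℕ.+ Vec.sum β ≡ Vec.sum α → φ β ≡ ψ β) →
  runW r n φ α ≡ runW r n ψ α
runW-cong r n α φ≡ψ = sumW-cong n (λ w len → cong (⟦ run r w ⟧ *_) (δ*-cong w α (λ β eq → φ≡ψ β (trans (cong (ℕ._+ Vec.sum β) (sym len)) eq))))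

runW-natural : ∀ {k} {L : (I → ℚ) → I′ → ℚ} → Linear L → ∀ (r : Fin k → Fin k → Bool) n (φ : Vec ℕ k → I → ℚ) α i →
  L (λ i → runW r n (λ β → φ β i) α) i ≡ runW r n (λ β → L (φ β) i) α
runW-natural L-lin r n φ α i = trans (sumW-linear L-lin n (λ w i → ⟦ run r w ⟧ * δ* w (λ β → φ β i) α) i)
  (sumW-cong n (λ w _ → trans (*-homo L-lin ⟦ run r w ⟧ (λ i → δ* w (λ β → φ β i) α) i) (cong (⟦ run r w ⟧ *_) (δ*-natural L-lin w φ α i))))

-- `telescope`, weighted by monomials and summed over all words of length n. The monomial of u ++ v
-- is a product, so each length of u gives the series of the runs times that of the alternating
-- words.
altW-recurrence : ∀ {k} (r : Fin k → Fin k → Bool) n α →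
  antidiag (λ a l → reI a * runW r a (altW r l) α) n ≡ one n * 1₀ α + imI n * runW r n 1₀ α
altW-recurrence {k} r n α = begin
  antidiag (λ a l → reI a * runW r a (altW r l) α) n
    ≡⟨ antidiag-cong n (λ a l _ → expand a l) ⟩
  antidiag (λ a l → sumW a (λ u → sumW l (λ v → signedSplit u v * δ* (u ++ v) 1₀ α))) n
    ≡⟨ sumW-splits n (λ u v → signedSplit u v * δ* (u ++ v) 1₀ α) ⟨
  sumW n (splits (λ u v → signedSplit u v * δ* (u ++ v) 1₀ α))
    ≡⟨ sumW-cong n (λ w len → begin
         splits (λ u v → signedSplit u v * δ* (u ++ v) 1₀ α) w               ≡⟨ splits-++ signedSplit (λ w → δ* w 1₀ α) w ⟩
         splits signedSplit w * δ* w 1₀ α                                    ≡⟨ cong (_* δ* w 1₀ α) (telescope w) ⟩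
         (ε w + imI (length w) * ⟦ run r w ⟧) * δ* w 1₀ α                    ≡⟨ cong (λ m → (ε w + imI m * ⟦ run r w ⟧) * δ* w 1₀ α) len ⟩
         (ε w + imI n * ⟦ run r w ⟧) * δ* w 1₀ α                             ≡⟨ distrib (ε w) (imI n) ⟦ run r w ⟧ (δ* w 1₀ α) ⟩
         ε w * δ* w 1₀ α + imI n * (⟦ run r w ⟧ * δ* w 1₀ α)                 ∎) ⟩
  sumW n (λ w → ε w * δ* w 1₀ α + imI n * (⟦ run r w ⟧ * δ* w 1₀ α))
    ≡⟨ sumW-+ n (λ w → ε w * δ* w 1₀ α) (λ w → imI n * (⟦ run r w ⟧ * δ* w 1₀ α)) ⟩
  sumW n (λ w → ε w * δ* w 1₀ α) + sumW n (λ w → imI n * (⟦ run r w ⟧ * δ* w 1₀ α))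
    ≡⟨ cong₂ _+_ (empty n) (sumW-* n (imI n) (λ w → ⟦ run r w ⟧ * δ* w 1₀ α)) ⟩
  one n * 1₀ α + imI n * runW r n 1₀ α
    ∎
  where
  open Telescope r
  distrib : ∀ e i p q → (e + i * p) * q ≡ e * q + i * (p * q)
  distrib = solve-∀ ℚ-ring
  assemble : ∀ i p q x → i * (p * (q * x)) ≡ i * (p * q) * x
  assemble = solve-∀ ℚ-ring
  empty : ∀ n → sumW n (λ w → ε w * δ* w 1₀ α) ≡ one n * 1₀ α
  empty zero    = refl
  empty (suc n) = begin
    sumW (suc n) (λ w → ε w * δ* w 1₀ α)      ≡⟨ sumW-cong (suc n) {f = λ w → ε w * δ* w 1₀ α} {g = λ _ → 0ℚ} (λ { (x ∷ w) _ → ℚₚ.*-zeroˡ (δ* (x ∷ w) 1₀ α) }) ⟩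
    sumW {k} (suc n) (λ _ → 0ℚ)               ≡⟨ sumW-zero {k} (suc n) (λ _ → 0ℚ) (λ _ → refl) ⟩
    0ℚ                                        ≡⟨ ℚₚ.*-zeroˡ (1₀ α) ⟨
    0ℚ * 1₀ α                                 ∎
  expand : ∀ a l → reI a * runW r a (altW r l) α ≡ sumW a (λ u → sumW l (λ v → signedSplit u v * δ* (u ++ v) 1₀ α))
  expand a l = begin
    reI a * runW r a (altW r l) α
      ≡⟨ sumW-* a (reI a) (λ u → ⟦ run r u ⟧ * δ* u (altW r l) α) ⟨
    sumW a (λ u → reI a * (⟦ run r u ⟧ * δ* u (altW r l) α))
      ≡⟨ sumW-cong a (λ u len → begin
           reI a * (⟦ run r u ⟧ * δ* u (altW r l) α)
             ≡⟨ cong₂ (λ m x → reI m * (⟦ run r u ⟧ * x)) (sym len) (inner u) ⟩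
           reI (length u) * (⟦ run r u ⟧ * sumW l (λ v → ⟦ alt r true v ⟧ * δ* (u ++ v) 1₀ α))
             ≡⟨ cong (reI (length u) *_) (sumW-* l ⟦ run r u ⟧ (λ v → ⟦ alt r true v ⟧ * δ* (u ++ v) 1₀ α)) ⟨
           reI (length u) * sumW l (λ v → ⟦ run r u ⟧ * (⟦ alt r true v ⟧ * δ* (u ++ v) 1₀ α))
             ≡⟨ sumW-* l (reI (length u)) (λ v → ⟦ run r u ⟧ * (⟦ alt r true v ⟧ * δ* (u ++ v) 1₀ α)) ⟨
           sumW l (λ v → reI (length u) * (⟦ run r u ⟧ * (⟦ alt r true v ⟧ * δ* (u ++ v) 1₀ α)))
             ≡⟨ sumW-cong l (λ v _ → assemble (reI (length u)) ⟦ run r u ⟧ ⟦ alt r true v ⟧ (δ* (u ++ v) 1₀ α)) ⟩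
           sumW l (λ v → signedSplit u v * δ* (u ++ v) 1₀ α)
             ∎) ⟩
    sumW a (λ u → sumW l (λ v → signedSplit u v * δ* (u ++ v) 1₀ α))
      ∎
    where
    inner : ∀ u → δ* u (altW r l) α ≡ sumW l (λ v → ⟦ alt r true v ⟧ * δ* (u ++ v) 1₀ α)
    inner u = trans (sumW-linear (δ*-linear u) l (λ v α → ⟦ alt r true v ⟧ * δ* v 1₀ α) α)
      (sumW-cong l (λ v _ → trans (*-homo (δ*-linear u) ⟦ alt r true v ⟧ (δ* v 1₀) α) (cong (⟦ alt r true v ⟧ *_) (sym (δ*-++ u v 1₀ α)))))

run-reverse : ∀ {r r′ : A → A → Bool} → (∀ x y → r y x ≡ r′ x y) → ∀ w → run r (reverse w) ≡ run r′ w
run-reverse             r≡r′ []          = refl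
run-reverse             r≡r′ (x ∷ [])    = refl
run-reverse {r = r} {r′} r≡r′ (x ∷ y ∷ w) = begin
  run r (reverse (x ∷ y ∷ w))            ≡⟨ cong (run r) (trans (Listₚ.unfold-reverse x (y ∷ w)) (cong (_∷ʳ x) (Listₚ.unfold-reverse y w))) ⟩
  run r (reverse w ∷ʳ y ∷ʳ x)            ≡⟨ run-∷ʳ (reverse w) ⟩
  run r (reverse w ∷ʳ y) ∧ r y x         ≡⟨ Boolₚ.∧-comm (run r (reverse w ∷ʳ y)) (r y x) ⟩
  r y x ∧ run r (reverse w ∷ʳ y)         ≡⟨ cong₂ _∧_ (r≡r′ x y) (trans (cong (run r) (sym (Listₚ.unfold-reverse y w))) (run-reverse r≡r′ (y ∷ w))) ⟩
  r′ x y ∧ run r′ (y ∷ w)                ∎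
  where
  run-∷ʳ : ∀ v → run r (v ∷ʳ y ∷ʳ x) ≡ run r (v ∷ʳ y) ∧ r y x
  run-∷ʳ []          = Boolₚ.∧-identityʳ (r y x)
  run-∷ʳ (a ∷ [])    = trans (cong (r a y ∧_) (Boolₚ.∧-identityʳ (r y x))) (cong (_∧ r y x) (sym (Boolₚ.∧-identityʳ (r a y))))
  run-∷ʳ (a ∷ b ∷ v) = trans (cong (r a b ∧_) (run-∷ʳ (b ∷ v))) (sym (Boolₚ.∧-assoc (r a b) (run r (b ∷ v ∷ʳ y)) (r y x)))

-- Reversing words preserves multiplicities and inverts the relation; decreasing runs thereby become
-- increasing ones.
runW-flip : ∀ {k} {r r′ : Fin k → Fin k → Bool} → (∀ x y → r y x ≡ r′ x y) → ∀ n φ α → runW r n φ α ≡ runW r′ n φ α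
runW-flip {r = r} {r′} r≡r′ n φ α = trans (sym (sumW-reverse n (λ w → ⟦ run r w ⟧ * δ* w φ α)))
  (sumW-cong n (λ w _ → cong₂ (λ b x → ⟦ b ⟧ * x) (run-reverse r≡r′ w) (δ*-reverse w φ α)))

gtAB-flip : ∀ {k} (X : Subset k) x y → gtAB X y x ≡ ltAB X x y
gtAB-flip X x y with x Fin.≟ y | y Fin.≟ x
... | yes refl | yes _    = refl
... | yes refl | no y≢x   = ⊥-elim (y≢x refl)
... | no x≢y   | yes refl = ⊥-elim (x≢y refl)
... | no _     | no _     = refl

-- Runs

private
  ltAB-suc : ∀ {k} x (X : Subset k) y z → ltAB (x ∷ X) (suc y) (suc z) ≡ ltAB X y z
  ltAB-suc x X y z with y Fin.≟ z
  ... | yes _ = refl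
  ... | no _  = refl

  -- An increasing run that has passed the least letter zero never returns to it.
  sumW-after-suc : ∀ {k} x (X : Subset k) n (y : Fin k) (f : List (Fin (suc k)) → ℚ) →
    sumW n (λ w → ⟦ run (ltAB (x ∷ X)) (suc y ∷ w) ⟧ * f w) ≡ sumW n (λ w → ⟦ run (ltAB X) (y ∷ w) ⟧ * f (map suc w))
  sumW-after-suc x X zero    y f = refl
  sumW-after-suc {k} x X (suc n) y f = begin
    sumW n (λ w → ⟦ false ⟧ * f (zero ∷ w)) + sumF k (λ z → sumW n (λ w → ⟦ ltAB (x ∷ X) (suc y) (suc z) ∧ run (ltAB (x ∷ X)) (suc z ∷ w) ⟧ * f (suc z ∷ w)))
      ≡⟨ cong₂ _+_ (sumW-zero n (λ w → 0ℚ * f (zero ∷ w)) (λ w → ℚₚ.*-zeroˡ (f (zero ∷ w)))) (sumF-cong k per-letter) ⟩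
    0ℚ + sumF k (λ z → sumW n (λ w → ⟦ ltAB X y z ∧ run (ltAB X) (z ∷ w) ⟧ * f (suc z ∷ map suc w)))
      ≡⟨ ℚₚ.+-identityˡ _ ⟩
    sumF k (λ z → sumW n (λ w → ⟦ ltAB X y z ∧ run (ltAB X) (z ∷ w) ⟧ * f (suc z ∷ map suc w)))
      ∎
    where
    pull : ∀ b c x → ⟦ b ∧ c ⟧ * x ≡ ⟦ b ⟧ * (⟦ c ⟧ * x)
    pull b c x = trans (cong (_* x) (⟦∧⟧ b c)) (ℚₚ.*-assoc ⟦ b ⟧ ⟦ c ⟧ x)
    per-letter : ∀ z → sumW n (λ w → ⟦ ltAB (x ∷ X) (suc y) (suc z) ∧ run (ltAB (x ∷ X)) (suc z ∷ w) ⟧ * f (suc z ∷ w)) ≡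
                       sumW n (λ w → ⟦ ltAB X y z ∧ run (ltAB X) (z ∷ w) ⟧ * f (suc z ∷ map suc w))
    per-letter z = begin
      sumW n (λ w → ⟦ ltAB (x ∷ X) (suc y) (suc z) ∧ run (ltAB (x ∷ X)) (suc z ∷ w) ⟧ * f (suc z ∷ w))
        ≡⟨ cong (λ b → sumW n (λ w → ⟦ b ∧ run (ltAB (x ∷ X)) (suc z ∷ w) ⟧ * f (suc z ∷ w))) (ltAB-suc x X y z) ⟩
      sumW n (λ w → ⟦ b ∧ run (ltAB (x ∷ X)) (suc z ∷ w) ⟧ * f (suc z ∷ w))
        ≡⟨ sumW-cong n (λ w _ → pull b (run (ltAB (x ∷ X)) (suc z ∷ w)) (f (suc z ∷ w))) ⟩
      sumW n (λ w → ⟦ b ⟧ * (⟦ run (ltAB (x ∷ X)) (suc z ∷ w) ⟧ * f (suc z ∷ w)))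
        ≡⟨ sumW-* n ⟦ b ⟧ (λ w → ⟦ run (ltAB (x ∷ X)) (suc z ∷ w) ⟧ * f (suc z ∷ w)) ⟩
      ⟦ b ⟧ * sumW n (λ w → ⟦ run (ltAB (x ∷ X)) (suc z ∷ w) ⟧ * f (suc z ∷ w))
        ≡⟨ cong (⟦ b ⟧ *_) (sumW-after-suc x X n z (f ∘ (suc z ∷_))) ⟩
      ⟦ b ⟧ * sumW n (λ w → ⟦ run (ltAB X) (z ∷ w) ⟧ * f (suc z ∷ map suc w))
        ≡⟨ sumW-* n ⟦ b ⟧ (λ w → ⟦ run (ltAB X) (z ∷ w) ⟧ * f (suc z ∷ map suc w)) ⟨
      sumW n (λ w → ⟦ b ⟧ * (⟦ run (ltAB X) (z ∷ w) ⟧ * f (suc z ∷ map suc w)))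
        ≡⟨ sumW-cong n (λ w _ → pull b (run (ltAB X) (z ∷ w)) (f (suc z ∷ map suc w))) ⟨
      sumW n (λ w → ⟦ b ∧ run (ltAB X) (z ∷ w) ⟧ * f (suc z ∷ map suc w))
        ∎
      where b = ltAB X y z

  runW-suc-letters : ∀ {k} x (X : Subset k) n φ m α →
    sumF k (λ y → sumW n (λ w → ⟦ run (ltAB (x ∷ X)) (suc y ∷ w) ⟧ * δ* (suc y ∷ w) φ (m ∷ α))) ≡ runW (ltAB X) (suc n) (φ ∘ (m ∷_)) α
  runW-suc-letters {k} x X n φ m α = sumF-cong k (λ y → trans
    (sumW-after-suc x X n y (λ w → δ* (suc y ∷ w) φ (m ∷ α)))
    (sumW-cong n (λ w _ → cong (⟦ run (ltAB X) (y ∷ w) ⟧ *_) (δ*-map-suc (y ∷ w) φ m α))))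

  -- What remains of the runs that begin with zero once this letter is removed. If x is true, zero
  -- may be repeated and the same kind of run remains; otherwise zero is used up.
  peeled : ∀ {k} → Bool → Subset k → ℕ → (Vec ℕ (suc k) → ℚ) → Vec ℕ (suc k) → ℚ
  peeled x     X n φ (zero ∷ α)  = 0ℚ
  peeled true  X n φ (suc m ∷ α) = runW (ltAB (true ∷ X)) n φ (m ∷ α)
  peeled false X n φ (suc m ∷ α) = runW (ltAB X) n (φ ∘ (m ∷_)) α

  runW-peel : ∀ {k} x (X : Subset k) n φ m α →
    runW (ltAB (x ∷ X)) (suc n) φ (m ∷ α) ≡ runW (ltAB X) (suc n) (φ ∘ (m ∷_)) α + peeled x X n φ (m ∷ α)
  runW-peel {k} x X n φ m α = trans (cong₂ _+_ (zero-letter x m) (runW-suc-letters x X n φ m α))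
    (ℚₚ.+-comm (peeled x X n φ (m ∷ α)) (runW (ltAB X) (suc n) (φ ∘ (m ∷_)) α))
    where
    zero-letter : ∀ x m → sumW n (λ w → ⟦ run (ltAB (x ∷ X)) (zero ∷ w) ⟧ * δ* (zero ∷ w) φ (m ∷ α)) ≡ peeled x X n φ (m ∷ α)
    zero-letter x     zero    = sumW-zero n (λ w → ⟦ run (ltAB (x ∷ X)) (zero ∷ w) ⟧ * 0ℚ) (λ w → ℚₚ.*-zeroʳ ⟦ run (ltAB (x ∷ X)) (zero ∷ w) ⟧)
    zero-letter true  (suc m) = sumW-cong n (λ w _ → cong (λ b → ⟦ b ⟧ * δ* w φ (m ∷ α)) (run-zero w))
      where
      -- With `true` at its place, zero is related to every letter, itself included.
      run-zero : ∀ w → run (ltAB (true ∷ X)) (zero ∷ w) ≡ run (ltAB (true ∷ X)) w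
      run-zero []          = refl
      run-zero (zero ∷ w)  = refl
      run-zero (suc y ∷ w) = refl
    zero-letter false (suc m) = after-zero n
      where
      after-zero : ∀ n → sumW n (λ w → ⟦ run (ltAB (false ∷ X)) (zero ∷ w) ⟧ * δ* w φ (m ∷ α)) ≡ runW (ltAB X) n (φ ∘ (m ∷_)) α
      after-zero zero    = refl
      after-zero (suc n) = trans (cong₂ _+_ (sumW-zero n (λ w → 0ℚ * δ* (zero ∷ w) φ (m ∷ α)) (λ w → ℚₚ.*-zeroˡ (δ* (zero ∷ w) φ (m ∷ α))))
        (runW-suc-letters false X n φ m α)) (ℚₚ.+-identityˡ (runW (ltAB X) (suc n) (φ ∘ (m ∷_)) α))

-- The recurrence for the umbral values

gops-linear : {T : (I → ℚ) → I → ℚ} → Linear T → ∀ s {k} (X : Subset k) α → Linear (gops T s X α)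
gops-linear T-lin s []      []      = id-linear
gops-linear T-lin s (x ∷ X) (m ∷ α) = ∘-linear (gop-linear T-lin (s x) m) (gops-linear T-lin s X α)

gops-intertwine : {T : (I → ℚ) → I → ℚ} {T′ : (I′ → ℚ) → I′ → ℚ} {φ : (I → ℚ) → I′ → ℚ} →
  Linear T′ → Linear φ → (∀ a → φ (T a) ≗ T′ (φ a)) → ∀ s {k} (X : Subset k) α a → φ (gops T s X α a) ≗ gops T′ s X α (φ a)
gops-intertwine T′-lin φ-lin φT s []      []      a i = refl
gops-intertwine T′-lin φ-lin φT s (x ∷ X) (m ∷ α) a i = trans (gop-intertwine T′-lin φ-lin φT (s x) m _ i)
  (cong-≗ (gop-linear T′-lin (s x) m) (gops-intertwine T′-lin φ-lin φT s X α a) i)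

-- The sum of J^a R_a over a ≤ N. In Horner form, removing one letter from a run costs exactly one
-- application of `Jᶜ`.
horner : ℕ → (ℕ → ℂSeries) → ℂSeries
horner zero    R   = R 0
horner (suc N) R i = R 0 i + Jᶜ (horner N (R ∘ suc)) i

horner-cong : ∀ N {R R′ : ℕ → ℂSeries} → (∀ a → R a ≗ R′ a) → horner N R ≗ horner N R′
horner-cong zero    R≗R′ i = R≗R′ 0 i
horner-cong (suc N) R≗R′ i = cong₂ _+_ (R≗R′ 0 i) (cong-≗ Jᶜ-linear (horner-cong N (R≗R′ ∘ suc)) i)

horner-+ : ∀ N (R R′ : ℕ → ℂSeries) i → horner N (λ a i → R a i + R′ a i) i ≡ horner N R i + horner N R′ i
horner-+ zero    R R′ i = refl
horner-+ (suc N) R R′ i = begin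
  R 0 i + R′ 0 i + Jᶜ (horner N (λ a i → R (suc a) i + R′ (suc a) i)) i
    ≡⟨ cong (R 0 i + R′ 0 i +_) (trans (cong-≗ Jᶜ-linear (horner-+ N (R ∘ suc) (R′ ∘ suc)) i) (+-homo Jᶜ-linear (horner N (R ∘ suc)) (horner N (R′ ∘ suc)) i)) ⟩
  R 0 i + R′ 0 i + (Jᶜ (horner N (R ∘ suc)) i + Jᶜ (horner N (R′ ∘ suc)) i)
    ≡⟨ +-interchange (R 0 i) (R′ 0 i) (Jᶜ (horner N (R ∘ suc)) i) (Jᶜ (horner N (R′ ∘ suc)) i) ⟩
  horner (suc N) R i + horner (suc N) R′ i
    ∎

horner-zero : ∀ N i → horner N (λ _ _ → 0ℚ) i ≡ 0ℚ
horner-zero zero    i = refl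
horner-zero (suc N) i = trans (cong (0ℚ +_) (trans (cong-≗ Jᶜ-linear (horner-zero N) i) (linear-zero Jᶜ-linear i))) (ℚₚ.+-identityˡ 0ℚ)

horner-natural : {L : ℂSeries → ℂSeries} → Linear L → (∀ z → L (Jᶜ z) ≗ Jᶜ (L z)) → ∀ N R → L (horner N R) ≗ horner N (L ∘ R)
horner-natural         L-lin LJ zero    R i = refl
horner-natural {L = L} L-lin LJ (suc N) R i = trans (+-homo L-lin (R 0) (Jᶜ (horner N (R ∘ suc))) i)
  (cong (L (R 0) i +_) (trans (LJ (horner N (R ∘ suc)) i) (cong-≗ Jᶜ-linear (horner-natural L-lin LJ N (R ∘ suc)) i)))

-- `Jᶜ` is multiplication by i, and i^a has the parts `reI a` and `imI a`.
horner-real : ∀ N (r : ℕ → Series) n →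
  horner N (real ∘ r) (false , n) ≡ antidiag (λ a _ → reI a * r a n) N × horner N (real ∘ r) (true , n) ≡ antidiag (λ a _ → imI a * r a n) N
horner-real zero    r n = sym (ℚₚ.*-identityˡ (r 0 n)) , sym (ℚₚ.*-zeroˡ (r 0 n))
horner-real (suc N) r n with horner-real N (r ∘ suc) n
... | re≡ , im≡ =
  (begin
    r 0 n - horner N (real ∘ r ∘ suc) (true , n)
      ≡⟨ cong₂ _-_ (sym (ℚₚ.*-identityˡ (r 0 n))) im≡ ⟩
    1ℚ * r 0 n - antidiag (λ a _ → imI a * r (suc a) n) N
      ≡⟨ cong (1ℚ * r 0 n +_) (antidiag-neg (λ a _ → imI a * r (suc a) n) N) ⟨
    1ℚ * r 0 n + antidiag (λ a _ → - (imI a * r (suc a) n)) N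
      ≡⟨ cong (1ℚ * r 0 n +_) (antidiag-cong N (λ a _ _ → ℚₚ.neg-distribˡ-* (imI a) (r (suc a) n))) ⟩
    1ℚ * r 0 n + antidiag (λ a _ → - imI a * r (suc a) n) N
      ∎) ,
  cong₂ _+_ (sym (ℚₚ.*-zeroˡ (r 0 n))) re≡

-- The exponent ŝ belongs to D + J and s to D: `gop-unshift` relates them at the letters in X,
-- `gop-shift` at the others. The instances are ŝ = 0, where s = ± 1, and ŝ = ∓ 1, where s = 0.
module Runs (ŝ : Bool → ℚ) where

  s : Bool → ℚ
  s true  = ŝ true + 1ℚ
  s false = ŝ false - 1ℚ

  private
    runs : ∀ {k} → Subset k → (Vec ℕ k → ℂSeries) → Vec ℕ k → ℕ → ℂSeries
    runs X φ α a i = runW (ltAB X) a (λ β → φ β i) α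

  -- Summed over the runs with multiplicities α and weighted by Jᶜ to the power of their length, the factors
  -- 1 + x J and 1 / (1 - x J) of the letters outside and inside X turn Dᶜ into Dᶜ + Jᶜ.
  runs-shift : ∀ {k} (X : Subset k) α N z → sum α ℕ.≤ N → horner N (runs X (λ β → gops Dᶜ s X β z) α) ≗ gops Dᶜ⁺ ŝ X α z
  runs-shift []      []      zero    z _ i = ℚₚ.*-identityˡ (z i)
  runs-shift []      []      (suc N) z _ i = begin
    1ℚ * z i + Jᶜ (horner N (λ _ _ → 0ℚ)) i   ≡⟨ cong₂ _+_ (ℚₚ.*-identityˡ (z i)) (trans (cong-≗ Jᶜ-linear (horner-zero N) i) (linear-zero Jᶜ-linear i)) ⟩
    z i + 0ℚ                                  ≡⟨ ℚₚ.+-identityʳ (z i) ⟩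
    z i                                       ∎
  runs-shift {suc k} (x ∷ X) (m ∷ α) N z = by-multiplicity x m N
    where
    Ĝ = gops Dᶜ⁺ ŝ X α z

    φ : Bool → Vec ℕ (suc k) → ℂSeries
    φ x β = gops Dᶜ s (x ∷ X) β z

    -- Runs that avoid zero do not touch the first variable, so its operator comes out of the sum
    -- and the claim for X remains.
    without-zero : ∀ x m N → sum α ℕ.≤ N → horner N (runs X (φ x ∘ (m ∷_)) α) ≗ gop Dᶜ (s x) m Ĝ
    without-zero x m N α≤N i = begin
      horner N (runs X (φ x ∘ (m ∷_)) α) i
        ≡⟨ horner-cong N (λ a i → sym (runW-natural L-lin (ltAB X) a (λ β → gops Dᶜ s X β z) α i)) i ⟩
      horner N (gop Dᶜ (s x) m ∘ runs X (λ β → gops Dᶜ s X β z) α) i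
        ≡⟨ horner-natural L-lin (λ y i → sym (gop-intertwine Dᶜ-linear Jᶜ-linear JᶜDᶜ (s x) m y i)) N (runs X (λ β → gops Dᶜ s X β z) α) i ⟨
      gop Dᶜ (s x) m (horner N (runs X (λ β → gops Dᶜ s X β z) α)) i
        ≡⟨ cong-≗ L-lin (runs-shift X α N z α≤N) i ⟩
      gop Dᶜ (s x) m Ĝ i
        ∎
      where L-lin = gop-linear Dᶜ-linear (s x) m

    peel : ∀ x m N i → horner (suc N) (runs (x ∷ X) (φ x) (m ∷ α)) i ≡
      horner (suc N) (runs X (φ x ∘ (m ∷_)) α) i + Jᶜ (horner N (λ a i → peeled x X a (λ β → φ x β i) (m ∷ α))) i
    peel x m N i = begin
      r₀ + Jᶜ (horner N (λ a → runs (x ∷ X) (φ x) (m ∷ α) (suc a))) i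
        ≡⟨ cong (r₀ +_) (cong-≗ Jᶜ-linear (λ i → trans (horner-cong N (λ a i → runW-peel x X a (λ β → φ x β i) m α) i) (horner-+ N _ _ i)) i) ⟩
      r₀ + Jᶜ (λ i → horner N (λ a → runs X (φ x ∘ (m ∷_)) α (suc a)) i + horner N (λ a i → peeled x X a (λ β → φ x β i) (m ∷ α)) i) i
        ≡⟨ cong (r₀ +_) (+-homo Jᶜ-linear _ _ i) ⟩
      r₀ + (Jᶜ (horner N (λ a → runs X (φ x ∘ (m ∷_)) α (suc a))) i + Jᶜ (horner N (λ a i → peeled x X a (λ β → φ x β i) (m ∷ α))) i)
        ≡⟨ ℚₚ.+-assoc r₀ _ _ ⟨
      horner (suc N) (runs X (φ x ∘ (m ∷_)) α) i + Jᶜ (horner N (λ a i → peeled x X a (λ β → φ x β i) (m ∷ α))) i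
        ∎
      where r₀ = 1ℚ * φ x (m ∷ α) i

    -- N is only bounded below by the number of letters: it drops by 1 with each letter removed from
    -- a run, and for X alone it exceeds the remaining multiplicities.
    by-multiplicity : ∀ x m N → m ℕ.+ sum α ℕ.≤ N → horner N (runs (x ∷ X) (φ x) (m ∷ α)) ≗ gop Dᶜ⁺ (ŝ x) m Ĝ
    by-multiplicity x zero zero    α≤N i = without-zero x 0 0 α≤N i
    by-multiplicity x zero (suc N) α≤N i = begin
      horner (suc N) (runs (x ∷ X) (φ x) (0 ∷ α)) i
        ≡⟨ peel x 0 N i ⟩
      horner (suc N) (runs X (φ x ∘ (0 ∷_)) α) i + Jᶜ (horner N (λ _ _ → 0ℚ)) i
        ≡⟨ cong₂ _+_ (without-zero x 0 (suc N) α≤N i) (trans (cong-≗ Jᶜ-linear (horner-zero N) i) (linear-zero Jᶜ-linear i)) ⟩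
      Ĝ i + 0ℚ
        ≡⟨ ℚₚ.+-identityʳ (Ĝ i) ⟩
      Ĝ i
        ∎
    -- The peeled runs are of the same kind with m lowered by 1, as in the recursion of
    -- `gop-unshift`.
    by-multiplicity true (suc m) (suc N) (s≤s m+α≤N) i = begin
      horner (suc N) (runs (true ∷ X) (φ true) (suc m ∷ α)) i
        ≡⟨ peel true (suc m) N i ⟩
      horner (suc N) (runs X (φ true ∘ (suc m ∷_)) α) i + Jᶜ (horner N (runs (true ∷ X) (φ true) (m ∷ α))) i
        ≡⟨ cong₂ _+_ (without-zero true (suc m) (suc N) (ℕₚ.m≤n⇒m≤1+n (ℕₚ.≤-trans (ℕₚ.m≤n+m (sum α) m) m+α≤N)) i)
                     (cong-≗ Jᶜ-linear (by-multiplicity true m N m+α≤N) i) ⟩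
      gop Dᶜ (ŝ true + 1ℚ) (suc m) Ĝ i + Jᶜ (gop Dᶜ⁺ (ŝ true) m Ĝ) i
        ≡⟨ gop-unshift (ŝ true) m Ĝ i ⟨
      gop Dᶜ⁺ (ŝ true) (suc m) Ĝ i
        ∎
    -- A peeled run has no further zero, so `without-zero` covers both terms; they are the two terms
    -- of `gop-shift`.
    by-multiplicity false (suc m) (suc N) (s≤s m+α≤N) i = begin
      horner (suc N) (runs (false ∷ X) (φ false) (suc m ∷ α)) i
        ≡⟨ peel false (suc m) N i ⟩
      horner (suc N) (runs X (φ false ∘ (suc m ∷_)) α) i + Jᶜ (horner N (runs X (φ false ∘ (m ∷_)) α)) i
        ≡⟨ cong₂ _+_ (without-zero false (suc m) (suc N) (ℕₚ.m≤n⇒m≤1+n α≤N) i) (cong-≗ Jᶜ-linear (without-zero false m N α≤N) i) ⟩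
      gop Dᶜ (ŝ false - 1ℚ) (suc m) Ĝ i + Jᶜ (gop Dᶜ (ŝ false - 1ℚ) m Ĝ) i
        ≡⟨ gop-shift (ŝ false) m Ĝ i ⟨
      gop Dᶜ⁺ (ŝ false) (suc m) Ĝ i
        ∎
      where α≤N = ℕₚ.≤-trans (ℕₚ.m≤n+m (sum α) m) m+α≤N

  runs-real : ∀ {k} (X : Subset k) α a →
    horner (sum α) (λ n → real (λ j → runW (ltAB X) n (λ β → gops D s X β a j) α)) ≗ gops Dᶜ⁺ ŝ X α (real a)
  runs-real X α a i = trans (horner-cong (sum α) (λ n i → trans (runW-natural real-linear (ltAB X) n (λ β → gops D s X β a) α i)
      (sumW-cong n (λ w _ → cong (⟦ run (ltAB X) w ⟧ *_) (cong-≗ (δ*-linear w) (λ β → gops-intertwine Dᶜ-linear real-linear real-D s X β a i) α)))) i)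
    (runs-shift X α (sum α) (real a) ℕₚ.≤-refl i)

  -- Multiplication by e^(ix) is invisible at 0, but it replaces D + J by D and the series a by
  -- e^(ix) a, with real part a cos x.
  runs-re : ∀ {k} (X : Subset k) α a →
    antidiag (λ n _ → reI n * runW (ltAB X) n (λ β → gops D s X β a 0) α) (sum α) ≡ gops D ŝ X α (conv a cosC) 0
  runs-re X α a = begin
    antidiag (λ n _ → reI n * runW (ltAB X) n (λ β → gops D s X β a 0) α) (sum α)
      ≡⟨ proj₁ (horner-real (sum α) (λ n j → runW (ltAB X) n (λ β → gops D s X β a j) α) 0) ⟨
    horner (sum α) (λ n → real (λ j → runW (ltAB X) n (λ β → gops D s X β a j) α)) (false , 0)
      ≡⟨ runs-real X α a (false , 0) ⟩
    gops Dᶜ⁺ ŝ X α (real a) (false , 0)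
      ≡⟨ Re-exp-at-0 (gops Dᶜ⁺ ŝ X α (real a)) ⟨
    Re-exp (gops Dᶜ⁺ ŝ X α (real a)) 0
      ≡⟨ gops-intertwine D-linear Re-exp-linear Re-exp-D ŝ X α (real a) 0 ⟩
    gops D ŝ X α (Re-exp (real a)) 0
      ≡⟨ cong-≗ (gops-linear D-linear ŝ X α) (Re-exp-real a) 0 ⟩
    gops D ŝ X α (conv a cosC) 0
      ∎

  -- The imaginary part of the same identity; applied to the series 1 it accounts for the sin term
  -- when n is odd.
  runs-im : ∀ {k} (X : Subset k) α a →
    antidiag (λ n _ → imI n * runW (ltAB X) n (λ β → gops D s X β a 0) α) (sum α) ≡ gops D ŝ X α (conv a sinC) 0
  runs-im X α a = begin
    antidiag (λ n _ → imI n * runW (ltAB X) n (λ β → gops D s X β a 0) α) (sum α)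
      ≡⟨ proj₂ (horner-real (sum α) (λ n j → runW (ltAB X) n (λ β → gops D s X β a j) α) 0) ⟨
    horner (sum α) (λ n → real (λ j → runW (ltAB X) n (λ β → gops D s X β a j) α)) (true , 0)
      ≡⟨ runs-real X α a (true , 0) ⟩
    gops Dᶜ⁺ ŝ X α (real a) (true , 0)
      ≡⟨ Im-exp-at-0 (gops Dᶜ⁺ ŝ X α (real a)) ⟨
    Im-exp (gops Dᶜ⁺ ŝ X α (real a)) 0
      ≡⟨ gops-intertwine D-linear Im-exp-linear Im-exp-D ŝ X α (real a) 0 ⟩
    gops D ŝ X α (Im-exp (real a)) 0
      ≡⟨ cong-≗ (gops-linear D-linear ŝ X α) (Im-exp-real a) 0 ⟩
    gops D ŝ X α (conv a sinC) 0
      ∎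

  -- The instance a = sec + tan, for which a cos x = 1 + sin x. The two summands are kept apart
  -- since parity removes one of them.
  umbral-recurrence : ∀ {k} (X : Subset k) α →
    antidiag (λ n _ → reI n * runW (ltAB X) n (λ β → gops D s X β secTanC 0) α) (sum α) ≡ gops D ŝ X α one 0 + gops D ŝ X α sinC 0
  umbral-recurrence X α = trans (runs-re X α secTanC) (trans
    (cong-≗ (gops-linear D-linear ŝ X α) (λ n → trans (secTan-cos n) (onePlusSin≗ n)) 0)
    (+-homo (gops-linear D-linear ŝ X α) one sinC 0))

-- Parity

flipSign : Series → Series
flipSign a n = sgn n * a n

flipSign-linear : Linear flipSign
flipSign-linear = record
  { cong-≗ = λ f≗g n → cong (sgn n *_) (f≗g n)
  ; +-homo = λ f g n → ℚₚ.*-distribˡ-+ (sgn n) (f n) (g n)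
  ; *-homo = λ c f n → *-left-comm (sgn n) c (f n)
  }

flipSign-D : ∀ a n → flipSign (D a) n ≡ - D (flipSign a) n
flipSign-D a n = lemma (sgn n) (ℕtoℚ (suc n)) (a (suc n))
  where
  lemma : ∀ s c x → s * (c * x) ≡ - (c * (- s * x))
  lemma = solve-∀ ℚ-ring

-- `gop T s m` is a polynomial in T of the same parity as m, and x ↦ - x turns D into - D.
flipSign-gop : ∀ s m a n → flipSign (gop D s m a) n ≡ sgn m * gop D s m (flipSign a) n
flipSign-gop s m a n = trans (gop-intertwine (neg-linear D-linear) flipSign-linear flipSign-D s m a n) (gop-neg m (flipSign a) n)
  where
  -D : Series → Series
  -D a n = - D a n
  gop-neg : ∀ m a n → gop -D s m a n ≡ sgn m * gop D s m a n
  gop-neg zero          a n = sym (ℚₚ.*-identityˡ (a n))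
  gop-neg (suc zero)    a n = lemma (D a n)
    where
    lemma : ∀ x → - x ≡ - 1ℚ * x
    lemma = solve-∀ ℚ-ring
  gop-neg (suc (suc m)) a n = begin
    v * (- D (gop -D s (suc m) a) n + d * gop -D s m a n)
      ≡⟨ cong₂ (λ x y → v * (- x + d * y)) (trans (cong-≗ D-linear (gop-neg (suc m) a) n) (*-homo D-linear (- sgn m) (gop D s (suc m) a) n)) (gop-neg m a n) ⟩
    v * (- (- sgn m * D (gop D s (suc m) a) n) + d * (sgn m * gop D s m a n))
      ≡⟨ lemma v (sgn m) (D (gop D s (suc m) a) n) d (gop D s m a n) ⟩
    - - sgn m * (v * (D (gop D s (suc m) a) n + d * gop D s m a n))
      ∎
    where
    v = invℕ (2 ℕ.+ m)
    d = s - ℕtoℚ m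
    lemma : ∀ v e x d y → v * (- (- e * x) + d * (e * y)) ≡ - - e * (v * (x + d * y))
    lemma = solve-∀ ℚ-ring

flipSign-gops : ∀ s {k} (X : Subset k) α a n → flipSign (gops D s X α a) n ≡ sgn (sum α) * gops D s X α (flipSign a) n
flipSign-gops s []      []      a n = sym (ℚₚ.*-identityˡ (flipSign a n))
flipSign-gops s (x ∷ X) (m ∷ α) a n = begin
  flipSign (gop D (s x) m g) n                                    ≡⟨ flipSign-gop (s x) m g n ⟩
  sgn m * gop D (s x) m (flipSign g) n                            ≡⟨ cong (sgn m *_) (cong-≗ lin (flipSign-gops s X α a) n) ⟩
  sgn m * gop D (s x) m (λ n → sgn (sum α) * gᵢ n) n       ≡⟨ cong (sgn m *_) (*-homo lin (sgn (sum α)) gᵢ n) ⟩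
  sgn m * (sgn (sum α) * gop D (s x) m gᵢ n)               ≡⟨ ℚₚ.*-assoc (sgn m) (sgn (sum α)) (gop D (s x) m gᵢ n) ⟨
  sgn m * sgn (sum α) * gop D (s x) m gᵢ n                 ≡⟨ cong (_* gop D (s x) m gᵢ n) (sgn-+ m (sum α)) ⟨
  sgn (m ℕ.+ sum α) * gop D (s x) m gᵢ n                   ∎
  where
  g   = gops D s X α a
  gᵢ  = gops D s X α (flipSign a)
  lin = gop-linear D-linear (s x) m

x≡-x⇒x≡0 : ∀ x → x ≡ - x → x ≡ 0ℚ
x≡-x⇒x≡0 x x≡-x = begin
  x                          ≡⟨ halve x ⟩
  invℕ 2 * (x + x)           ≡⟨ cong (λ y → invℕ 2 * (x + y)) x≡-x ⟩
  invℕ 2 * (x + - x)         ≡⟨ cong (invℕ 2 *_) (ℚₚ.+-inverseʳ x) ⟩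
  invℕ 2 * 0ℚ                ≡⟨ ℚₚ.*-zeroʳ (invℕ 2) ⟩
  0ℚ                         ∎
  where
  double : ∀ v x → v * (x + x) ≡ (1ℚ + 1ℚ) * v * x
  double = solve-∀ ℚ-ring
  halve : ∀ x → x ≡ invℕ 2 * (x + x)
  halve x = sym (trans (double (invℕ 2) x) (ℚₚ.*-identityˡ x))

sgn-even : ∀ n → n % 2 ≡ 0 → sgn n ≡ 1ℚ
sgn-even zero          _ = refl
sgn-even (suc (suc n)) e = cong (λ x → - - x) (sgn-even n (trans (sym (2+n%2 n)) e))

sgn-odd : ∀ n → n % 2 ≡ 1 → sgn n ≡ - 1ℚ
sgn-odd (suc zero)    _ = refl
sgn-odd (suc (suc n)) e = cong (λ x → - - x) (sgn-odd n (trans (sym (2+n%2 n)) e))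

imI-even : ∀ n → n % 2 ≡ 0 → imI n ≡ 0ℚ
imI-even zero          _ = refl
imI-even (suc (suc n)) e = cong -_ (imI-even n (trans (sym (2+n%2 n)) e))

flipSign-one : flipSign one ≗ one
flipSign-one zero    = refl
flipSign-one (suc n) = ℚₚ.*-zeroʳ (sgn (suc n))

flipSign-sin : ∀ n → flipSign sinC n ≡ - sinC n
flipSign-sin n = begin
  sgn n * sinC n                        ≡⟨ cong (sgn n *_) (imI-parity n (invℕ (n !))) ⟩
  sgn n * (imI n * invℕ (n !))          ≡⟨ ℚₚ.*-assoc (sgn n) (imI n) (invℕ (n !)) ⟨
  sgn n * imI n * invℕ (n !)            ≡⟨ cong (_* invℕ (n !)) (imI-sign n) ⟩
  - imI n * invℕ (n !)                  ≡⟨ ℚₚ.neg-distribˡ-* (imI n) (invℕ (n !)) ⟨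
  - (imI n * invℕ (n !))                ≡⟨ cong -_ (imI-parity n (invℕ (n !))) ⟨
  - sinC n                              ∎
  where
  lemma : ∀ s x → - - s * - x ≡ - (s * x)
  lemma = solve-∀ ℚ-ring
  imI-sign : ∀ n → sgn n * imI n ≡ - imI n
  imI-sign zero          = refl
  imI-sign (suc zero)    = refl
  imI-sign (suc (suc n)) = trans (lemma (sgn n) (imI n)) (cong -_ (imI-sign n))

-- An operator of odd degree makes the even series 1 odd, and an odd series vanishes at 0.
gops-one-odd : ∀ s {k} (X : Subset k) α → sum α % 2 ≡ 1 → gops D s X α one 0 ≡ 0ℚ
gops-one-odd s X α odd = x≡-x⇒x≡0 (gops D s X α one 0) (begin
  gops D s X α one 0                          ≡⟨ ℚₚ.*-identityˡ (gops D s X α one 0) ⟨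
  flipSign (gops D s X α one) 0                      ≡⟨ flipSign-gops s X α one 0 ⟩
  sgn (sum α) * gops D s X α (flipSign one) 0        ≡⟨ cong₂ _*_ (sgn-odd (sum α) odd) (cong-≗ (gops-linear D-linear s X α) flipSign-one 0) ⟩
  - 1ℚ * gops D s X α one 0                   ≡⟨ lemma (gops D s X α one 0) ⟩
  - gops D s X α one 0                        ∎)
  where
  lemma : ∀ x → - 1ℚ * x ≡ - x
  lemma = solve-∀ ℚ-ring

gops-sin-even : ∀ s {k} (X : Subset k) α → sum α % 2 ≡ 0 → gops D s X α sinC 0 ≡ 0ℚ
gops-sin-even s X α even = x≡-x⇒x≡0 (gops D s X α sinC 0) (begin
  gops D s X α sinC 0                              ≡⟨ ℚₚ.*-identityˡ (gops D s X α sinC 0) ⟨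
  flipSign (gops D s X α sinC) 0                          ≡⟨ flipSign-gops s X α sinC 0 ⟩
  sgn (sum α) * gops D s X α (flipSign sinC) 0            ≡⟨ cong₂ _*_ (sgn-even (sum α) even) (cong-≗ (gops-linear D-linear s X α) flipSign-sin 0) ⟩
  1ℚ * gops D s X α (λ n → - sinC n) 0             ≡⟨ ℚₚ.*-identityˡ (gops D s X α (λ n → - sinC n) 0) ⟩
  gops D s X α (λ n → - sinC n) 0                  ≡⟨ linear-neg (gops-linear D-linear s X α) sinC 0 ⟩
  - gops D s X α sinC 0                            ∎)

-- exp (D arctan x) fixes constants because D kills them. Index 2 is separate: its recursion
-- contains the series 1 itself, with coefficient s - 0 = 0.
gop₀-one : ∀ m → gop D 0ℚ (suc m) one ≗ λ _ → 0ℚ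
gop₀-one zero          n = ℚₚ.*-zeroʳ (ℕtoℚ (suc n))
gop₀-one (suc zero)    n = begin
  invℕ 2 * (D (D one) n + (0ℚ - 0ℚ) * one n)    ≡⟨ cong (λ x → invℕ 2 * (x + (0ℚ - 0ℚ) * one n)) (trans (cong-≗ D-linear (gop₀-one zero) n) (linear-zero D-linear n)) ⟩
  invℕ 2 * (0ℚ + (0ℚ - 0ℚ) * one n)             ≡⟨ lemma (invℕ 2) (one n) ⟩
  0ℚ                                            ∎
  where
  lemma : ∀ v x → v * (0ℚ + (0ℚ - 0ℚ) * x) ≡ 0ℚ
  lemma = solve-∀ ℚ-ring
gop₀-one (suc (suc m)) n = begin
  v * (D (gop D 0ℚ (2 ℕ.+ m) one) n + d * gop D 0ℚ (suc m) one n)   ≡⟨ cong₂ (λ x y → v * (x + d * y)) (trans (cong-≗ D-linear (gop₀-one (suc m)) n) (linear-zero D-linear n)) (gop₀-one m n) ⟩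
  v * (0ℚ + d * 0ℚ)                                                 ≡⟨ lemma v d ⟩
  0ℚ                                                                ∎
  where
  v = invℕ (3 ℕ.+ m)
  d = 0ℚ - ℕtoℚ (suc m)
  lemma : ∀ v d → v * (0ℚ + d * 0ℚ) ≡ 0ℚ
  lemma = solve-∀ ℚ-ring

gops₀-one : ∀ s → (∀ b → s b ≡ 0ℚ) → ∀ {k} (X : Subset k) α n → gops D s X α one n ≡ 1₀ α * one n
gops₀-one s s≡0 []      []          n = sym (ℚₚ.*-identityˡ (one n))
gops₀-one s s≡0 (x ∷ X) (zero ∷ α)  n = gops₀-one s s≡0 X α n
gops₀-one s s≡0 (x ∷ X) (suc m ∷ α) n = begin
  gop D (s x) (suc m) (gops D s X α one) n     ≡⟨ cong-≗ (gop-linear D-linear (s x) (suc m)) (gops₀-one s s≡0 X α) n ⟩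
  gop D (s x) (suc m) (λ n → 1₀ α * one n) n   ≡⟨ *-homo (gop-linear D-linear (s x) (suc m)) (1₀ α) one n ⟩
  1₀ α * gop D (s x) (suc m) one n             ≡⟨ cong (λ c → 1₀ α * gop D c (suc m) one n) (s≡0 x) ⟩
  1₀ α * gop D 0ℚ (suc m) one n                ≡⟨ cong (1₀ α *_) (gop₀-one m n) ⟩
  1₀ α * 0ℚ                                    ≡⟨ ℚₚ.*-zeroʳ (1₀ α) ⟩
  0ℚ                                           ≡⟨ ℚₚ.*-zeroˡ (one n) ⟨
  0ℚ * one n                                   ∎

-- Terms of the recurrence with odd run length vanish, and an even run length keeps the parity of
-- the rest. So the recurrence never leaves a parity class, and each class can have its own
-- solution.
reI-parity-split : ∀ m → reI m ≡ 0ℚ ⊎ (∀ l → (m ℕ.+ l) % 2 ≡ l % 2)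
reI-parity-split zero          = inj₂ (λ _ → refl)
reI-parity-split (suc zero)    = inj₁ refl
reI-parity-split (suc (suc m)) with reI-parity-split m
... | inj₁ eq = inj₁ (cong -_ eq)
... | inj₂ eq = inj₂ (λ l → trans (2+n%2 (m ℕ.+ l)) (eq l))

-- The recurrence determines its solution: the term with a = 0 is the unknown, all others are smaller.
altW-unique : ∀ {k} (r : Fin k → Fin k → Bool) (U : Vec ℕ k → ℚ) q →
  (∀ α → sum α % 2 ≡ q → antidiag (λ a _ → reI a * runW r a U α) (sum α) ≡ one (sum α) * 1₀ α + imI (sum α) * runW r (sum α) 1₀ α) →
  ∀ n α → sum α ≡ n → n % 2 ≡ q → altW r n α ≡ U α
altW-unique {k} r U q U-rec n = go n (<-wellFounded n)
  where
  cancel : ∀ {x y} → 1ℚ * (1ℚ * x) ≡ 1ℚ * (1ℚ * y) → x ≡ y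
  cancel {x} {y} eq = trans (unit x) (trans eq (sym (unit y)))
    where
    unit : ∀ x → x ≡ 1ℚ * (1ℚ * x)
    unit = solve-∀ ℚ-ring
  +-cancelʳ : ∀ {x y} z → x + z ≡ y + z → x ≡ y
  +-cancelʳ {x} {y} z eq = trans (undo x z) (trans (cong (_- z) eq) (sym (undo y z)))
    where
    undo : ∀ x z → x ≡ x + z - z
    undo = solve-∀ ℚ-ring
  go : ∀ n → Acc _<_ n → ∀ α → sum α ≡ n → n % 2 ≡ q → altW r n α ≡ U α
  go n (acc rs) α refl parity = cancel (head n (trans (altW-recurrence r n α) (sym (U-rec α parity))) tails)
    where
    tails : ∀ a l → suc a ℕ.+ l ≡ n → reI (suc a) * runW r (suc a) (altW r l) α ≡ reI (suc a) * runW r (suc a) U α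
    tails a l a+l≡n with reI-parity-split (suc a)
    ... | inj₁ reI≡0 = trans (cong (_* runW r (suc a) (altW r l) α) reI≡0) (trans (ℚₚ.*-zeroˡ (runW r (suc a) (altW r l) α))
                         (sym (trans (cong (_* runW r (suc a) U α) reI≡0) (ℚₚ.*-zeroˡ (runW r (suc a) U α)))))
    ... | inj₂ even  = cong (reI (suc a) *_) (runW-cong r (suc a) α (λ β eq →
                         go l (rs (subst (l <_) a+l≡n (s≤s (ℕₚ.m≤n+m l a)))) β
                            (ℕₚ.+-cancelˡ-≡ (suc a) (sum β) l (trans eq (sym a+l≡n)))
                            (trans (sym (even l)) (trans (cong (_% 2) a+l≡n) parity))))
    head : ∀ n {g g′ : ℕ → ℕ → ℚ} → antidiag g n ≡ antidiag g′ n → (∀ a l → suc a ℕ.+ l ≡ n → g (suc a) l ≡ g′ (suc a) l) → g 0 n ≡ g′ 0 n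
    head zero    eq tails = eq
    head (suc n) {g} {g′} eq tails = +-cancelʳ (antidiag (g ∘ suc) n) (trans eq
      (cong (g′ 0 (suc n) +_) (antidiag-cong n (λ a l a+l≡n → sym (tails a l (cong suc a+l≡n))))))

module _ {k} (r : Fin k → Fin k → Bool) (X : Subset k) (run≡ : ∀ n φ α → runW r n φ α ≡ runW (ltAB X) n φ α) where

  private
    transfer : ∀ (U : Vec ℕ k → ℚ) α → antidiag (λ a _ → reI a * runW r a U α) (sum α) ≡ antidiag (λ a _ → reI a * runW (ltAB X) a U α) (sum α)
    transfer U α = antidiag-cong (sum α) (λ a _ _ → cong (reI a *_) (run≡ a U α))

  -- The instance ŝ = 0, so s = ± 1. At exponent 0 the series 1 is fixed, which leaves the indicator
  -- of α = 0; the sin term and `imI (sum α)` both vanish for even sums.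
  altW-even : ∀ n α → sum α ≡ n → n % 2 ≡ 0 → altW r n α ≡ gops D (λ b → if b then 1ℚ else - 1ℚ) X α secTanC 0
  altW-even n α α≡n even = trans (altW-unique r (λ β → gops D s X β secTanC 0) 0 recurrence n α α≡n even) (gops-s X α secTanC 0)
    where
    open Runs (λ _ → 0ℚ)
    s≡ : ∀ b → s b ≡ (if b then 1ℚ else - 1ℚ)
    s≡ true  = refl
    s≡ false = refl
    gops-s : ∀ {k} (X : Subset k) α a → gops D s X α a ≗ gops D (λ b → if b then 1ℚ else - 1ℚ) X α a
    gops-s []      []      a n = refl
    gops-s (x ∷ X) (m ∷ α) a n = trans (cong (λ c → gop D c m (gops D s X α a) n) (s≡ x)) (cong-≗ (gop-linear D-linear _ m) (gops-s X α a) n)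
    support : ∀ {k} (α : Vec ℕ k) → 1₀ α * 1ℚ ≡ one (sum α) * 1₀ α
    support α with sum α in eq
    ... | zero  = ℚₚ.*-comm (1₀ α) 1ℚ
    ... | suc n = trans (cong (_* 1ℚ) (1₀-positive α (subst (0 <_) (sym eq) (s≤s z≤n)))) (sym (ℚₚ.*-zeroˡ (1₀ α)))
    recurrence : ∀ α → sum α % 2 ≡ 0 → antidiag (λ a _ → reI a * runW r a (λ β → gops D s X β secTanC 0) α) (sum α) ≡
      one (sum α) * 1₀ α + imI (sum α) * runW r (sum α) 1₀ α
    recurrence α even = begin
      antidiag (λ a _ → reI a * runW r a (λ β → gops D s X β secTanC 0) α) (sum α)
        ≡⟨ trans (transfer (λ β → gops D s X β secTanC 0) α) (umbral-recurrence X α) ⟩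
      gops D (λ _ → 0ℚ) X α one 0 + gops D (λ _ → 0ℚ) X α sinC 0
        ≡⟨ cong₂ _+_ (trans (gops₀-one (λ _ → 0ℚ) (λ _ → refl) X α 0) (support α)) (gops-sin-even (λ _ → 0ℚ) X α even) ⟩
      one (sum α) * 1₀ α + 0ℚ
        ≡⟨ cong (one (sum α) * 1₀ α +_) (trans (cong (_* runW r (sum α) 1₀ α) (imI-even (sum α) even)) (ℚₚ.*-zeroˡ (runW r (sum α) 1₀ α))) ⟨
      one (sum α) * 1₀ α + imI (sum α) * runW r (sum α) 1₀ α
        ∎

  -- The instance ŝ = ∓ 1, so s = 0. The term of the series 1 vanishes by parity, and the sin term,
  -- with sin written as 1 times sin, is turned by `runs-im` into a sum over runs.
  altW-odd : ∀ n α → sum α ≡ n → n % 2 ≡ 1 → altW r n α ≡ gops D (λ _ → 0ℚ) X α secTanC 0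
  altW-odd n α α≡n odd = trans (altW-unique r (λ β → gops D s X β secTanC 0) 1 recurrence n α α≡n odd) (gops-s X α secTanC 0)
    where
    ŝ : Bool → ℚ
    ŝ b = if b then - 1ℚ else 1ℚ
    open Runs ŝ
    s≡0 : ∀ b → s b ≡ 0ℚ
    s≡0 true  = refl
    s≡0 false = refl
    gops-s : ∀ {k} (X : Subset k) α a → gops D s X α a ≗ gops D (λ _ → 0ℚ) X α a
    gops-s []      []      a n = refl
    gops-s (x ∷ X) (m ∷ α) a n = trans (cong (λ c → gop D c m (gops D s X α a) n) (s≡0 x)) (cong-≗ (gop-linear D-linear _ m) (gops-s X α a) n)
    one-odd : ∀ n → n % 2 ≡ 1 → one n ≡ 0ℚ
    one-odd (suc n) _ = refl
    conv-one-sin : conv one sinC ≗ sinC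
    conv-one-sin n = trans (conv-comm one sinC n) (conv-one sinC n)
    -- With s = 0 the operators fix the series 1, leaving `1₀` behind the run; only runs that use up
    -- all letters contribute, hence the single term at length `sum α`.
    runs-only-full : ∀ α → antidiag (λ a _ → imI a * runW (ltAB X) a (λ β → gops D s X β one 0) α) (sum α) ≡ imI (sum α) * runW r (sum α) 1₀ α
    runs-only-full α = begin
      antidiag (λ a _ → imI a * runW (ltAB X) a (λ β → gops D s X β one 0) α) (sum α)
        ≡⟨ antidiag-cong (sum α) (λ a _ _ → cong (imI a *_) (trans (runW-cong (ltAB X) a α (λ β _ → trans (gops₀-one s s≡0 X β 0) (ℚₚ.*-identityʳ (1₀ β)))) (sym (run≡ a 1₀ α)))) ⟩
      antidiag (λ a _ → imI a * runW r a 1₀ α) (sum α)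
        ≡⟨ antidiag-last (λ a _ → imI a * runW r a 1₀ α) (sum α) (λ a _ a<n → trans (cong (imI a *_) (short a a<n)) (ℚₚ.*-zeroʳ (imI a))) ⟩
      imI (sum α) * runW r (sum α) 1₀ α
        ∎
      where
      short : ∀ a → a < sum α → runW r a 1₀ α ≡ 0ℚ
      short a a<n = trans
        (runW-cong r a α (λ β eq → 1₀-positive β (ℕₚ.+-cancelˡ-< a 0 (sum β) (subst (a ℕ.+ 0 <_) (sym eq) (subst (_< sum α) (sym (ℕₚ.+-identityʳ a)) a<n)))))
        (sumW-zero a (λ w → ⟦ run r w ⟧ * δ* w (λ _ → 0ℚ) α) (λ w → trans (cong (⟦ run r w ⟧ *_) (linear-zero (δ*-linear w) α)) (ℚₚ.*-zeroʳ ⟦ run r w ⟧)))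
    recurrence : ∀ α → sum α % 2 ≡ 1 → antidiag (λ a _ → reI a * runW r a (λ β → gops D s X β secTanC 0) α) (sum α) ≡
      one (sum α) * 1₀ α + imI (sum α) * runW r (sum α) 1₀ α
    recurrence α odd = begin
      antidiag (λ a _ → reI a * runW r a (λ β → gops D s X β secTanC 0) α) (sum α)
        ≡⟨ trans (transfer (λ β → gops D s X β secTanC 0) α) (umbral-recurrence X α) ⟩
      gops D ŝ X α one 0 + gops D ŝ X α sinC 0
        ≡⟨ cong₂ _+_ (gops-one-odd ŝ X α odd) (cong-≗ (gops-linear D-linear ŝ X α) (sym ∘ conv-one-sin) 0) ⟩
      0ℚ + gops D ŝ X α (conv one sinC) 0
        ≡⟨ cong₂ _+_ (trans (sym (ℚₚ.*-zeroˡ (1₀ α))) (cong (_* 1₀ α) (sym (one-odd (sum α) odd)))) (trans (sym (runs-im X α one)) (runs-only-full α)) ⟩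
      one (sum α) * 1₀ α + imI (sum α) * runW r (sum α) 1₀ α
        ∎

-- Counting the permutations as alternating words of one relation

countWords : ∀ {k} n (α : Vec ℕ k) (p : List (Fin k) → Bool) r → (∀ w → p w ≡ alt r true w) →
  ℕtoℚ (length (filterᵇ (λ w → isαPerm α w ∧ p w) (words k n))) ≡ altW r n α
countWords {k} n α p r p≡alt = begin
  ℕtoℚ (length (filterᵇ (λ w → isαPerm α w ∧ p w) (words k n)))  ≡⟨ length-filterᵇ (λ w → isαPerm α w ∧ p w) (words k n) ⟩
  ∑ (λ w → ⟦ isαPerm α w ∧ p w ⟧) (words k n)                    ≡⟨ ∑-words k n (λ w → ⟦ isαPerm α w ∧ p w ⟧) ⟩
  sumW n (λ w → ⟦ isαPerm α w ∧ p w ⟧)                           ≡⟨ sumW-cong n (λ w _ → trans (⟦∧⟧ (isαPerm α w) (p w))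
      (trans (ℚₚ.*-comm ⟦ isαPerm α w ⟧ ⟦ p w ⟧) (cong₂ (λ b x → ⟦ b ⟧ * x) (p≡alt w) (isαPerm-δ* w α)))) ⟩
  altW r n α                                                     ∎

module _ {k} (A B : Subset k) (B≡ : ∀ i → lookup B i ≡ not (lookup A i)) where

  private
    <ᵇ-flip : ∀ m n → m ≢ n → (m <ᵇ n) ≡ not (n <ᵇ m)
    <ᵇ-flip zero    zero    m≢n = ⊥-elim (m≢n refl)
    <ᵇ-flip zero    (suc n) m≢n = refl
    <ᵇ-flip (suc m) zero    m≢n = refl
    <ᵇ-flip (suc m) (suc n) m≢n = <ᵇ-flip m n (m≢n ∘ cong suc)

  ltAB-not : ∀ x y → ltAB B x y ≡ not (gtAB A x y)
  ltAB-not x y with x Fin.≟ y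
  ... | yes _  = B≡ x
  ... | no x≢y = <ᵇ-flip (toℕ x) (toℕ y) (x≢y ∘ Finₚ.toℕ-injective)

  -- Words beginning with a descent are read through `gtAB A`, and by `altFrom-lt` those beginning
  -- with an ascent through `ltAB B`, so that in either case the first step is r itself.
  altFrom-gt : ∀ d w → altFrom A B d w ≡ alt (gtAB A) d w
  altFrom-gt d     []          = refl
  altFrom-gt d     (x ∷ [])    = refl
  altFrom-gt true  (x ∷ y ∷ w) = cong (gtAB A x y ∧_) (altFrom-gt false (y ∷ w))
  altFrom-gt false (x ∷ y ∷ w) = cong₂ _∧_ (ltAB-not x y) (altFrom-gt true (y ∷ w))

  altFrom-lt : ∀ d w → altFrom A B d w ≡ alt (ltAB B) (not d) w
  altFrom-lt d     []          = refl
  altFrom-lt d     (x ∷ [])    = refl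
  altFrom-lt true  (x ∷ y ∷ w) = cong₂ _∧_ (trans (sym (Boolₚ.not-involutive (gtAB A x y))) (cong not (sym (ltAB-not x y)))) (altFrom-lt false (y ∷ w))
  altFrom-lt false (x ∷ y ∷ w) = cong (ltAB B x y ∧_) (altFrom-lt true (y ∷ w))

complement : ∀ {k} (A B : Subset k) → A ∩ B ≡ ⊥ → A ∪ B ≡ ⊤ → ∀ i → lookup B i ≡ not (lookup A i)
complement (true  ∷ A) (true  ∷ B) ()  ∪≡⊤ zero
complement (true  ∷ A) (false ∷ B) ∩≡⊥ ∪≡⊤ zero    = refl
complement (false ∷ A) (true  ∷ B) ∩≡⊥ ∪≡⊤ zero    = refl
complement (false ∷ A) (false ∷ B) ∩≡⊥ ()  zero
complement (a ∷ A)     (b ∷ B)     ∩≡⊥ ∪≡⊤ (suc i) = complement A B (Vecₚ.∷-injectiveʳ ∩≡⊥) (Vecₚ.∷-injectiveʳ ∪≡⊤) i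

theorem7p3 : (k n : ℕ) (α : Vec ℕ k) → (∀ (i : Fin k) → 0 < lookup α i) → sum α ≡ n →
    (A B : Subset k) → A ∩ B ≡ ⊥ → A ∪ B ≡ ⊤ →
    (n % 2 ≡ 1 → (ℕtoℚ (Nalt n α A B) ≡ rhs α A B σodd) × (ℕtoℚ (Nralt n α A B) ≡ rhs α A B σodd))
    × (n % 2 ≡ 0 → (ℕtoℚ (Nalt n α A B) ≡ rhs α A B σminus) × (ℕtoℚ (Nralt n α A B) ≡ rhs α A B σplus))
theorem7p3 k n α _ α≡n A B ∩≡⊥ ∪≡⊤ =
  -- Exponent 0 is its own negative, so e and h behave alike and N and N* share one right-hand side.
  (λ odd → trans Nalt≡ (trans (altW-odd gt A gt-run n α α≡n odd) (sym (rhs-gops σodd-isSpec (λ _ → 0ℚ) α A B A B≡ s₀)))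
         , trans Nralt≡ (trans (altW-odd lt B lt-run n α α≡n odd) (sym (rhs-gops σodd-isSpec (λ _ → 0ℚ) α A B B B≡ s₀)))) ,
  -- Letters that a run may repeat need s = 1, the others s = - 1. For N these letters are the
  -- members of A, with factor e and s = - p_2, so p_2 = - 1; for N* they are the members of B, with
  -- factor h and s = p_2, so p_2 = 1.
  (λ even → trans Nalt≡ (trans (altW-even gt A gt-run n α α≡n even) (sym (rhs-gops σminus-isSpec s± α A B A B≡ s-A)))
          , trans Nralt≡ (trans (altW-even lt B lt-run n α α≡n even) (sym (rhs-gops σplus-isSpec s± α A B B B≡ s-B))))
  where
  B≡ = complement A B ∩≡⊥ ∪≡⊤
  gt = gtAB A
  lt = ltAB B
  gt-run : ∀ n φ α → runW gt n φ α ≡ runW (ltAB A) n φ α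
  gt-run = runW-flip (gtAB-flip A)
  lt-run : ∀ n φ α → runW lt n φ α ≡ runW (ltAB B) n φ α
  lt-run n φ α = refl
  Nalt≡ : ℕtoℚ (Nalt n α A B) ≡ altW gt n α
  Nalt≡ = countWords n α (altFrom A B true) gt (altFrom-gt A B B≡ true)
  Nralt≡ : ℕtoℚ (Nralt n α A B) ≡ altW lt n α
  Nralt≡ = countWords n α (altFrom A B false) lt (altFrom-lt A B B≡ false)
  s± : Bool → ℚ
  s± b = if b then 1ℚ else - 1ℚ
  s₀ : ∀ i → 0ℚ ≡ (if lookup A i then - 0ℚ else 0ℚ)
  s₀ i with lookup A i
  ... | true  = refl
  ... | false = refl
  s-A : ∀ i → s± (lookup A i) ≡ (if lookup A i then - - 1ℚ else - 1ℚ)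
  s-A i with lookup A i
  ... | true  = refl
  ... | false = refl
  s-B : ∀ i → s± (lookup B i) ≡ (if lookup A i then - 1ℚ else 1ℚ)
  s-B i rewrite B≡ i with lookup A i
  ... | true  = refl
  ... | false = refl
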